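{- Let $G$ be a minimal non-$4$-choosable planar graph, embedded in the plane, and let $v$ be a vertex of degree $5$ in $G$. Then at least three of the faces incident to $v$ are each incident to at least two vertices of degree at least $5$.
   Context: All graphs are finite, simple and undirected. A graph is $4$-choosable if for every assignment of lists of size $4$ to its vertices there is a proper coloring choosing each vertex's color from its list. A minimal non-$4$-choosable planar graph is a planar graph that is not $4$-choosable and has the minimum number of vertices among such graphs. A face is incident to a vertex if the vertex lies on its boundary. -}

module Defs where

open import Data.Nat using (ℕ; zero; suc; _+_; _*_; _<_; _≥_)
open import Data.Fin using (Fin)
open import Data.Bool using (Bool; true; false; if_then_else_)
open import Data.List using (List; length; map; allFin)
open import Data.Nat.ListAction using (sum)
open import Data.List.Membership.Propositional using (_∈_)
open import Data.List.Relation.Unary.Unique.Propositional using (Unique)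
open import Data.Product using (Σ; ∃; ∃-syntax; Σ-syntax; _×_; _,_)
open import Relation.Binary.PropositionalEquality using (_≡_; _≢_)
open import Relation.Nullary using (¬_)

record Graph (n : ℕ) : Set where
  field
    adj     : Fin n → Fin n → Bool
    adj-sym : ∀ u w → adj u w ≡ adj w u
    adj-irr : ∀ u → adj u u ≡ false
open Graph public

Adj : ∀ {n} → Graph n → Fin n → Fin n → Set
Adj G u w = adj G u w ≡ true

bool→ℕ : Bool → ℕ
bool→ℕ b = if b then 1 else 0

degree : ∀ {n} → Graph n → Fin n → ℕ
degree {n} G v = sum (map (λ w → bool→ℕ (adj G v w)) (allFin n))

dartCount : ∀ {n} → Graph n → ℕ
dartCount {n} G = sum (map (degree G) (allFin n))

isZero : ℕ → Bool
isZero zero    = true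
isZero (suc _) = false

isolatedCount : ∀ {n} → Graph n → ℕ
isolatedCount {n} G = sum (map (λ v → bool→ℕ (isZero (degree G v))) (allFin n))

Choosable4 : ∀ {n} → Graph n → Set
Choosable4 {n} G =
  (L : Fin n → List ℕ) → (∀ v → length (L v) ≡ 4 × Unique (L v)) →
  Σ[ c ∈ (Fin n → ℕ) ] ((∀ v → c v ∈ L v) × (∀ u w → Adj G u w → c u ≢ c w))

data Reach {n} (G : Graph n) : Fin n → Fin n → Set where
  here : ∀ {u} → Reach G u u
  step : ∀ {u w x} → Adj G u w → Reach G w x → Reach G u x

ComponentCount : ∀ {n} → Graph n → ℕ → Set
ComponentCount {n} G c =
  Σ (Fin c → Fin n) λ rep →
    (∀ i j → i ≢ j → ¬ Reach G (rep i) (rep j)) ×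
    (∀ v → ∃[ i ] Reach G (rep i) v)

iter : ∀ {A : Set} → (A → A) → ℕ → A → A
iter f zero    x = x
iter f (suc k) x = f (iter f k x)

-- rot v is a cyclic permutation of the neighbourhood of v
-- (the clockwise order of the edges around v); its values at
-- non-neighbours are irrelevant.
record Rotation {n} (G : Graph n) : Set where
  field
    rot    : Fin n → Fin n → Fin n
    rot-adj : ∀ v w → Adj G v w → Adj G v (rot v w)
    rot-cyc : ∀ v w w' → Adj G v w → Adj G v w' → ∃[ k ] iter (rot v) k w ≡ w'
open Rotation public

record Dart {n} (G : Graph n) : Set where
  constructor dart
  field
    tl  : Fin n
    hd  : Fin n
    arc : Adj G tl hd
open Dart public

flipAdj : ∀ {n} (G : Graph n) {u w} → Adj G u w → Adj G w u
flipAdj G {u} {w} p rewrite adj-sym G w u = p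

faceNext : ∀ {n} {G : Graph n} → Rotation G → Dart G → Dart G
faceNext {G = G} R (dart u w p) = dart w (rot R w u) (rot-adj R w u (flipAdj G p))

-- d' lies on the facial walk of d (faces = orbits of faceNext)
SameFace : ∀ {n} {G : Graph n} → Rotation G → Dart G → Dart G → Set
SameFace R d d' =
  ∃[ k ] (tl (iter (faceNext R) k d) ≡ tl d' × hd (iter (faceNext R) k d) ≡ hd d')

OnFace : ∀ {n} {G : Graph n} → Rotation G → Dart G → Fin n → Set
OnFace R d x = ∃[ k ] tl (iter (faceNext R) k d) ≡ x

FaceCount : ∀ {n} {G : Graph n} → Rotation G → ℕ → Set
FaceCount {G = G} R f =
  Σ (Fin f → Dart G) λ rep →
    (∀ i j → i ≢ j → ¬ SameFace R (rep i) (rep j)) ×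
    (∀ d → ∃[ i ] SameFace R (rep i) d)

-- The rotation system is a plane embedding: every component is of
-- genus 0, i.e. (Euler) n - e + f + (#isolated vertices) = 2 c,
-- written multiplied by 2 (2e = number of darts).
IsPlane : ∀ {n} {G : Graph n} → Rotation G → Set
IsPlane {n} {G} R =
  Σ ℕ λ f → Σ ℕ λ c →
    FaceCount R f × ComponentCount G c ×
    (2 * n + 2 * f + 2 * isolatedCount G ≡ 4 * c + dartCount G)

Planar : ∀ {n} → Graph n → Set
Planar G = Σ (Rotation G) IsPlane

MinimalNon4ChoosablePlanar : ∀ {n} → Graph n → Set
MinimalNon4ChoosablePlanar {n} G =
  Planar G × ¬ Choosable4 G ×
  (∀ m (H : Graph m) → m < n → Planar H → Choosable4 H)

FaceHasTwoBig : ∀ {n} {G : Graph n} → Rotation G → Dart G → Set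
FaceHasTwoBig {n} {G} R d =
  ∃[ x ] ∃[ y ] (x ≢ y × OnFace R d x × OnFace R d y ×
                 degree G x ≥ 5 × degree G y ≥ 5)

{-# OPTIONS --safe #-}
module Submission where

-- Fix lists L from which G has no colouring, and call a vertex low if its degree is at most 4.  By minimality, every minor
-- of G with fewer vertices can be coloured from arbitrary lists of four colours.  Three consequences for a vertex v of
-- degree 5:
--
-- (1) Let A and B be vertex sets without edges between them, and let a path outside them join a ∈ A to b ∈ B.
--     Contracting it identifies a with b, and the colours of B may be permuted first; so the colours that a takes in
--     colourings of A and those that b takes in colourings of B number at least five.  In particular v is on no bridge.
--
-- (2) No three neighbours of v are joined by low vertices other than v.  A minimal connected set doing this consists of
--     three legs and a core, which is a vertex or a triangle.  Any colouring of the rest leaves two colours for v.  For one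
--     of them a leg has a choice, or else its end repeats the colour of v for both, or takes the opposite one for both.
--     This colours everything unless the core is a triangle and all legs behave alike, which is avoided by first colouring
--     the minor in which the ends of two legs are adjacent.  There remains the case of empty legs: v and the triangle form
--     a K₄, its outer neighbours are not all connected in the rest (K₅ is not planar), and (1) applies.
--
-- (3) If G − v separates two neighbours of v from the other three, then no two of these three are joined by low vertices
--     other than v: otherwise they leave v a single colour, and (1) applies to a suitable contraction.
--
-- Planarity enters through Euler's formula for a rotation σ of the darts and their reversal α, where vertices are the
-- cycles of σ and faces those of σα.  Deleting an edge multiplies α by a transposition, so by induction no map violates the
-- Euler inequality; hence minors of plane maps are plane, and a vertex meeting a face twice is a cut vertex.
--
-- A face at v on which every other vertex is low joins consecutive neighbours of v by low vertices.  If the five corners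
-- of v lie on distinct faces, then by (2) no two such faces are consecutive.  If a face has two corners at v, then by (1)
-- they separate two neighbours from three, and by (3) at most one of the four faces is of this kind.

-- A vertex of degree at most four keeps at least as many colours as it has uncoloured neighbours,
-- which is the setting of degree-choosability. The vertex v falls short by one: with three
-- neighbours uncoloured, up to two are coloured, so only two colours are certain. This deficit is
-- why (2) compares two schemes instead of colouring greedily. A tight leg transmits the colour of v
-- or its opposite like a signal, and only equal signals at a triangle resist.
--
-- List colourings of the two sides of a cut vertex need not agree on it, and lists forbid permuting
-- colours freely.
--
-- The five in (1) is one more than the length of a list: if the attained colours number at most
-- four in total, some bijection between the two lists sends no attained colour to an attained one,
-- whereas identified vertices would receive such a pair.
--
-- The minors used for colouring keep the vertex set of G, with at least one vertex isolated;
-- colourings of minors are thus functions on the vertices of G.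

open import Defs
open import Data.Nat using (ℕ; zero; suc; _+_; _*_; _∸_; _≤_; _<_; _≤?_; z≤n; s≤s)
open import Data.Nat.Properties
open import Data.Nat.ListAction using (sum)
open import Data.Nat.ListAction.Properties using (sum-++)
open import Data.Nat.Solver using (module +-*-Solver)
open +-*-Solver using (solve; con; _:+_; _:*_; _:=_)
open import Data.Fin as Fin using (Fin; zero; suc; punchIn; punchOut; remQuot; toℕ; #_)
import Data.Fin.Properties as Finₚ
open import Data.Bool as Bool using (Bool; true; false; not)
open import Data.Bool.Properties using (¬-not)
open import Data.List using (List; []; _∷_; _++_; length; map; allFin; filter; lookup; cartesianProduct; upTo)
open import Data.List.Properties using (map-∘; map-++; map-cong; length-map; length-upTo; length-++; filter-notAll)
open import Data.List.Membership.Propositional using (_∈_; _∉_; find; lose)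
import Data.List.Membership.DecPropositional as DecMem
open import Data.List.Membership.Propositional.Properties using (∈-allFin; ∈-cartesianProduct⁺; ∈-filter⁺; ∈-filter⁻; ∈-lookup; ∈-map⁺; ∈-map⁻; ∈-++⁺ˡ; ∈-++⁺ʳ; ∈-++⁻; ∈-upTo⁺)
open import Data.List.Relation.Binary.Pointwise using (Pointwise; []; _∷_)
open import Data.List.Relation.Unary.All as All using (All; []; _∷_)
open import Data.List.Relation.Unary.AllPairs using (AllPairs; []; _∷_)
open import Data.List.Relation.Unary.Any as Any using (Any; here; there; index)
open import Data.List.Relation.Unary.Any.Properties using (lookup-index)
open import Data.List.Relation.Unary.Unique.Propositional using (Unique)
import Data.List.Relation.Unary.Unique.Propositional.Properties as Uniqueₚ
open import Data.Product using (Σ; ∃-syntax; Σ-syntax; _×_; _,_; proj₁; proj₂)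
open import Data.Sum using (_⊎_; inj₁; inj₂)
open import Data.Empty using (⊥; ⊥-elim)
open import Function using (_∘_; id; case_of_)
open import Relation.Binary using (IsEquivalence; DecidableEquality; Decidable; tri<; tri≈; tri>)
open import Relation.Binary.Construct.Closure.Equivalence as Clo using (EqClosure)
open import Relation.Binary.Construct.Closure.ReflexiveTransitive using (ε; _◅◅_)
open import Relation.Binary.PropositionalEquality using (_≡_; _≢_; refl; sym; trans; cong; cong₂; subst; subst₂; isEquivalence)
open import Relation.Nullary using (¬_; Dec; yes; no; contradiction; does)
open import Relation.Nullary.Decidable using (decidable-stable; map′; _⊎-dec_; _×-dec_; _→-dec_; ¬?; dec-true; dec-false; ⌊_⌋; toWitness)

private variable
  Elem Elem′ : Set
  k l n : ℕ

-- Counting equivalence classes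

-- `FaceCount` and `ComponentCount` unfold to this shape, so facts about `Count` apply to them
-- directly.
Count : {Elem : Set} → (Elem → Elem → Set) → ℕ → Set
Count {Elem} R k =
  Σ (Fin k → Elem) λ rep →
    (∀ i j → i ≢ j → ¬ R (rep i) (rep j)) ×
    (∀ a → ∃[ i ] R (rep i) a)

_⇔′_ : {Elem : Set} → (Elem → Elem → Set) → (Elem → Elem → Set) → Set
R ⇔′ S = (∀ {a b} → R a b → S a b) × (∀ {a b} → S a b → R a b)

count-≤ : {R : Elem → Elem → Set} {S : Elem′ → Elem′ → Set} → IsEquivalence S → (f : Elem → Elem′) →
  (∀ {a a′} → S (f a) (f a′) → R a a′) → Count R k → Count S l → k ≤ l
count-≤ {S = S} eqS f back (rep , dist , _) (rep′ , _ , cov) =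
  Finₚ.injective⇒≤ {f = λ i → proj₁ (cov (f (rep i)))} λ {i} {j} e →
    decidable-stable (i Finₚ.≟ j) λ i≢j → dist i j i≢j (back (S.trans
      (S.sym (proj₂ (cov (f (rep i)))))
      (subst (λ t → S (rep′ t) (f (rep j))) (sym e) (proj₂ (cov (f (rep j)))))))
  where module S = IsEquivalence eqS

count-unique : {R : Elem → Elem → Set} → IsEquivalence R → Count R k → Count R l → k ≡ l
count-unique eqR p q = ≤-antisym (count-≤ eqR id id p q) (count-≤ eqR id id q p)

count-map : {R : Elem → Elem → Set} {S : Elem′ → Elem′ → Set} → IsEquivalence S → (f : Elem → Elem′) →
  (∀ {a a′} → S (f a) (f a′) → R a a′) → (∀ {a a′} → R a a′ → S (f a) (f a′)) →
  (∀ b → ∃[ a ] S (f a) b) → Count R k → Count S k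
count-map eqS f back fore onto (rep , dist , cov) =
  (λ i → f (rep i)) , (λ i j i≢j s → dist i j i≢j (back s)) , λ b →
    let a , s = onto b ; i , r = cov a in i , IsEquivalence.trans eqS (fore r) s

count-resp : {R S : Elem → Elem → Set} → IsEquivalence S → R ⇔′ S → Count R k → Count S k
count-resp eqS (to , from) = count-map eqS id from to (λ b → b , IsEquivalence.refl eqS)

count-list : {R : Elem → Elem → Set} (rs : List Elem) → (∀ {a b} → R a b → R b a) →
  AllPairs (λ a b → ¬ R a b) rs → (∀ a → ∃[ b ] (b ∈ rs × R b a)) → Count R (length rs)
count-list {R = R} rs symR ap cov = lookup rs , dist rs ap , λ a →
  let b , b∈ , r = cov a in index b∈ , subst (λ t → R t a) (lookup-index b∈) r
  where
  dist : ∀ xs → AllPairs (λ a b → ¬ R a b) xs → ∀ i j → i ≢ j → ¬ R (lookup xs i) (lookup xs j)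
  dist (x ∷ xs) (p ∷ ps) zero    zero    i≢j r = i≢j refl
  dist (x ∷ xs) (p ∷ ps) zero    (suc j) i≢j r = All.lookup p (∈-lookup {xs = xs} j) r
  dist (x ∷ xs) (p ∷ ps) (suc i) zero    i≢j r = All.lookup p (∈-lookup {xs = xs} i) (symR r)
  dist (x ∷ xs) (p ∷ ps) (suc i) (suc j) i≢j r = dist xs ps i j (i≢j ∘ cong suc) r

count-dec : {R : Elem → Elem → Set} → IsEquivalence R → Decidable R → (xs : List Elem) →
  (∀ a → ∃[ b ] (b ∈ xs × R b a)) → ∃[ k ] Count R k
count-dec {Elem = Elem} {R = R} eqR R? xs cov =
  let rs , ap , cov′ = go xs
  in length rs , count-list rs R.sym ap λ a →
       let b , b∈ , r = cov a ; c , c∈ , r′ = cov′ b b∈ in c , c∈ , R.trans r′ r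
  where
  module R = IsEquivalence eqR
  go : ∀ xs → Σ (List Elem) λ rs → AllPairs (λ a b → ¬ R a b) rs × (∀ a → a ∈ xs → ∃[ b ] (b ∈ rs × R b a))
  go [] = [] , [] , λ _ ()
  go (x ∷ xs) with go xs
  ... | rs , ap , c with Any? rs
    where
    Any? : ∀ ys → Dec (∃[ b ] (b ∈ ys × R b x))
    Any? [] = no λ ()
    Any? (y ∷ ys) with R? y x
    ... | yes r = yes (y , here refl , r)
    ... | no ¬r with Any? ys
    ...   | yes (b , b∈ , r) = yes (b , there b∈ , r)
    ...   | no ¬a = no λ { (b , here refl , r) → ¬r r ; (b , there b∈ , r) → ¬a (b , b∈ , r) }
  ... | yes (b , b∈ , r) = rs , ap , λ { a (here refl) → b , b∈ , r ; a (there a∈) → c a a∈ }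
  ... | no ¬a = x ∷ rs , All.tabulate (λ {b} b∈ r → ¬a (b , b∈ , R.sym r)) ∷ ap ,
        λ { a (here refl) → x , here refl , R.refl
          ; a (there a∈) → let b , b∈ , r = c a a∈ in b , there b∈ , r }

-- For an equivalence `R`, the equivalence generated by `R` and the pair x, y. The closed form keeps
-- decidability and counting elementary.
Add : {Elem : Set} → (Elem → Elem → Set) → Elem → Elem → Elem → Elem → Set
Add R x y a b = R a b ⊎ (R a x × R y b) ⊎ (R a y × R x b)

add-equiv : {R : Elem → Elem → Set} → IsEquivalence R → ∀ x y → IsEquivalence (Add R x y)
add-equiv {R = R} eqR x y = record { refl = inj₁ R.refl ; sym = sy ; trans = tr }
  where
  module R = IsEquivalence eqR
  sy : ∀ {a b} → Add R x y a b → Add R x y b a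
  sy (inj₁ r) = inj₁ (R.sym r)
  sy (inj₂ (inj₁ (p , q))) = inj₂ (inj₂ (R.sym q , R.sym p))
  sy (inj₂ (inj₂ (p , q))) = inj₂ (inj₁ (R.sym q , R.sym p))
  tr : ∀ {a b c} → Add R x y a b → Add R x y b c → Add R x y a c
  tr (inj₁ r) (inj₁ s) = inj₁ (R.trans r s)
  tr (inj₁ r) (inj₂ (inj₁ (p , q))) = inj₂ (inj₁ (R.trans r p , q))
  tr (inj₁ r) (inj₂ (inj₂ (p , q))) = inj₂ (inj₂ (R.trans r p , q))
  tr (inj₂ (inj₁ (p , q))) (inj₁ s) = inj₂ (inj₁ (p , R.trans q s))
  tr (inj₂ (inj₂ (p , q))) (inj₁ s) = inj₂ (inj₂ (p , R.trans q s))
  tr (inj₂ (inj₁ (p , q))) (inj₂ (inj₁ (p′ , q′))) = inj₂ (inj₁ (p , q′))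
  tr (inj₂ (inj₁ (p , q))) (inj₂ (inj₂ (p′ , q′))) = inj₁ (R.trans p q′)
  tr (inj₂ (inj₂ (p , q))) (inj₂ (inj₁ (p′ , q′))) = inj₁ (R.trans p q′)
  tr (inj₂ (inj₂ (p , q))) (inj₂ (inj₂ (p′ , q′))) = inj₂ (inj₂ (p , q′))

-- The classes of x and y merge, so the representative for y is dropped by `punchIn`, and its class
-- is redirected to that of x.
count-add : {R : Elem → Elem → Set} → IsEquivalence R → ∀ {x y} → ¬ R x y →
  Count R k → ∃[ l ] (k ≡ suc l × Count (Add R x y) l)
count-add {k = zero} eqR {x} ¬r (rep , dist , cov) with () ← proj₁ (cov x)
count-add {k = suc l} {R = R} eqR {x} {y} ¬r (rep , dist , cov) = l , refl ,
  (λ i → rep (punchIn j i)) , dist′ , cov′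
  where
  module R = IsEquivalence eqR
  j : Fin (suc l)
  j = proj₁ (cov y)
  notj : ∀ i → ¬ R (rep (punchIn j i)) y
  notj i r = dist (punchIn j i) j (Finₚ.punchInᵢ≢i j i) (R.trans r (R.sym (proj₂ (cov y))))
  dist′ : ∀ i i′ → i ≢ i′ → ¬ Add R x y (rep (punchIn j i)) (rep (punchIn j i′))
  dist′ i i′ ne (inj₁ r) = dist _ _ (ne ∘ Finₚ.punchIn-injective j i i′) r
  dist′ i i′ ne (inj₂ (inj₁ (p , q))) = notj i′ (R.sym q)
  dist′ i i′ ne (inj₂ (inj₂ (p , q))) = notj i p
  fromi : ∀ {a} i → R (rep i) a → i ≢ j → ∃[ t ] R (rep (punchIn j t)) a
  fromi {a} i r ne = punchOut (ne ∘ sym) , subst (λ t → R (rep t) a) (sym (Finₚ.punchIn-punchOut (ne ∘ sym))) r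
  cov′ : ∀ a → ∃[ i ] Add R x y (rep (punchIn j i)) a
  cov′ a with cov a
  ... | i , r with i Finₚ.≟ j
  ... | no ne = let t , r′ = fromi i r ne in t , inj₁ r′
  ... | yes refl = let i′ , rx = cov x
                       t , r′ = fromi i′ rx λ e → ¬r (R.trans (R.sym rx) (subst (λ t → R (rep t) y) (sym e) (proj₂ (cov y))))
                   in t , inj₂ (inj₁ (r′ , R.trans (R.sym (proj₂ (cov y))) r))

On₁ : {Elem : Set} {P : Elem → Set} → (Elem → Elem → Set) → Σ Elem P → Σ Elem P → Set
On₁ R a b = R (proj₁ a) (proj₁ b)

on₁-equiv : {P : Elem → Set} {R : Elem → Elem → Set} → IsEquivalence R → IsEquivalence (On₁ {P = P} R)
on₁-equiv eqR = record { refl = R.refl ; sym = R.sym ; trans = R.trans }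
  where module R = IsEquivalence eqR

count-split : {R : Elem → Elem → Set} {P : Elem → Set} → (∀ a → Dec (P a)) →
  (∀ {a b} → R a b → P a → P b) → (∀ {a b} → R a b → R b a) →
  Count (On₁ {P = P} R) k → Count (On₁ {P = ¬_ ∘ P} R) l → Count R (k + l)
count-split {Elem = Elem} {k = k} {l = l} {R = R} {P} P? resp symR (r₁ , d₁ , c₁) (r₂ , d₂ , c₂) =
  rep , dist , cov
  where
  rep′ : Fin k ⊎ Fin l → Elem
  rep′ (inj₁ i) = proj₁ (r₁ i)
  rep′ (inj₂ i) = proj₁ (r₂ i)
  rep : Fin (k + l) → Elem
  rep i = rep′ (Fin.splitAt k i)
  dist′ : ∀ x y → x ≢ y → ¬ R (rep′ x) (rep′ y)
  dist′ (inj₁ i) (inj₁ j) ne r = d₁ i j (ne ∘ cong inj₁) r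
  dist′ (inj₁ i) (inj₂ j) ne r = proj₂ (r₂ j) (resp r (proj₂ (r₁ i)))
  dist′ (inj₂ i) (inj₁ j) ne r = proj₂ (r₂ i) (resp (symR r) (proj₂ (r₁ j)))
  dist′ (inj₂ i) (inj₂ j) ne r = d₂ i j (ne ∘ cong inj₂) r
  dist : ∀ i j → i ≢ j → ¬ R (rep i) (rep j)
  dist i j ne = dist′ (Fin.splitAt k i) (Fin.splitAt k j) λ e → ne (trans (sym (Finₚ.join-splitAt k l i))
                  (trans (cong (Fin.join k l) e) (Finₚ.join-splitAt k l j)))
  cov : ∀ a → ∃[ i ] R (rep i) a
  cov a with P? a
  ... | yes p = let i , r = c₁ (a , p) in i Fin.↑ˡ l ,
                subst (λ t → R (rep′ t) a) (sym (Finₚ.splitAt-↑ˡ k i l)) r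
  ... | no ¬p = let i , r = c₂ (a , ¬p) in k Fin.↑ʳ i ,
                subst (λ t → R (rep′ t) a) (sym (Finₚ.splitAt-↑ʳ k l i)) r

iter-shift : (f : Elem → Elem) → ∀ k x → iter f k (f x) ≡ f (iter f k x)
iter-shift f zero    x = refl
iter-shift f (suc k) x = cong f (iter-shift f k x)

iter-+ : (f : Elem → Elem) → ∀ k l x → iter f (k + l) x ≡ iter f k (iter f l x)
iter-+ f zero    l x = refl
iter-+ f (suc k) l x = cong f (iter-+ f k l x)

module _ (_≟_ : DecidableEquality Elem) where

  swapWith : Elem → Elem → Elem → Elem
  swapWith x y z with z ≟ x | z ≟ y
  ... | yes _ | _     = y
  ... | no _  | yes _ = x
  ... | no _  | no _  = z

  swapWith-x : ∀ x y → swapWith x y x ≡ y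
  swapWith-x x y with x ≟ x | x ≟ y
  ... | yes _ | _ = refl
  ... | no p | _ = contradiction refl p

  swapWith-y : ∀ x y → swapWith x y y ≡ x
  swapWith-y x y with y ≟ x | y ≟ y
  ... | yes p | _ = p
  ... | no _ | yes _ = refl
  ... | no _ | no p = contradiction refl p

  swapWith-off : ∀ {x y z} → z ≢ x → z ≢ y → swapWith x y z ≡ z
  swapWith-off {x} {y} {z} p q with z ≟ x | z ≟ y
  ... | yes e | _ = contradiction e p
  ... | no _ | yes e = contradiction e q
  ... | no _ | no _ = refl

  swapWith-invol : ∀ x y z → swapWith x y (swapWith x y z) ≡ z
  swapWith-invol x y z = go (z ≟ x) (z ≟ y)
    where
    go : Dec (z ≡ x) → Dec (z ≡ y) → swapWith x y (swapWith x y z) ≡ z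
    go (yes refl) _ = trans (cong (swapWith x y) (swapWith-x x y)) (swapWith-y x y)
    go (no _) (yes refl) = trans (cong (swapWith x y) (swapWith-y x y)) (swapWith-x x y)
    go (no p) (no q) = trans (cong (swapWith x y) (swapWith-off p q)) (swapWith-off p q)

select : {P : Elem → Set} → (∀ a → Dec (P a)) → List Elem → List (Σ Elem P)
select P? [] = []
select P? (x ∷ xs) with P? x
... | yes p = (x , p) ∷ select P? xs
... | no  _ = select P? xs

∈-select : {P : Elem → Set} (P? : ∀ a → Dec (P a)) (xs : List Elem) → ∀ {a} → a ∈ xs → P a →
  ∃[ b ] (b ∈ select P? xs × proj₁ b ≡ a)
∈-select P? (x ∷ xs) (here refl) p with P? x
... | yes q = (x , q) , here refl , refl
... | no ¬p = contradiction p ¬p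
∈-select P? (x ∷ xs) (there i) p with P? x | ∈-select P? xs i p
... | yes q | b , b∈ , e = b , there b∈ , e
... | no _  | b , b∈ , e = b , b∈ , e

count-select : {P : Elem → Set} {R : Elem → Elem → Set} → IsEquivalence R → Decidable R → (∀ a → Dec (P a)) →
  (xs : List Elem) → (∀ a → a ∈ xs) → ∃[ k ] Count (On₁ {P = P} R) k
count-select eqR R? P? xs all = count-dec (on₁-equiv eqR) (λ a b → R? (proj₁ a) (proj₁ b)) (select P? xs)
  λ { (a , p) → let b , b∈ , e = ∈-select P? xs (all a) p in b , b∈ , IsEquivalence.reflexive eqR e }

abstract

  least : {P : ℕ → Set} → (∀ k → Dec (P k)) → ∀ k → P k → ∃[ j ] (P j × (∀ i → i < j → ¬ P i))
  least {P} P? k p = go k 0 (+-identityʳ k) λ _ ()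
    where
    go : ∀ f i → f + i ≡ k → (∀ j → j < i → ¬ P j) → ∃[ j ] (P j × (∀ i → i < j → ¬ P i))
    go zero i refl h = i , p , h
    go (suc f) i q h with P? i
    ... | yes p′ = i , p′ , h
    ... | no ¬p = go f (suc i) (trans (+-suc f i) q) λ j j<si → case m≤n⇒m<n∨m≡n (≤-pred j<si) of λ
                    { (inj₁ j<i) → h j j<i ; (inj₂ refl) → ¬p }

-- Arithmetic for Euler's formula

2c+2c : ∀ c → 2 * c + 2 * c ≡ 4 * c + 0
2c+2c = solve 1 (λ c → con 2 :* c :+ con 2 :* c := con 4 :* c :+ con 0) refl

2s+2[1+f] : ∀ s f → 2 * s + 2 * suc f ≡ 2 + (2 * s + 2 * f)
2s+2[1+f] = solve 2 (λ s f → con 2 :* s :+ con 2 :* (con 1 :+ f) := con 2 :+ (con 2 :* s :+ con 2 :* f)) refl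

2[1+s]+2f : ∀ s f → 2 * suc s + 2 * f ≡ 2 + (2 * s + 2 * f)
2[1+s]+2f = solve 2 (λ s f → con 2 :* (con 1 :+ s) :+ con 2 :* f := con 2 :+ (con 2 :* s :+ con 2 :* f)) refl

2[1+s]+2[1+f] : ∀ s f → 2 * suc s + 2 * suc f ≡ 2 * s + 2 * f + 4
2[1+s]+2[1+f] = solve 2 (λ s f → con 2 :* (con 1 :+ s) :+ con 2 :* (con 1 :+ f) := con 2 :* s :+ con 2 :* f :+ con 4) refl

4c+[2+e] : ∀ c e → 4 * c + (2 + e) ≡ 2 + (4 * c + e)
4c+[2+e] = solve 2 (λ c e → con 4 :* c :+ (con 2 :+ e) := con 2 :+ (con 4 :* c :+ e)) refl

2+[4c+[2+e]] : ∀ c e → 2 + (4 * c + (2 + e)) ≡ 4 * c + e + 4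
2+[4c+[2+e]] = solve 2 (λ c e → con 2 :+ (con 4 :* c :+ (con 2 :+ e)) := con 4 :* c :+ e :+ con 4) refl

4[1+c]+e : ∀ c e → 4 * suc c + e ≡ 2 + (4 * c + (2 + e))
4[1+c]+e = solve 2 (λ c e → con 4 :* (con 1 :+ c) :+ e := con 2 :+ (con 4 :* c :+ (con 2 :+ e))) refl

-- Permutations and the Euler inequality

record Finite : Set₁ where
  field
    D : Set
    _≟ᴰ_ : DecidableEquality D
    enum : List D
    complete : ∀ d → d ∈ enum

module FiniteMaps (F : Finite) where

  open Finite F

  Step : (D → D) → (D → D) → D → D → Set
  Step f g x y = (f x ≡ y) ⊎ (g x ≡ y)

  E : (D → D) → (D → D) → D → D → Set
  E f g = EqClosure (Step f g)

  -- Orbits are components with a repeated generator, so elimination, decidability and counting are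
  -- shared.
  O : (D → D) → D → D → Set
  O f = E f f

  Inj : (D → D) → Set
  Inj f = ∀ {x y} → f x ≡ f y → x ≡ y

  E-equiv : ∀ f g → IsEquivalence (E f g)
  E-equiv f g = Clo.isEquivalence (Step f g)

  E-elim : ∀ {f g} {R : D → D → Set} → IsEquivalence R →
    (∀ x → R x (f x)) → (∀ x → R x (g x)) → ∀ {x y} → E f g x y → R x y
  E-elim eqR pf pg = Clo.fold eqR λ { (inj₁ refl) → pf _ ; (inj₂ refl) → pg _ }

  E-f : ∀ {f g} x → E f g x (f x)
  E-f x = Clo.return (inj₁ refl)

  E-g : ∀ {f g} x → E f g x (g x)
  E-g x = Clo.return (inj₂ refl)

  E-sym : ∀ {f g x y} → E f g x y → E f g y x
  E-sym = Clo.symmetric _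

  O-iter : ∀ {f g} k x → E f g x (iter f k x)
  O-iter zero    x = ε
  O-iter (suc k) x = O-iter k x ◅◅ E-f _

  private
    -- Finitely many generating pairs give a relation that is decidable by recursion on the list;
    -- `E` is decided through the span of the graphs of both maps.
    Span : List (D × D) → D → D → Set
    Span [] = _≡_
    Span ((x , y) ∷ ps) = Add (Span ps) x y

    span-equiv : ∀ ps → IsEquivalence (Span ps)
    span-equiv [] = isEquivalence
    span-equiv ((x , y) ∷ ps) = add-equiv (span-equiv ps) x y

    span? : ∀ ps → Decidable (Span ps)
    span? [] = _≟ᴰ_
    span? ((x , y) ∷ ps) a b = span? ps a b ⊎-dec ((span? ps a x ×-dec span? ps y b) ⊎-dec (span? ps a y ×-dec span? ps x b))

    span-∈ : ∀ ps {x y} → (x , y) ∈ ps → Span ps x y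
    span-∈ (p ∷ ps) (here refl) = inj₂ (inj₁ (IsEquivalence.refl (span-equiv ps) , IsEquivalence.refl (span-equiv ps)))
    span-∈ (p ∷ ps) (there i) = inj₁ (span-∈ ps i)

    span-⊆ : ∀ ps {R : D → D → Set} → IsEquivalence R → (∀ {x y} → (x , y) ∈ ps → R x y) → ∀ {a b} → Span ps a b → R a b
    span-⊆ [] eqR h refl = IsEquivalence.refl eqR
    span-⊆ (p ∷ ps) eqR h (inj₁ s) = span-⊆ ps eqR (h ∘ there) s
    span-⊆ (p ∷ ps) eqR h (inj₂ (inj₁ (s , t))) =
      R.trans (span-⊆ ps eqR (h ∘ there) s) (R.trans (h (here refl)) (span-⊆ ps eqR (h ∘ there) t))
      where module R = IsEquivalence eqR
    span-⊆ (p ∷ ps) eqR h (inj₂ (inj₂ (s , t))) =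
      R.trans (span-⊆ ps eqR (h ∘ there) s) (R.trans (R.sym (h (here refl))) (span-⊆ ps eqR (h ∘ there) t))
      where module R = IsEquivalence eqR

    gens : (D → D) → List (D × D)
    gens f = map (λ x → x , f x) enum

    ∈-gens : ∀ f {x y} → (x , y) ∈ gens f → f x ≡ y
    ∈-gens f = go enum
      where
      go : ∀ xs {x y} → (x , y) ∈ map (λ x → x , f x) xs → f x ≡ y
      go (x ∷ xs) (here refl) = refl
      go (x ∷ xs) (there i) = go xs i


  abstract

    E? : ∀ f g → Decidable (E f g)
    E? f g x y = map′ (span-⊆ ps (E-equiv f g) fromPs)
                      (E-elim (span-equiv ps)
                        (λ x → span-∈ ps (∈-++⁺ˡ (∈-map⁺ _ (complete x))))
                        (λ x → span-∈ ps (∈-++⁺ʳ (gens f) (∈-map⁺ _ (complete x)))))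
                      (span? ps x y)
      where
      ps : List (D × D)
      ps = gens f ++ gens g
      fromPs : ∀ {a b} → (a , b) ∈ ps → E f g a b
      fromPs i with ∈-++⁻ (gens f) i
      ... | inj₁ j = Clo.return (inj₁ (∈-gens f j))
      ... | inj₂ j = Clo.return (inj₂ (∈-gens g j))

    E-count : ∀ f g → ∃[ k ] Count (E f g) k
    E-count f g = count-dec (E-equiv f g) (E? f g) enum λ a → a , complete a , ε

    -- Among sufficiently many iterates two coincide, and injectivity strips their common prefix.
    period : ∀ {f} → Inj f → ∀ x → ∃[ k ] iter f (suc k) x ≡ x
    period {f} inj x with Finₚ.pigeonhole (n<1+n (length enum)) (λ i → index (complete (iter f (Fin.toℕ i) x)))
    ... | i , j , i<j , e = go (Fin.toℕ i) (Fin.toℕ j) i<j (trans (lookup-index (complete _)) (trans (cong (lookup enum) e) (sym (lookup-index (complete _)))))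
      where
      go : ∀ i j → i < j → iter f i x ≡ iter f j x → ∃[ k ] iter f (suc k) x ≡ x
      go zero    (suc j) _         e = j , sym e
      go (suc i) (suc j) (s≤s i<j) e = go i j i<j (inj e)

    -- By `period` a backward step is itself a forward iterate.
    O⇒iter : ∀ {f} → Inj f → ∀ {x y} → O f x y → ∃[ k ] iter f k x ≡ y
    O⇒iter {f} inj = E-elim (record { refl = 0 , refl ; sym = sy ; trans = tr }) (λ x → 1 , refl) (λ x → 1 , refl)
      where
      tr : ∀ {x y z} → ∃[ k ] iter f k x ≡ y → ∃[ k ] iter f k y ≡ z → ∃[ k ] iter f k x ≡ z
      tr {x} (k , refl) (l , refl) = l + k , iter-+ f l k x
      back : ∀ k {x y} → iter f k x ≡ y → ∃[ k ] iter f k y ≡ x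
      back zero    refl = 0 , refl
      back (suc k) {x} e with period inj (iter f k x)
      ... | p , q = tr (p , trans (cong (iter f p) (sym e)) (trans (iter-shift f p _) q)) (back k refl)
      sy : ∀ {x y} → ∃[ k ] iter f k x ≡ y → ∃[ k ] iter f k y ≡ x
      sy (k , e) = back k e

  -- π′ is π composed with the transposition of x and y, applied first. The pointwise form also fits
  -- edge deletion, where the change sits inside α.
  record Transposed (π π′ : D → D) (x y : D) : Set where
    field
      x≢y : x ≢ y
      atx : π′ x ≡ π y
      aty : π′ y ≡ π x
      off : ∀ z → z ≢ x → z ≢ y → π′ z ≡ π z

  module _ {π π′ x y} (inj : Inj π) (t : Transposed π π′ x y) where
    open Transposed t

    transposed-sym : Transposed π′ π x y
    transposed-sym = record { x≢y = x≢y ; atx = sym aty ; aty = sym atx ; off = λ z p q → sym (off z p q) }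

    transposed-inj : Inj π′
    transposed-inj {a} {b} e with a ≟ᴰ x | a ≟ᴰ y | b ≟ᴰ x | b ≟ᴰ y
    ... | yes refl | _        | yes refl | _        = refl
    ... | yes refl | _        | no _     | yes refl = contradiction (sym (inj (trans (sym atx) (trans e aty)))) x≢y
    ... | yes refl | _        | no p     | no q     = contradiction (sym (inj (trans (sym atx) (trans e (off b p q))))) q
    ... | no _     | yes refl | yes refl | _        = contradiction (inj (trans (sym aty) (trans e atx))) x≢y
    ... | no _     | yes refl | no _     | yes refl = refl
    ... | no _     | yes refl | no p     | no q     = contradiction (sym (inj (trans (sym aty) (trans e (off b p q))))) p
    ... | no p     | no q     | yes refl | _        = contradiction (inj (trans (sym (off a p q)) (trans e atx))) q
    ... | no p     | no q     | no _     | yes refl = contradiction (inj (trans (sym (off a p q)) (trans e aty))) p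
    ... | no p     | no q     | no p′    | no q′    = inj (trans (sym (off a p q)) (trans e (off b p′ q′)))

    -- From x, π′ enters the π-cycle of y and follows it. Since x is not on that cycle, the walk
    -- arrives at y.
    transposed-joins : ¬ O π x y → O π′ x y
    transposed-joins ¬o with period inj y
    ... | k , e with go k
      where
      go : ∀ k → O π′ x y ⊎ O π′ x (iter π (suc k) y)
      go zero = inj₂ (Clo.return (inj₁ atx))
      go (suc k) with go k
      ... | inj₁ o = inj₁ o
      ... | inj₂ o with iter π (suc k) y ≟ᴰ y
      ...   | yes q = inj₁ (subst (O π′ x) q o)
      ...   | no q with iter π (suc k) y ≟ᴰ x
      ...     | yes p = contradiction (E-sym (subst (O π y) p (O-iter (suc k) y))) ¬o
      ...     | no p = inj₂ (o ◅◅ Clo.return (inj₁ (off _ p q)))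
    ... | inj₁ o = o
    ... | inj₂ o = subst (O π′ x) e o

    -- The stretch from π x to the first occurrence of y avoids x and is closed under π′, which
    -- sends y back to π x.
    transposed-splits : O π x y → ¬ O π′ x y
    transposed-splits o o′ with least (λ i → iter π i x ≟ᴰ y) (proj₁ (O⇒iter inj o)) (proj₂ (O⇒iter inj o)) | O⇒iter transposed-inj (E-sym o′)
    ... | zero , e , _ | _ = x≢y e
    ... | suc k , e , min | l , e′ = let i , i≤k , q = P-iter l in
                                     notx i i≤k (trans (sym q) e′)
      where
      P : D → Set
      P z = ∃[ i ] (i ≤ k × z ≡ iter π (suc i) x)
      -- After a return to x, y would be reached in the remaining k - i steps, against the
      -- minimality of k + 1.
      notx : ∀ i → i ≤ k → iter π (suc i) x ≢ x
      notx i i≤k q = contradiction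
        (trans (sym e) (trans (cong (λ t → iter π t x) (sym (m∸n+n≡m (s≤s i≤k))))
          (trans (iter-+ π (suc k ∸ suc i) (suc i) x) (cong (iter π (suc k ∸ suc i)) q))))
        (λ eq → min (suc k ∸ suc i) (s≤s (m∸n≤m k i)) (sym eq))
      P-step : ∀ z → P z → P (π′ z)
      P-step z (i , i≤k , refl) with m≤n⇒m<n∨m≡n i≤k
      ... | inj₂ refl = 0 , z≤n , trans (cong π′ e) aty
      ... | inj₁ i<k = suc i , i<k , off _ (notx i i≤k) (min (suc i) (s≤s i<k))
      P-iter : ∀ l → P (iter π′ l y)
      P-iter zero = k , ≤-refl , sym e
      P-iter (suc l) = P-step _ (P-iter l)

    private
      ⊆Add : ∀ {a b} → O π′ a b → Add (O π) x y a b
      ⊆Add = E-elim (add-equiv (E-equiv π π) x y) st st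
        where
        st : ∀ z → Add (O π) x y z (π′ z)
        st z with z ≟ᴰ x | z ≟ᴰ y
        ... | yes refl | _ rewrite atx = inj₂ (inj₁ (ε , E-f y))
        ... | no _ | yes refl rewrite aty = inj₂ (inj₂ (ε , E-f x))
        ... | no p | no q rewrite off z p q = inj₁ (E-f z)

    O-join : ¬ O π x y → Add (O π) x y ⇔′ O π′
    O-join ¬o = add⊆ , ⊆Add
      where
      j = transposed-joins ¬o
      st : ∀ z → O π′ z (π z)
      st z with z ≟ᴰ x | z ≟ᴰ y
      ... | yes refl | _ = j ◅◅ Clo.return (inj₁ aty)
      ... | no _ | yes refl = E-sym j ◅◅ Clo.return (inj₁ atx)
      ... | no p | no q = Clo.return (inj₁ (off z p q))
      O⊆ : ∀ {a b} → O π a b → O π′ a b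
      O⊆ = E-elim (E-equiv π′ π′) st st
      add⊆ : ∀ {a b} → Add (O π) x y a b → O π′ a b
      add⊆ (inj₁ o) = O⊆ o
      add⊆ (inj₂ (inj₁ (p , q))) = O⊆ p ◅◅ (j ◅◅ O⊆ q)
      add⊆ (inj₂ (inj₂ (p , q))) = O⊆ p ◅◅ (E-sym j ◅◅ O⊆ q)

    count-join : ¬ O π x y → Count (O π) k → Count (O π′) l → k ≡ suc l
    count-join ¬o cπ cπ′ with count-add (E-equiv π π) ¬o cπ
    ... | l′ , refl , c = cong suc (count-unique (E-equiv π′ π′) (count-resp (E-equiv π′ π′) (O-join ¬o) c) cπ′)

  count-parts : ∀ {π π′ x y} → Inj π → Transposed π π′ x y → O π x y → Count (O π) k → Count (O π′) l → l ≡ suc k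
  count-parts inj t o c c′ = count-join (transposed-inj inj t) (transposed-sym inj t) (transposed-splits inj t o) c′ c

  Moved : (D → D) → D → Set
  Moved α d = α d ≢ d

  moved? : ∀ α d → Dec (Moved α d)
  moved? α d = ¬? (α d ≟ᴰ d)

  MovedCount : (D → D) → ℕ → Set
  MovedCount α = Count (On₁ {P = Moved α} _≡_)

  moved-count : ∀ α → ∃[ e ] MovedCount α e
  moved-count α = count-select isEquivalence _≟ᴰ_ (moved? α) enum complete

  Invol : (D → D) → Set
  Invol α = ∀ x → α (α x) ≡ x

  invol-inj : ∀ {α} → Invol α → Inj α
  invol-inj {α} inv {x} {y} e = trans (sym (inv x)) (trans (cong α e) (inv y))

  -- Deletion makes the two darts of an edge fixed points of α, so that neither the set of darts nor
  -- σ changes.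
  cut : (D → D) → D → D → D
  cut α d x with x ≟ᴰ d | x ≟ᴰ α d
  ... | yes _ | _     = x
  ... | no _  | yes _ = x
  ... | no _  | no _  = α x

  module _ (α : D → D) (inv : Invol α) (d : D) where

    cut-d : cut α d d ≡ d
    cut-d with d ≟ᴰ d | d ≟ᴰ α d
    ... | yes _ | _ = refl
    ... | no p | _ = contradiction refl p

    cut-αd : cut α d (α d) ≡ α d
    cut-αd with α d ≟ᴰ d | α d ≟ᴰ α d
    ... | yes _ | _ = refl
    ... | no _ | yes _ = refl
    ... | no _ | no p = contradiction refl p

    cut-off : ∀ z → z ≢ d → z ≢ α d → cut α d z ≡ α z
    cut-off z p q with z ≟ᴰ d | z ≟ᴰ α d
    ... | yes e | _ = contradiction e p
    ... | no _ | yes e = contradiction e q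
    ... | no _ | no _ = refl

    cut-case : ∀ z → cut α d z ≡ z ⊎ (cut α d z ≡ α z × z ≢ d × z ≢ α d)
    cut-case z with z ≟ᴰ d | z ≟ᴰ α d
    ... | yes e | _ = inj₁ refl
    ... | no _ | yes e = inj₁ refl
    ... | no p | no q = inj₂ (refl , p , q)

    cut-moved : ∀ {z} → Moved (cut α d) z → Moved α z × z ≢ d × z ≢ α d × cut α d z ≡ α z
    cut-moved {z} m with cut-case z
    ... | inj₁ e = contradiction e m
    ... | inj₂ (e , p , q) = (λ e′ → m (trans e e′)) , p , q , e

    cut-invol : Invol (cut α d)
    cut-invol z with cut-case z
    ... | inj₁ e = trans (cong (cut α d) e) e
    ... | inj₂ (e , p , q) = trans (cong (cut α d) e)
      (trans (cut-off (α z) (λ e′ → q (trans (sym (inv z)) (cong α e′))) (p ∘ invol-inj inv)) (inv z))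

    cut-transposed : ∀ σ → Moved α d → Transposed (σ ∘ α) (σ ∘ cut α d) d (α d)
    cut-transposed σ m = record
      { x≢y = m ∘ sym
      ; atx = cong σ (trans cut-d (sym (inv d)))
      ; aty = cong σ cut-αd
      ; off = λ z p q → cong σ (cut-off z p q) }

    moved-cut : ∀ {e e′} → Moved α d → MovedCount α e → MovedCount (cut α d) e′ → e ≡ 2 + e′
    moved-cut {e′ = e′} m c (rep , dist , cov) = count-unique (on₁-equiv isEquivalence) c (rep₂ , dist₂ , cov₂)
      where
      rep₂ : Fin (2 + e′) → Σ D (Moved α)
      rep₂ zero = d , m
      rep₂ (suc zero) = α d , λ q → m (invol-inj {α} inv q)
      rep₂ (suc (suc i)) = proj₁ (rep i) , proj₁ (cut-moved (proj₂ (rep i)))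
      dist₂ : ∀ i j → i ≢ j → proj₁ (rep₂ i) ≢ proj₁ (rep₂ j)
      dist₂ zero zero ne _ = ne refl
      dist₂ zero (suc zero) ne q = m (sym q)
      dist₂ zero (suc (suc j)) ne q = proj₁ (proj₂ (cut-moved (proj₂ (rep j)))) (sym q)
      dist₂ (suc zero) zero ne q = m q
      dist₂ (suc zero) (suc zero) ne q = ne refl
      dist₂ (suc zero) (suc (suc j)) ne q = proj₁ (proj₂ (proj₂ (cut-moved (proj₂ (rep j))))) (sym q)
      dist₂ (suc (suc i)) zero ne q = proj₁ (proj₂ (cut-moved (proj₂ (rep i)))) q
      dist₂ (suc (suc i)) (suc zero) ne q = proj₁ (proj₂ (proj₂ (cut-moved (proj₂ (rep i))))) q
      dist₂ (suc (suc i)) (suc (suc j)) ne q = dist i j (λ r → ne (cong (λ t → suc (suc t)) r)) q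
      cov₂ : ∀ a → ∃[ i ] proj₁ (rep₂ i) ≡ proj₁ a
      cov₂ (a , ma) with a ≟ᴰ d | a ≟ᴰ α d
      ... | yes q | _ = zero , sym q
      ... | no _ | yes q = suc zero , sym q
      ... | no p | no q = let i , r = cov (a , λ e → ma (trans (sym (cut-off a p q)) e)) in suc (suc i) , r

    module _ {σ : D → D} where

      E-cut⊆ : ∀ {a b} → E σ (cut α d) a b → E σ α a b
      E-cut⊆ = E-elim (E-equiv σ α) E-f λ x → case cut-case x of λ
        { (inj₁ e) → subst (E σ α x) (sym e) ε
        ; (inj₂ (e , _)) → subst (E σ α x) (sym e) (E-g x) }

      E-cut⊇ : ∀ {a b} → E σ α a b → Add (E σ (cut α d)) d (α d) a b
      E-cut⊇ = E-elim (add-equiv (E-equiv σ (cut α d)) d (α d)) (λ x → inj₁ (E-f x)) st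
        where
        st : ∀ x → Add (E σ (cut α d)) d (α d) x (α x)
        st x with x ≟ᴰ d | x ≟ᴰ α d
        ... | yes refl | _ = inj₂ (inj₁ (ε , ε))
        ... | no _ | yes refl = inj₂ (inj₂ (ε , subst (E σ (cut α d) d) (sym (inv d)) ε))
        ... | no p | no q = inj₁ (subst (E σ (cut α d) x) (cut-off x p q) (E-g x))

      E-cut-same : E σ (cut α d) d (α d) → E σ (cut α d) ⇔′ E σ α
      E-cut-same o = E-cut⊆ , λ e → case E-cut⊇ e of λ
        { (inj₁ r) → r ; (inj₂ (inj₁ (p , q))) → p ◅◅ (o ◅◅ q) ; (inj₂ (inj₂ (p , q))) → p ◅◅ (E-sym o ◅◅ q) }

      -- The transposition splits or joins one cycle of σα. If it joins two faces, the joined face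
      -- leads from d to α d without the deleted edge, so no component is lost.
      cut-step : Inj σ → Moved α d → ∀ {f f′ c c′} →
        Count (O (σ ∘ α)) f → Count (O (σ ∘ cut α d)) f′ → Count (E σ α) c → Count (E σ (cut α d)) c′ →
        (f′ ≡ suc f × (c′ ≡ c ⊎ c′ ≡ suc c)) ⊎ (f ≡ suc f′ × c′ ≡ c)
      cut-step injσ m {c = c} {c′} cf cf′ cc cc′ with E? (σ ∘ α) (σ ∘ α) d (α d)
      ... | no ¬o = inj₂ (count-join (invol-inj inv ∘ injσ) (cut-transposed σ m) ¬o cf cf′ , same)
        where
        o′ : E σ (cut α d) d (α d)
        o′ = E-elim (E-equiv σ (cut α d)) (λ x → E-g x ◅◅ E-f _) (λ x → E-g x ◅◅ E-f _)
               (transposed-joins (invol-inj inv ∘ injσ) (cut-transposed σ m) ¬o)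
        same : c′ ≡ c
        same = count-unique (E-equiv σ α) (count-resp (E-equiv σ α) (E-cut-same o′) cc′) cc
      ... | yes o = inj₁ (count-parts (invol-inj inv ∘ injσ) (cut-transposed σ m) o cf cf′ , cs)
        where
        cs : c′ ≡ c ⊎ c′ ≡ suc c
        cs with E? σ (cut α d) d (α d)
        ... | yes o′ = inj₁ (count-unique (E-equiv σ α) (count-resp (E-equiv σ α) (E-cut-same o′) cc′) cc)
        ... | no ¬o′ with count-add (E-equiv σ (cut α d)) ¬o′ cc′
        ...   | l , refl , cl = inj₂ (cong suc (count-unique (E-equiv σ α) (count-resp (E-equiv σ α) (back , E-cut⊇) cl) cc))
          where
          back : ∀ {a b} → Add (E σ (cut α d)) d (α d) a b → E σ α a b
          back (inj₁ r) = E-cut⊆ r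
          back (inj₂ (inj₁ (p , q))) = E-cut⊆ p ◅◅ (E-g d ◅◅ E-cut⊆ q)
          back (inj₂ (inj₂ (p , q))) = E-cut⊆ p ◅◅ (E-sym (E-g d) ◅◅ E-cut⊆ q)

  -- Non-negativity of the genus, doubled because e counts darts. Slack arises only where the
  -- deletion splits a face and the components stay.
  euler-≤ : ∀ e {σ α s f c} → Inj σ → Invol α → MovedCount α e →
    Count (O σ) s → Count (O (σ ∘ α)) f → Count (E σ α) c → 2 * s + 2 * f ≤ 4 * c + e
  euler-≤ zero {σ} {α} {s} {f} {c} injσ inv me cs cf cc = ≤-reflexive (trans (cong₂ (λ x y → 2 * x + 2 * y) s≡c f≡c) (2c+2c c))
    where
    fix : ∀ x → α x ≡ x
    fix x = decidable-stable (α x ≟ᴰ x) λ m → case proj₁ (proj₂ (proj₂ me) (x , m)) of λ ()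
    s≡c : s ≡ c
    s≡c = count-unique (E-equiv σ α) (count-resp (E-equiv σ α)
      ((λ o → E-elim (E-equiv σ α) E-f E-f o) ,
       (λ o → E-elim (E-equiv σ σ) E-f (λ x → subst (O σ x) (sym (fix x)) ε) o)) cs) cc
    f≡c : f ≡ c
    f≡c = count-unique (E-equiv σ α) (count-resp (E-equiv σ α)
      ((λ o → E-elim (E-equiv σ α) (λ x → E-g x ◅◅ E-f _) (λ x → E-g x ◅◅ E-f _) o) ,
       (λ o → E-elim (E-equiv (σ ∘ α) (σ ∘ α)) (λ x → subst (O (σ ∘ α) x) (cong σ (fix x)) (E-f x)) (λ x → subst (O (σ ∘ α) x) (sym (fix x)) ε) o)) cf) cc
  euler-≤ (suc e) {σ} {α} {s} {f} {c} injσ inv me cs cf cc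
    with proj₁ me zero
  ... | d , m with moved-count (cut α d) | E-count (σ ∘ cut α d) (σ ∘ cut α d) | E-count σ (cut α d)
  ... | e′ , me′ | f′ , cf′ | c′ , cc′ with moved-cut α inv d m me me′
  ... | refl with euler-≤ e′ injσ (cut-invol α inv d) me′ cs cf′ cc′ | cut-step α inv d injσ m cf cf′ cc cc′
  ... | ih | inj₁ (refl , inj₁ refl) = ≤-trans (+-monoʳ-≤ (2 * s) (*-monoʳ-≤ 2 (n≤1+n f))) (≤-trans ih (+-monoʳ-≤ (4 * c) (m≤n+m e′ 2)))
  ... | ih | inj₁ (refl , inj₂ refl) = +-cancelˡ-≤ 2 _ _ (subst₂ _≤_ (2s+2[1+f] s f) (4[1+c]+e c e′) ih)
  ... | ih | inj₂ (refl , refl) = subst₂ _≤_ (sym (2s+2[1+f] s f′)) (sym (4c+[2+e] c′ e′)) (s≤s (s≤s ih))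

  -- Euler's formula on darts alone: vertices without darts are invisible here and are accounted for
  -- in `toPlane` and `planar`.
  record Plane (σ α : D → D) : Set where
    constructor plane
    field
      {s f c e} : ℕ
      #σ : Count (O σ) s
      #φ : Count (O (σ ∘ α)) f
      #c : Count (E σ α) c
      #e : MovedCount α e
      euler : 2 * s + 2 * f ≡ 4 * c + e

  -- The remaining case of `cut-step`, a split face with the same components, would exceed `euler-≤`
  -- for the smaller map by four.
  plane-cut : ∀ {σ α} → Inj σ → (inv : Invol α) → ∀ d → Moved α d → Plane σ α → Plane σ (cut α d)
  plane-cut {σ} {α} injσ inv d m (plane {s} {f} {c} cs cf cc me eu)
    with moved-count (cut α d) | E-count (σ ∘ cut α d) (σ ∘ cut α d) | E-count σ (cut α d)
  ... | e′ , me′ | f′ , cf′ | c′ , cc′ with moved-cut α inv d m me me′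
  ... | refl with cut-step α inv d injσ m cf cf′ cc cc′
  ... | inj₁ (refl , inj₂ refl) = plane cs cf′ cc′ me′ (trans (2s+2[1+f] s f) (trans (cong (2 +_) eu) (sym (4[1+c]+e c e′))))
  ... | inj₂ (refl , refl) = plane cs cf′ cc′ me′ (+-cancelˡ-≡ 2 _ _ (trans (sym (2s+2[1+f] s f′)) (trans eu (4c+[2+e] c e′))))
  ... | inj₁ (refl , inj₁ refl) = contradiction
    (≤-trans (≤-reflexive (sym (trans (2s+2[1+f] s f) (trans (cong (2 +_) eu) (2+[4c+[2+e]] c e′))))) (euler-≤ e′ injσ (cut-invol α inv d) me′ cs cf′ cc′))
    (m+1+n≰m (4 * c + e′))

  swap : D → D → D → D
  swap = swapWith _≟ᴰ_

  swap-transposed : ∀ (π : D → D) {x y} → x ≢ y → Transposed π (π ∘ swap x y) x y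
  swap-transposed π {x} {y} x≢y = record
    { x≢y = x≢y ; atx = cong π (swapWith-x _≟ᴰ_ x y) ; aty = cong π (swapWith-y _≟ᴰ_ x y) ; off = λ z p q → cong π (swapWith-off _≟ᴰ_ p q) }

  -- Contracting the edge d merges the two vertex cycles and leaves the face permutation unchanged.
  module Merge (σ α : D → D) (injσ : Inj σ) (inv : Invol α) (d : D) (m : Moved α d) (¬o : ¬ O σ d (α d)) where

    merged : D → D
    merged = σ ∘ swap d (α d)

    merged-transposed : Transposed σ merged d (α d)
    merged-transposed = swap-transposed σ (m ∘ sym)

    merged-inj : Inj merged
    merged-inj = transposed-inj injσ merged-transposed

    merged-orbits : Add (O σ) d (α d) ⇔′ O merged
    merged-orbits = O-join injσ merged-transposed ¬o

    plane-contract : Plane σ α → Plane merged (cut α d)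
    plane-contract (plane {s} {f} {c} cs cf cc me eu) with E-count merged merged | moved-count (cut α d)
    ... | s′ , cs′ | e′ , me′ with moved-cut α inv d m me me′ | count-join injσ merged-transposed ¬o cs cs′
    ... | refl | refl = plane cs′ (count-resp (E-equiv _ _) (φ⊆ , φ⊇) cf)
                          (count-resp (E-equiv _ _) (E⊆ , E⊇) cc) me′
                          (+-cancelˡ-≡ 2 _ _ (trans (sym (2[1+s]+2f s′ f)) (trans eu (4c+[2+e] c e′))))
      where
      open Transposed merged-transposed
      -- The swap inside `merged` makes up for the two darts that `cut` has fixed.
      same : ∀ x → merged (cut α d x) ≡ σ (α x)
      same x with x ≟ᴰ d | x ≟ᴰ α d
      ... | yes refl | _ = atx
      ... | no _ | yes refl = trans aty (cong σ (sym (inv d)))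
      ... | no p | no q = off (α x) (λ e → q (trans (sym (inv x)) (cong α e))) (p ∘ invol-inj inv)
      φ⊆ : ∀ {a b} → O (σ ∘ α) a b → O (merged ∘ cut α d) a b
      φ⊆ = E-elim (E-equiv _ _) st st
        where st = λ x → Clo.return (inj₁ (same x))
      φ⊇ : ∀ {a b} → O (merged ∘ cut α d) a b → O (σ ∘ α) a b
      φ⊇ = E-elim (E-equiv _ _) st st
        where st = λ x → Clo.return (inj₁ (sym (same x)))
      inE : ∀ {a b} → O merged a b → E merged (cut α d) a b
      inE = E-elim (E-equiv _ _) E-f E-f
      dα : E merged (cut α d) d (α d)
      dα = inE (transposed-joins injσ merged-transposed ¬o)
      E⊆ : ∀ {a b} → E σ α a b → E merged (cut α d) a b
      E⊆ = E-elim (E-equiv _ _) (λ x → inE (proj₁ merged-orbits (inj₁ (E-f x)))) st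
        where
        st : ∀ x → E merged (cut α d) x (α x)
        st x with x ≟ᴰ d | x ≟ᴰ α d
        ... | yes refl | _ = dα
        ... | no _ | yes refl = subst (E merged (cut α d) (α d)) (sym (inv d)) (E-sym dα)
        ... | no p | no q = Clo.return (inj₂ (cut-off α inv d x p q))
      outE : ∀ {a b} → O σ a b → E σ α a b
      outE = E-elim (E-equiv _ _) E-f E-f
      E⊇ : ∀ {a b} → E merged (cut α d) a b → E σ α a b
      E⊇ = E-elim (E-equiv _ _) st λ x → E-cut⊆ α inv d (E-g x)
        where
        st : ∀ x → E σ α x (merged x)
        st x with proj₂ merged-orbits (E-f x)
        ... | inj₁ o = outE o
        ... | inj₂ (inj₁ (p , q)) = outE p ◅◅ (E-g d ◅◅ outE q)
        ... | inj₂ (inj₂ (p , q)) = outE p ◅◅ (E-sym (E-g d) ◅◅ outE q)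

  -- Jordan curve theorem in disguise: cutting a vertex open along a face it meets twice disconnects the map.
  split-disconnects : ∀ {σ α x y} → Inj σ → Invol α → Plane σ α → x ≢ y → O σ x y →
    O (σ ∘ α) (α x) (α y) → ¬ E (σ ∘ swap x y) α x y
  split-disconnects {σ} {α} {x} {y} injσ inv (plane {s} {f} {c} {e} cs cf cc me eu) x≢y oσ oφ conn
    with E-count (σ ∘ swap x y) (σ ∘ swap x y) | E-count (σ ∘ swap x y ∘ α) (σ ∘ swap x y ∘ α)
  ... | s′ , cs′ | f′ , cf′
    with count-parts injσ (swap-transposed σ x≢y) oσ cs cs′
       | count-parts (invol-inj inv ∘ injσ) tφ oφ cf cf′
    where
    module T = Transposed (swap-transposed σ x≢y)
    -- A swap at x and y in σ is a transposition at their reversals in the face permutation.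
    tφ : Transposed (σ ∘ α) (σ ∘ swap x y ∘ α) (α x) (α y)
    tφ = record
      { x≢y = x≢y ∘ invol-inj inv
      ; atx = trans (cong (σ ∘ swap x y) (inv x)) (trans T.atx (cong σ (sym (inv y))))
      ; aty = trans (cong (σ ∘ swap x y) (inv y)) (trans T.aty (cong σ (sym (inv x))))
      ; off = λ z p q → T.off (α z) (λ e → p (trans (sym (inv z)) (cong α e))) (λ e → q (trans (sym (inv z)) (cong α e))) }
  -- Vertices and faces both gain one, while under `conn` components and darts keep their number: an
  -- excess of four.
  ... | refl | refl = contradiction
    (≤-trans (≤-reflexive (sym (trans (2[1+s]+2[1+f] s f) (cong (_+ 4) eu))))
      (euler-≤ e (transposed-inj injσ (swap-transposed σ x≢y)) inv me cs′ cf′ (count-resp (E-equiv _ _) (E⊆ , E⊇) cc)))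
    (m+1+n≰m (4 * c + e))
    where
    module T = Transposed (swap-transposed σ x≢y)
    E⊆ : ∀ {a b} → E σ α a b → E (σ ∘ swap x y) α a b
    E⊆ = E-elim (E-equiv _ _) st E-g
      where
      st : ∀ z → E (σ ∘ swap x y) α z (σ z)
      st z with z ≟ᴰ x | z ≟ᴰ y
      ... | yes refl | _ = conn ◅◅ Clo.return (inj₁ T.aty)
      ... | no _ | yes refl = E-sym conn ◅◅ Clo.return (inj₁ T.atx)
      ... | no p | no q = Clo.return (inj₁ (T.off z p q))
    outE : ∀ {a b} → O σ a b → E σ α a b
    outE = E-elim (E-equiv _ _) E-f E-f
    E⊇ : ∀ {a b} → E (σ ∘ swap x y) α a b → E σ α a b
    E⊇ = E-elim (E-equiv _ _) st E-g
      where
      st : ∀ z → E σ α z (σ (swap x y z))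
      st z with z ≟ᴰ x | z ≟ᴰ y
      ... | yes refl | _ = outE oσ ◅◅ E-f y
      ... | no _ | yes refl = E-sym (outE oσ) ◅◅ E-f x
      ... | no p | no q = E-f z

-- Maps with labelled vertices

uip : {Elem : Set} {x y : Elem} (p q : x ≡ y) → p ≡ q
uip refl refl = refl

adj? : (G : Graph n) → ∀ u w → Dec (Adj G u w)
adj? G u w = adj G u w Bool.≟ true

adj-≢ : (G : Graph n) → ∀ {u w} → Adj G u w → u ≢ w
adj-≢ G {u} a refl with () ← trans (sym a) (adj-irr G u)

length-select : (b : Elem → Bool) (xs : List Elem) →
  length (select (λ a → b a Bool.≟ true) xs) ≡ sum (map (bool→ℕ ∘ b) xs)
length-select b [] = refl
length-select b (x ∷ xs) with b x Bool.≟ true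
... | yes p = cong₂ _+_ (cong bool→ℕ (sym p)) (length-select b xs)
... | no ¬p = cong₂ _+_ (cong bool→ℕ (sym (¬-not ¬p))) (length-select b xs)

select-∈ : {P : Elem → Set} (P? : ∀ a → Dec (P a)) (xs : List Elem) {b : Σ Elem P} → b ∈ select P? xs → proj₁ b ∈ xs
select-∈ P? (x ∷ xs) i with P? x
select-∈ P? (x ∷ xs) (here refl) | yes p = here refl
select-∈ P? (x ∷ xs) (there i) | yes p = there (select-∈ P? xs i)
select-∈ P? (x ∷ xs) i | no _ = there (select-∈ P? xs i)

select-unique : {P : Elem → Set} (P? : ∀ a → Dec (P a)) {xs : List Elem} → Unique xs →
  AllPairs (λ a b → proj₁ a ≢ proj₁ b) (select P? xs)
select-unique P? [] = []
select-unique P? {x ∷ xs} (p ∷ ps) with P? x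
... | yes q = All.tabulate (λ i → All.lookup p (select-∈ P? xs i)) ∷ select-unique P? ps
... | no _ = select-unique P? ps

count-true : (b : Elem → Bool) {xs : List Elem} → Unique xs → (∀ a → a ∈ xs) →
  Count (On₁ {P = λ a → b a ≡ true} _≡_) (sum (map (bool→ℕ ∘ b) xs))
count-true b {xs} u all = subst (Count (On₁ _≡_)) (length-select b xs)
  (count-list (select (λ a → b a Bool.≟ true) xs) sym (select-unique _ u)
    λ { (a , p) → ∈-select (λ a → b a Bool.≟ true) xs (all a) p })

sum-cartesian : (f : Elem × Elem′ → ℕ) (xs : List Elem) (ys : List Elem′) →
  sum (map f (cartesianProduct xs ys)) ≡ sum (map (λ x → sum (map (λ y → f (x , y)) ys)) xs)
sum-cartesian f [] ys = refl
sum-cartesian f (x ∷ xs) ys =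
  trans (cong sum (map-++ f (map (x ,_) ys) _)) (trans (sum-++ (map f (map (x ,_) ys)) _)
    (cong₂ _+_ (cong sum (sym (map-∘ ys))) (sum-cartesian f xs ys)))

pairs : ∀ n → List (Fin n × Fin n)
pairs n = cartesianProduct (allFin n) (allFin n)

pairs-complete : (p : Fin n × Fin n) → p ∈ pairs n
pairs-complete (u , w) = ∈-cartesianProduct⁺ (∈-allFin u) (∈-allFin w)

adjᵖ : Graph n → Fin n × Fin n → Bool
adjᵖ G (u , w) = adj G u w

dartCount-count : (G : Graph n) → Count (On₁ {P = λ p → adjᵖ G p ≡ true} _≡_) (dartCount G)
dartCount-count {n} G = subst (Count (On₁ _≡_)) (sum-cartesian (bool→ℕ ∘ adjᵖ G) (allFin n) (allFin n))
  (count-true (adjᵖ G) (Uniqueₚ.cartesianProduct⁺ (Uniqueₚ.allFin⁺ n) (Uniqueₚ.allFin⁺ n)) pairs-complete)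

Isolated : Graph n → Fin n → Set
Isolated G v = isZero (degree G v) ≡ true

isolated-count : (G : Graph n) → Count (On₁ {P = Isolated G} _≡_) (isolatedCount G)
isolated-count {n} G = count-true (λ v → isZero (degree G v)) (Uniqueₚ.allFin⁺ n) ∈-allFin

isolated⁻ : (G : Graph n) → ∀ {v w} → Isolated G v → ¬ Adj G v w
isolated⁻ {n} G {v} {w} iso a = go (allFin n) iso (∈-allFin w)
  where
  go : ∀ xs → isZero (sum (map (λ w → bool→ℕ (adj G v w)) xs)) ≡ true → w ∈ xs → ⊥
  go (x ∷ xs) z (here refl) rewrite a with () ← z
  go (x ∷ xs) z (there i) with adj G v x
  ... | true with () ← z
  ... | false = go xs z i

isolated⁺ : (G : Graph n) → ∀ {v} → (∀ w → ¬ Adj G v w) → Isolated G v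
isolated⁺ {n} G {v} h = go (allFin n)
  where
  go : ∀ xs → isZero (sum (map (λ w → bool→ℕ (adj G v w)) xs)) ≡ true
  go [] = refl
  go (x ∷ xs) with adj G v x in e
  ... | true = contradiction e (h x)
  ... | false = go xs

fin-count : Count {Fin n} _≡_ n
fin-count = id , (λ _ _ ne → ne) , λ a → a , refl

reach-trans : (G : Graph n) → ∀ {u v w} → Reach G u v → Reach G v w → Reach G u w
reach-trans G here r = r
reach-trans G (step a q) r = step a (reach-trans G q r)

reach-sym : (G : Graph n) → ∀ {u v} → Reach G u v → Reach G v u
reach-sym G here = here
reach-sym G (step a q) = reach-trans G (reach-sym G q) (step (flipAdj G a) here)

reach-equiv : (G : Graph n) → IsEquivalence (Reach G)
reach-equiv G = record { refl = here ; sym = reach-sym G ; trans = reach-trans G }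

dart-≡ : {G : Graph n} {d d′ : Dart G} → tl d ≡ tl d′ → hd d ≡ hd d′ → d ≡ d′
dart-≡ {d = dart u w p} {dart _ _ q} refl refl = cong (dart u w) (uip p q)

dart-≟ : {G : Graph n} → DecidableEquality (Dart G)
dart-≟ d d′ with tl d Finₚ.≟ tl d′ | hd d Finₚ.≟ hd d′
... | yes p | yes q = yes (dart-≡ p q)
... | no p | _ = no λ { refl → p refl }
... | _ | no q = no λ { refl → q refl }

darts : (G : Graph n) → List (Dart G)
darts {n} G = map (λ { ((u , w) , a) → dart u w a }) (select (λ p → adjᵖ G p Bool.≟ true) (pairs n))

darts-complete : (G : Graph n) → ∀ d → d ∈ darts G
darts-complete {n} G (dart u w a) with ∈-select (λ p → adjᵖ G p Bool.≟ true) (pairs n) (pairs-complete (u , w)) a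
... | ((_ , _) , b) , i , refl = subst (_∈ darts G) (dart-≡ refl refl) (∈-map⁺ _ i)

dart-finite : Graph n → Finite
dart-finite G = record { D = Dart G ; _≟ᴰ_ = dart-≟ ; enum = darts G ; complete = darts-complete G }

module LabelledMaps (F : Finite) where

  open Finite F
  open FiniteMaps F public

  any-D : {P : D → Set} → (∀ d → Dec (P d)) → Dec (∃[ d ] P d)
  any-D P? with Any.any? P? enum
  ... | yes a = yes (Any.satisfied a)
  ... | no ¬a = no λ { (d , p) → ¬a (Any.map (λ { refl → p }) (complete d)) }

  -- Vertices are the cycles of σ, identified by their labels; darts fixed by α are the stubs of deleted edges.
  record Map (H : Graph n) : Set where
    field
      σ α   : D → D
      lab   : D → Fin n
      injσ  : Inj σ
      inv   : Invol α
      lab-σ : ∀ d → lab (σ d) ≡ lab d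
      lab-O : ∀ {d d′} → lab d ≡ lab d′ → O σ d d′
      real  : ∀ {u w} → Adj H u w → ∃[ d ] (Moved α d × lab d ≡ u × lab (α d) ≡ w)
      uniq  : ∀ {d d′} → Moved α d → Moved α d′ → lab d ≡ lab d′ → lab (α d) ≡ lab (α d′) → d ≡ d′

    HasDart : Fin n → Set
    HasDart u = ∃[ d ] lab d ≡ u

    hasDart? : ∀ u → Dec (HasDart u)
    hasDart? u = any-D λ d → lab d Finₚ.≟ u

    lab-iter : ∀ k d → lab (iter σ k d) ≡ lab d
    lab-iter zero d = refl
    lab-iter (suc k) d = trans (lab-σ _) (lab-iter k d)

    O-lab : ∀ {d d′} → O σ d d′ → lab d ≡ lab d′
    O-lab = E-elim (record { refl = refl ; sym = sym ; trans = trans }) (sym ∘ lab-σ) (sym ∘ lab-σ)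

    moved-α : ∀ {d} → Moved α d → Moved α (α d)
    moved-α m e = m (invol-inj {α} inv e)

    count-n : ∀ {s k} → Count (O σ) s → Count (On₁ {P = ¬_ ∘ HasDart} _≡_) k → n ≡ s + k
    count-n cs ck = count-unique isEquivalence fin-count
      (count-split hasDart? (λ { refl → id }) sym
        (count-map (on₁-equiv isEquivalence) (λ d → lab d , d , refl) lab-O O-lab (λ { (_ , d , refl) → d , refl }) cs) ck)

  module Live {H : Graph n} (M : Map H) (live : ∀ {d} → Moved (Map.α M) d → Adj H (Map.lab M d) (Map.lab M (Map.α M d))) where
    open Map M

    reach⇒E : ∀ {u w} → Reach H u w → ∀ {d d′} → lab d ≡ u → lab d′ ≡ w → E σ α d d′
    reach⇒E here p q = E-elim (E-equiv σ α) E-f E-f (lab-O (trans p (sym q)))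
    reach⇒E (step a r) p q with real a
    ... | m , _ , e , e′ = E-elim (E-equiv σ α) E-f E-f (lab-O (trans p (sym e))) ◅◅ (E-g m ◅◅ reach⇒E r e′ q)

    E⇒reach : ∀ {d d′} → E σ α d d′ → Reach H (lab d) (lab d′)
    E⇒reach = E-elim {R = λ d d′ → Reach H (lab d) (lab d′)}
      (record { refl = here ; sym = reach-sym H ; trans = reach-trans H })
      (λ d → subst (Reach H (lab d)) (sym (lab-σ d)) here) α-step
      where
      α-step : ∀ d → Reach H (lab d) (lab (α d))
      α-step d with α d ≟ᴰ d
      ... | yes e = subst (Reach H (lab d)) (cong lab (sym e)) here
      ... | no m = step (live m) here

    count-components : ∀ {c k} → Count (E σ α) c → Count (On₁ {P = ¬_ ∘ HasDart} _≡_) k → ComponentCount H (c + k)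
    count-components cc ck = count-split hasDart? resp (reach-sym H)
      (count-map (on₁-equiv (reach-equiv H)) (λ d → lab d , d , refl) (λ r → reach⇒E r refl refl) E⇒reach
        (λ { (_ , d , refl) → d , here }) cc)
      (count-map (on₁-equiv (reach-equiv H)) id (λ { {u , nu} → stay nu }) (λ { {u , _} refl → here }) (λ b → b , here) ck)
      where
      resp : ∀ {a b} → Reach H a b → HasDart a → HasDart b
      resp here h = h
      resp (step a r) h = resp r (let d , _ , _ , e = real a in α d , e)
      stay : ∀ {u w} → ¬ HasDart u → Reach H u w → u ≡ w
      stay nu here = refl
      stay nu (step a r) = contradiction (let d , _ , e , _ = real a in d , e) nu

    moved-dartCount : ∀ {e} → MovedCount α e → e ≡ dartCount H
    moved-dartCount me = count-unique (on₁-equiv isEquivalence)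
      (count-map (on₁-equiv isEquivalence) (λ { (d , m) → (lab d , lab (α d)) , live m })
        (λ { {d , m} {d′ , m′} q → uniq m m′ (cong proj₁ q) (cong proj₂ q) })
        (λ { {d , m} {d′ , m′} refl → refl })
        (λ { ((u , w) , a) → let d , m , e , e′ = real a in (d , m) , cong₂ _,_ e e′ })
        me)
      (dartCount-count H)

    -- The first moved dart after d: stubs are skipped when the rotation of H is read off.
    Next : (D → D) → D → D → Set
    Next π d d₁ = ∃[ j ] (d₁ ≡ iter π (suc j) d × Moved α d₁ × (∀ i → i < j → ¬ Moved α (iter π (suc i) d)))

    next : ∀ {π} → Inj π → ∀ {d} → Moved α d → ∃[ d₁ ] Next π d d₁
    next {π} inj {d} m with period inj d
    ... | k , e with least (λ i → moved? α (iter π (suc i) d)) k (subst (Moved α) (sym e) m)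
    ... | j , mj , min = _ , j , refl , mj , min

    rot′ : Fin n → Fin n → Fin n
    rot′ u w with adj? H u w
    ... | yes a = let d , m , _ = real a in lab (α (proj₁ (next injσ m)))
    ... | no _  = w

    rot′-spec : ∀ {d} → Moved α d → ∃[ d₁ ] (Next σ d d₁ × rot′ (lab d) (lab (α d)) ≡ lab (α d₁))
    rot′-spec {d} m with adj? H (lab d) (lab (α d))
    ... | no ¬a = contradiction (live m) ¬a
    ... | yes a with real a
    ... | d′ , m′ , e , e′ with uniq m′ m e e′
    ... | refl = _ , proj₂ (next injσ m′) , refl

    -- Any number of π-steps between moved darts amounts to some number of first returns. The
    -- valuation is arbitrary so that this serves both rotations, on pairs of labels, and facial
    -- walks, on darts. The fuel is there because one return consumes several steps.
    first-return : ∀ {π} {T : Set} (val : ∀ d → Moved α d → T) (stp : T → T) →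
      (∀ d m m′ → val d m ≡ val d m′) →
      (∀ d m → ∃[ d₁ ] (Next π d d₁ × (∀ m₁ → stp (val d m) ≡ val d₁ m₁))) →
      ∀ fuel k → k ≤ fuel → ∀ {d d′} m m′ → iter π k d ≡ d′ → ∃[ j ] iter stp j (val d m) ≡ val d′ m′
    first-return val stp irr spec fuel zero _ m m′ refl = 0 , irr _ m m′
    first-return {π} val stp irr spec (suc fuel) (suc k) (s≤s k≤) {d} {d′} m m′ e with spec d m
    ... | d₁ , (j , refl , m₁ , min) , s with j ≤? k
    ... | no j≰k = contradiction (subst (Moved α) (sym e) m′) (min k (≰⇒> j≰k))
    ... | yes j≤k =
      let i , q = first-return val stp irr spec fuel (k ∸ j) (≤-trans (m∸n≤m k j) k≤) m₁ m′
                    (trans (sym (iter-+ π (k ∸ j) (suc j) d))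
                      (trans (cong (λ t → iter π t d) (trans (+-suc (k ∸ j) j) (cong suc (m∸n+n≡m j≤k)))) e))
      in suc i , trans (sym (iter-shift stp i (val d m))) (trans (cong (iter stp i) (s m₁)) q)

    rotation : Rotation H
    rotation = record { rot = rot′ ; rot-adj = ra ; rot-cyc = rc }
      where
      ra : ∀ v w → Adj H v w → Adj H v (rot′ v w)
      ra v w a with real a
      ... | d , m , refl , refl with rot′-spec m
      ... | d₁ , (j , refl , m₁ , _) , e = subst₂ (Adj H) (lab-iter (suc j) d) (sym e) (live m₁)
      rc : ∀ v w w′ → Adj H v w → Adj H v w′ → ∃[ k ] iter (rot′ v) k w ≡ w′
      rc v w w′ a a′ with real a | real a′
      ... | d , m , refl , refl | d′ , m′ , e , refl with O⇒iter injσ (lab-O (sym e))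
      ... | k , q =
        let j , r = first-return (λ d _ → lab d , lab (α d)) stp (λ _ _ _ → refl) spec k k ≤-refl m m′ q
        in j , cong proj₂ (trans (sym (iter-stp j (lab (α d)))) r)
        where
        stp : Fin n × Fin n → Fin n × Fin n
        stp (u , w) = u , rot′ u w
        iter-stp : ∀ j {v} w → iter stp j (v , w) ≡ (v , iter (rot′ v) j w)
        iter-stp zero w = refl
        iter-stp (suc j) w = cong stp (iter-stp j w)
        spec : ∀ d → Moved α d → ∃[ d₁ ] (Next σ d d₁ × (Moved α d₁ → stp (lab d , lab (α d)) ≡ (lab d₁ , lab (α d₁))))
        spec d m with rot′-spec m
        ... | d₁ , nx@(j , refl , _) , s = d₁ , nx , λ _ → cong₂ _,_ (sym (lab-iter (suc j) d)) s

    φ : D → D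
    φ = σ ∘ α

    injφ : Inj φ
    injφ = invol-inj {α} inv ∘ injσ

    toDart : ∀ d → Moved α d → Dart H
    toDart d m = dart (lab d) (lab (α d)) (live m)

    -- On stubs φ agrees with σ, so the first return of φ at d is that of σ at α d.
    face-spec : ∀ d m → ∃[ d₁ ] (Next φ d d₁ × (∀ m₁ → faceNext rotation (toDart d m) ≡ toDart d₁ m₁))
    face-spec d m with rot′-spec (moved-α m)
    ... | d₁ , (j , refl , m₁ , min) , s = d₁ , (j , sym (same j ≤-refl) , m₁ , λ i i<j mi → min i i<j (subst (Moved α) (same i (<⇒≤ i<j)) mi)) ,
      λ _ → dart-≡ (sym (lab-iter (suc j) (α d))) (trans (cong (λ t → rot′ (lab (α d)) (lab t)) (sym (inv d))) s)
      where
      same : ∀ i → i ≤ j → iter φ (suc i) d ≡ iter σ (suc i) (α d)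
      same zero _ = refl
      same (suc i) i<j = trans (cong φ (same i (<⇒≤ i<j)))
        (cong σ (decidable-stable (α _ ≟ᴰ _) (min i i<j)))

    toDart-irr : ∀ d m m′ → toDart d m ≡ toDart d m′
    toDart-irr d m m′ = dart-≡ refl refl

    O⇒sameFace : ∀ {d d′} m m′ → O φ d d′ → SameFace rotation (toDart d m) (toDart d′ m′)
    O⇒sameFace m m′ o =
      let k , e = O⇒iter injφ o
          j , q = first-return toDart (faceNext rotation) toDart-irr face-spec k k ≤-refl m m′ e
      in j , cong tl q , cong hd q

    face-iter : ∀ k d m → ∃[ d₁ ] Σ[ m₁ ∈ Moved α d₁ ] (O φ d d₁ × iter (faceNext rotation) k (toDart d m) ≡ toDart d₁ m₁)
    face-iter zero d m = d , m , ε , refl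
    face-iter (suc k) d m with face-iter k d m
    ... | d₁ , m₁ , o , e with face-spec d₁ m₁
    ... | d₂ , (j , q , m₂ , _) , s = d₂ , m₂ , o ◅◅ subst (O φ d₁) (sym q) (O-iter (suc j) d₁) , trans (cong (faceNext rotation) e) (s m₂)

    sameFace⇒O : ∀ {d d′} m m′ → SameFace rotation (toDart d m) (toDart d′ m′) → O φ d d′
    sameFace⇒O {d} {d′} m m′ (k , p , q) with face-iter k d m
    ... | d₁ , m₁ , o , e = subst (O φ d) (uniq m₁ m′ (trans (sym (cong tl e)) p) (trans (sym (cong hd e)) q)) o

    -- A φ-cycle of stubs only is a whole σ-cycle, that is, an isolated vertex of H; it must not be
    -- counted as a face.
    Alive : D → Set
    Alive d = ∃[ m ] (Moved α m × O φ d m)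

    alive? : ∀ d → Dec (Alive d)
    alive? d = any-D λ m → moved? α m ×-dec E? φ φ d m

    fromReal : (e : Dart H) → ∃[ d ] Σ[ m ∈ Moved α d ] toDart d m ≡ e
    fromReal (dart u w a) with real a
    ... | d , m , refl , refl = d , m , dart-≡ refl refl

    sameFace-equiv : IsEquivalence (SameFace rotation)
    sameFace-equiv = record { refl = 0 , refl , refl ; sym = λ {a} {b} → sy {a} {b} ; trans = λ {a} {b} {c} → tr {a} {b} {c} }
      where
      sy : ∀ {a b} → SameFace rotation a b → SameFace rotation b a
      sy {a} {b} s with fromReal a | fromReal b
      ... | _ , m , refl | _ , m′ , refl = O⇒sameFace m′ m (E-sym (sameFace⇒O m m′ s))
      tr : ∀ {a b c} → SameFace rotation a b → SameFace rotation b c → SameFace rotation a c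
      tr {a} {b} {c} s t with fromReal a | fromReal b | fromReal c
      ... | _ , m , refl | _ , m′ , refl | _ , m″ , refl = O⇒sameFace m m″ (sameFace⇒O m m′ s ◅◅ sameFace⇒O m′ m″ t)

    count-faces : ∀ {k} → Count (On₁ {P = Alive} (O φ)) k → FaceCount rotation k
    count-faces = count-map sameFace-equiv (λ { (d , m , mm , o) → toDart m mm })
      (λ { {_ , m , mm , o} {_ , m′ , mm′ , o′} s → o ◅◅ (sameFace⇒O mm mm′ s ◅◅ E-sym o′) })
      (λ { {_ , m , mm , o} {_ , m′ , mm′ , o′} r → O⇒sameFace mm mm′ (E-sym o ◅◅ (r ◅◅ o′)) })
      λ e → let d , m , q = fromReal e in (d , d , m , ε) , (0 , cong tl q , cong hd q)

    dead-iter : ∀ {d} → ¬ Alive d → ∀ k → iter φ k d ≡ iter σ k d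
    dead-iter nd zero = refl
    dead-iter {d} nd (suc k) = trans (cong φ (dead-iter nd k))
      (cong σ (decidable-stable (α _ ≟ᴰ _) λ m → nd (_ , subst (Moved α) (sym (dead-iter nd k)) m , O-iter k d)))

    dead-isolated : ∀ {d} → ¬ Alive d → Isolated H (lab d)
    dead-isolated {d} nd = isolated⁺ H λ w a →
      let m , mm , e , _ = real a
          k , q = O⇒iter injσ (lab-O (sym e))
      in nd (m , mm , subst (O φ d) (trans (dead-iter nd k) q) (O-iter k d))

    isolated-dead : ∀ {d} → Isolated H (lab d) → ¬ Alive d
    isolated-dead {d} iso (m , mm , o) with O⇒iter injφ o
    ... | k , refl = isolated⁻ H (subst (Isolated H) (sym (go k)) iso) (live mm)
      where
      go : ∀ k → lab (iter φ k d) ≡ lab d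
      go zero = refl
      go (suc k) = trans (lab-σ _) (trans (cong lab (decidable-stable (α _ ≟ᴰ _) λ m →
        isolated⁻ H (subst (Isolated H) (sym (go k)) iso) (live m))) (go k))

    -- Isolated vertices are of two kinds: those whose darts are all stubs, one dead φ-cycle each,
    -- and labels without darts.
    count-isolated : ∀ {k l} → Count (On₁ {P = ¬_ ∘ Alive} (O φ)) k → Count (On₁ {P = ¬_ ∘ HasDart} _≡_) l →
      isolatedCount H ≡ k + l
    count-isolated ck cl = count-unique (on₁-equiv isEquivalence) (isolated-count H)
      (count-split {P = HasDart ∘ proj₁} (hasDart? ∘ proj₁) (λ { refl → id }) sym
        (count-map (on₁-equiv (on₁-equiv isEquivalence)) (λ { (d , nd) → (lab d , dead-isolated nd) , d , refl })
          (λ { {d , nd} {d′ , _} q → let k , e = O⇒iter injσ (lab-O q) in subst (O φ d) (trans (dead-iter nd k) e) (O-iter k d) })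
          (λ { {d , nd} {d′ , _} o → let k , e = O⇒iter injφ o in trans (sym (lab-iter k d)) (cong lab (trans (sym (dead-iter nd k)) e)) })
          (λ { ((_ , iso) , d , refl) → (d , isolated-dead iso) , refl }) ck)
        (count-map (on₁-equiv (on₁-equiv isEquivalence))
          (λ { (u , nu) → (u , isolated⁺ H λ w a → nu (let d , _ , e , _ = real a in d , e)) , nu })
          id id (λ { ((u , iso) , nu) → (u , nu) , refl }) cl))

    planar : Plane σ α → Planar H
    planar (plane {s} {f} {c} {e} cs cf cc me eu)
      with count-select isEquivalence Finₚ._≟_ (λ u → ¬? (hasDart? u)) (allFin n) ∈-allFin
         | count-select (E-equiv φ φ) (E? φ φ) alive? enum complete
         | count-select (E-equiv φ φ) (E? φ φ) (λ d → ¬? (alive? d)) enum complete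
    -- There are k labels without darts, k₁ proper faces and k₂ dead cycles.
    ... | k , ck | k₁ , ck₁ | k₂ , ck₂ = rotation , k₁ , c + k , count-faces ck₁ , count-components cc ck ,
      final s f c e k k₁ k₂ eu (count-n cs ck)
        (count-unique (E-equiv φ φ) cf (count-split alive? (λ { r (m , mm , o) → m , mm , (E-sym r ◅◅ o) }) E-sym ck₁ ck₂))
        (count-isolated ck₂ ck) (moved-dartCount me)
      where
      lem : ∀ s k k₁ k₂ → 2 * (s + k) + 2 * k₁ + 2 * (k₂ + k) ≡ 2 * s + 2 * (k₁ + k₂) + 4 * k
      lem = solve 4 (λ s k k₁ k₂ → con 2 :* (s :+ k) :+ con 2 :* k₁ :+ con 2 :* (k₂ :+ k) := con 2 :* s :+ con 2 :* (k₁ :+ k₂) :+ con 4 :* k) refl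
      lem′ : ∀ c e k → 4 * c + e + 4 * k ≡ 4 * (c + k) + e
      lem′ = solve 3 (λ c e k → con 4 :* c :+ e :+ con 4 :* k := con 4 :* (c :+ k) :+ e) refl
      final : ∀ s f c e k k₁ k₂ {n i e′} → 2 * s + 2 * f ≡ 4 * c + e → n ≡ s + k → f ≡ k₁ + k₂ → i ≡ k₂ + k → e ≡ e′ →
        2 * n + 2 * k₁ + 2 * i ≡ 4 * (c + k) + e′
      final s f c e k k₁ k₂ eu refl refl refl refl = trans (lem s k k₁ k₂) (trans (cong (_+ 4 * k) eu) (lem′ c e k))

  prune : {H : Graph n} (M : Map H) → Plane (Map.σ M) (Map.α M) → Planar H
  prune {n = n} {H = H} M pl = let M′ , pl′ , live = go enum M pl (λ _ → inj₁ (complete _)) in Live.planar M′ live pl′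
    where
    Ok : Map H → D → Set
    Ok M d = Moved (Map.α M) d → Adj H (Map.lab M d) (Map.lab M (Map.α M d))
    go : ∀ xs (M : Map H) → Plane (Map.σ M) (Map.α M) → (∀ d → d ∈ xs ⊎ Ok M d) →
      Σ[ M ∈ Map H ] (Plane (Map.σ M) (Map.α M) × (∀ {d} → Ok M d))
    go [] M pl ok = M , pl , λ {d} → case ok d of λ { (inj₁ ()) ; (inj₂ o) → o }
    go (x ∷ xs) M pl ok with moved? (Map.α M) x | adj? H (Map.lab M x) (Map.lab M (Map.α M x))
    ... | no nm | _ = go xs M pl λ d → case ok d of λ
      { (inj₁ (here refl)) → inj₂ λ m → contradiction m nm ; (inj₁ (there i)) → inj₁ i ; (inj₂ o) → inj₂ o }
    ... | yes m | yes a = go xs M pl λ d → case ok d of λ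
      { (inj₁ (here refl)) → inj₂ λ _ → a ; (inj₁ (there i)) → inj₁ i ; (inj₂ o) → inj₂ o }
    ... | yes m | no ¬a = go xs M′ (plane-cut injσ inv x m pl) ok′
      where
      open Map M
      real′ : ∀ {u w} → Adj H u w → ∃[ d ] (Moved (cut α x) d × lab d ≡ u × lab (cut α x d) ≡ w)
      real′ a with real a
      ... | d , md , refl , refl =
        let p = λ { refl → ¬a a }
            q = λ { refl → ¬a (flipAdj H (subst (Adj H (lab (α x))) (cong lab (inv x)) a)) }
            c = cut-off α inv x d p q
        in d , (λ z → md (trans (sym c) z)) , refl , cong lab c
      M′ : Map H
      M′ = record
        { σ = σ ; α = cut α x ; lab = lab ; injσ = injσ ; inv = cut-invol α inv x ; lab-σ = lab-σ ; lab-O = lab-O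
        ; real = real′
        ; uniq = λ md md′ e e′ → let m₁ , _ , _ , c₁ = cut-moved α inv x md
                                     m₂ , _ , _ , c₂ = cut-moved α inv x md′
                                 in uniq m₁ m₂ e (trans (sym (cong lab c₁)) (trans e′ (cong lab c₂))) }
      ok′ : ∀ d → d ∈ xs ⊎ Ok M′ d
      ok′ d with ok d
      ... | inj₁ (here refl) = inj₂ λ md → contradiction (cut-d α inv d) md
      ... | inj₁ (there i) = inj₁ i
      ... | inj₂ o = inj₂ λ md → let m₁ , _ , _ , c₁ = cut-moved α inv x md in subst (Adj H (lab d)) (cong lab (sym c₁)) (o m₁)

-- Minors of plane graphs

does⇒ : {P : Set} (P? : Dec P) → does P? ≡ true → P
does⇒ (yes p) _ = p

module _ {P : Fin n → Fin n → Set} (P? : ∀ x y → Dec (P x y)) (sy : ∀ {x y} → P x y → P y x) (ir : ∀ {x} → ¬ P x x) where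

  mkGraph : Graph n
  mkGraph = record
    { adj = λ x y → does (P? x y)
    ; adj-sym = λ x y → same x y
    ; adj-irr = λ x → dec-false (P? x x) ir }
    where
    same : ∀ x y → does (P? x y) ≡ does (P? y x)
    same x y with P? x y
    ... | yes p = sym (dec-true (P? y x) (sy p))
    ... | no ¬p = sym (dec-false (P? y x) (¬p ∘ sy))

  mkGraph⁻ : ∀ {x y} → Adj mkGraph x y → P x y
  mkGraph⁻ {x} {y} = does⇒ (P? x y)

  mkGraph⁺ : ∀ {x y} → P x y → Adj mkGraph x y
  mkGraph⁺ {x} {y} = dec-true (P? x y)

module Rotated {G : Graph n} (R : Rotation G) where

  open LabelledMaps (dart-finite G) public

  σ₀ : Dart G → Dart G
  σ₀ d = dart (tl d) (rot R (tl d) (hd d)) (rot-adj R (tl d) (hd d) (arc d))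

  α₀ : Dart G → Dart G
  α₀ d = dart (hd d) (tl d) (flipAdj G (arc d))

  σ₀-iter : ∀ k d → tl (iter σ₀ k d) ≡ tl d × hd (iter σ₀ k d) ≡ iter (rot R (tl d)) k (hd d)
  σ₀-iter zero d = refl , refl
  σ₀-iter (suc k) d = let p , q = σ₀-iter k d in p , cong₂ (rot R) p q

  σ₀-orbit : ∀ {d d′} → tl d ≡ tl d′ → ∃[ k ] iter σ₀ k d ≡ d′
  σ₀-orbit {dart u w a} {dart _ w′ a′} refl with rot-cyc R u w w′ a a′
  ... | k , e = k , let p , q = σ₀-iter k (dart u w a) in dart-≡ p (trans q e)

  -- Only transitivity on each neighbourhood is given. If c is the common image, and reaches d in k
  -- and d′ in l steps, then c has periods k + 1 and l + 1, and both darts are the iterate of c at k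
  -- + l(k + 1) = l + k(l + 1).
  σ₀-inj : Inj σ₀
  σ₀-inj {d} {d′} e with σ₀-orbit {σ₀ d} {d} refl | σ₀-orbit {σ₀ d} {d′} (cong tl e)
  ... | k , p | l , q = trans (sym p) (trans (cong (iter σ₀ k) (sym (rep k l (cong σ₀ p))))
    (trans (sym (iter-+ σ₀ k (l * suc k) c)) (trans (cong (λ t → iter σ₀ t c) (comm k l))
      (trans (iter-+ σ₀ l (k * suc l) c) (trans (cong (iter σ₀ l) (rep l k (trans (cong σ₀ q) (sym e)))) q)))))
    where
    c = σ₀ d
    comm : ∀ k l → k + l * suc k ≡ l + k * suc l
    comm = solve 2 (λ k l → k :+ l :* (con 1 :+ k) := l :+ k :* (con 1 :+ l)) refl
    rep : ∀ l m → iter σ₀ (suc l) c ≡ c → iter σ₀ (m * suc l) c ≡ c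
    rep l zero e = refl
    rep l (suc m) e = trans (iter-+ σ₀ (suc l) (m * suc l) c) (trans (cong (iter σ₀ (suc l)) (rep l m e)) e)

  α₀-invol : Invol α₀
  α₀-invol d = dart-≡ refl refl

  α₀-moved : ∀ d → Moved α₀ d
  α₀-moved d e = adj-≢ G (arc d) (sym (cong tl e))

  φ₀-inj : Inj (faceNext R)
  φ₀-inj = invol-inj {α₀} α₀-invol ∘ σ₀-inj

  tl-O : ∀ {d d′} → tl d ≡ tl d′ → O σ₀ d d′
  tl-O {d} e = let k , q = σ₀-orbit e in subst (O σ₀ d) q (O-iter k d)

  O-tl : ∀ {d d′} → O σ₀ d d′ → tl d ≡ tl d′
  O-tl = E-elim (record { refl = refl ; sym = sym ; trans = trans }) (λ _ → refl) (λ _ → refl)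

  sameFace⇒O : ∀ {d d′} → SameFace R d d′ → O (faceNext R) d d′
  sameFace⇒O {d} (k , p , q) = subst (O (faceNext R) d) (dart-≡ p q) (O-iter k d)

  O⇒sameFace : ∀ {d d′} → O (faceNext R) d d′ → SameFace R d d′
  O⇒sameFace o = let k , e = O⇒iter φ₀-inj o in k , cong tl e , cong hd e

  -- ρ may drop vertices that have no edges.
  relabelled : ∀ {m} {H : Graph m} (ρ : Dart G → Fin m) → (∀ {d d′} → ρ d ≡ ρ d′ → tl d ≡ tl d′) →
    (∀ {d d′} → tl d ≡ tl d′ → ρ d ≡ ρ d′) →
    (∀ {x y} → Adj H x y → ∃[ d ] (ρ d ≡ x × ρ (α₀ d) ≡ y)) → Map H
  relabelled ρ inj cong-ρ re = record
    { σ = σ₀ ; α = α₀ ; lab = ρ ; injσ = σ₀-inj ; inv = α₀-invol ; lab-σ = λ d → cong-ρ refl ; lab-O = tl-O ∘ inj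
    ; real = λ a → let d , p , q = re a in d , α₀-moved d , p , q
    ; uniq = λ _ _ p q → dart-≡ (inj p) (inj q) }

  inherited : {H : Graph n} → (∀ {x y} → Adj H x y → Adj G x y) → Map H
  inherited H⊆G = relabelled tl id id λ a → dart _ _ (H⊆G a) , refl , refl

  -- The k isolated vertices contribute 2k as vertices and 2k in their own term, which balances the
  -- 4k from their components.
  toPlane : IsPlane R → Plane σ₀ α₀
  toPlane (f , c , cf , cc , eu)
    with count-select isEquivalence Finₚ._≟_ (λ u → ¬? (hasDart? u)) (allFin n) ∈-allFin
       | E-count σ₀ σ₀ | E-count σ₀ α₀ | moved-count α₀
    where open Map (inherited {G} id)
  ... | k , ck | s , cs | c₀ , cc₀ | e , ce = plane cs (count-resp (E-equiv _ _) (sameFace⇒O , O⇒sameFace) cf) cc₀ ce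
    (final s f c₀ e k eu (count-n cs ck) (count-unique (reach-equiv G) cc (Lv.count-components cc₀ ck)) iso (Lv.moved-dartCount ce))
    where
    open Map (inherited {G} id)
    module Lv = Live (inherited {G} id) (λ {d} _ → arc d)
    iso : isolatedCount G ≡ k
    iso = count-unique (on₁-equiv isEquivalence) (isolated-count G)
      (count-map (on₁-equiv isEquivalence) (λ { (u , nu) → u , isolated⁺ G λ w a → nu (dart u w a , refl) }) id id
        (λ { (u , i) → (u , λ { (dart _ w a , refl) → isolated⁻ G i a }) , refl }) ck)
    lem : ∀ s f k → 2 * (s + k) + 2 * f + 2 * k ≡ 4 * k + (2 * s + 2 * f)
    lem = solve 3 (λ s f k → con 2 :* (s :+ k) :+ con 2 :* f :+ con 2 :* k := con 4 :* k :+ (con 2 :* s :+ con 2 :* f)) refl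
    lem′ : ∀ c e k → 4 * (c + k) + e ≡ 4 * k + (4 * c + e)
    lem′ = solve 3 (λ c e k → con 4 :* (c :+ k) :+ e := con 4 :* k :+ (con 4 :* c :+ e)) refl
    final : ∀ s f c₀ e k {n c i e′} → 2 * n + 2 * f + 2 * i ≡ 4 * c + e′ → n ≡ s + k → c ≡ c₀ + k → i ≡ k → e ≡ e′ →
      2 * s + 2 * f ≡ 4 * c₀ + e
    final s f c₀ e k eu refl refl refl refl = +-cancelˡ-≡ (4 * k) _ _ (trans (sym (lem s f k)) (trans eu (lem′ c₀ e k)))

abstract

  sub : {G H : Graph n} → Planar G → (∀ {x y} → Adj H x y → Adj G x y) → Planar H
  sub (R , pl) H⊆G = prune (inherited H⊆G) (toPlane pl)
    where open Rotated R

  del-vertex : ∀ {n} {G : Graph (suc n)} → Planar G → (z : Fin (suc n)) → (∀ w → ¬ Adj G z w) →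
    Σ[ H ∈ Graph n ] (Planar H × (∀ a b → adj H a b ≡ adj G (punchIn z a) (punchIn z b)))
  del-vertex {n} {G} (R , pl) z iso = H , Live.planar M live (toPlane pl) , λ _ _ → refl
    where
    open Rotated R
    H : Graph n
    H = record { adj = λ a b → adj G (punchIn z a) (punchIn z b)
               ; adj-sym = λ a b → adj-sym G (punchIn z a) (punchIn z b)
               ; adj-irr = λ a → adj-irr G (punchIn z a) }
    z≢ : ∀ (d : Dart G) → z ≢ tl d
    z≢ (dart u w a) refl = iso w a
    ρ : Dart G → Fin n
    ρ d = punchOut (z≢ d)
    M : Map H
    M = relabelled ρ (λ {d} {d′} → Finₚ.punchOut-injective (z≢ d) (z≢ d′)) (λ {d} {d′} e → Finₚ.punchOut-cong z {i≢j = z≢ d} {z≢ d′} e)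
      λ {x} {y} a → dart (punchIn z x) (punchIn z y) a ,
        trans (Finₚ.punchOut-cong z {i≢k = Finₚ.punchInᵢ≢i z x ∘ sym} refl) (Finₚ.punchOut-punchIn z) ,
        trans (Finₚ.punchOut-cong z {i≢k = Finₚ.punchInᵢ≢i z y ∘ sym} refl) (Finₚ.punchOut-punchIn z)
    live : ∀ {d} → Moved α₀ d → Adj H (ρ d) (ρ (α₀ d))
    live {d} _ = subst₂ (Adj G) (sym (Finₚ.punchIn-punchOut (z≢ d))) (sym (Finₚ.punchIn-punchOut (z≢ (α₀ d)))) (arc d)

module _ (u w : Fin n) where

  merge : Fin n → Fin n
  merge x with x Finₚ.≟ w
  ... | yes _ = u
  ... | no _ = x

  merge-w : merge w ≡ u
  merge-w with w Finₚ.≟ w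
  ... | yes _ = refl
  ... | no p = contradiction refl p

  merge-off : ∀ {x} → x ≢ w → merge x ≡ x
  merge-off {x} p with x Finₚ.≟ w
  ... | yes e = contradiction e p
  ... | no _ = refl

  merge-≡ : ∀ {x y} → merge x ≡ merge y → x ≡ y ⊎ (x ≡ w × y ≡ u) ⊎ (x ≡ u × y ≡ w)
  merge-≡ {x} {y} e with x Finₚ.≟ w | y Finₚ.≟ w
  ... | yes p | yes q = inj₁ (trans p (sym q))
  ... | yes p | no q = inj₂ (inj₁ (p , sym e))
  ... | no p | yes q = inj₂ (inj₂ (e , q))
  ... | no p | no q = inj₁ e

-- The contracted vertex keeps the name u and w becomes isolated, so that the minor has the same
-- vertex type.
MinorEdge : Graph n → Fin n → Fin n → Fin n → Fin n → Set
MinorEdge G u w x y = x ≢ w × y ≢ w × (Adj G x y ⊎ (x ≡ u × Adj G w y) ⊎ (y ≡ u × Adj G x w))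

module Contraction {G H : Graph n} (R : Rotation G) {u w : Fin n} (auw : Adj G u w)
  (disj : ∀ {x} → Adj G u x → Adj G w x → ⊥) (hH : ∀ {x y} → Adj H x y → MinorEdge G u w x y) where

  open Rotated R

  private
    c : Fin n → Fin n
    c = merge u w

    u≢w : u ≢ w
    u≢w = adj-≢ G auw

  -- Two edges can become parallel only through a common neighbour of u and w, which `disj`
  -- excludes.
  same-edge : ∀ {a b a′ b′} → Adj G a b → Adj G a′ b′ → ¬ (a ≡ w × b ≡ u) → ¬ (a ≡ u × b ≡ w) →
    c a ≡ c a′ → c b ≡ c b′ → a ≡ a′ × b ≡ b′
  same-edge A A′ n₁ n₂ ea eb with merge-≡ u w ea | merge-≡ u w eb
  ... | inj₁ p | inj₁ q = p , q
  ... | inj₁ refl | inj₂ (inj₁ (refl , refl)) = ⊥-elim (disj (flipAdj G A′) (flipAdj G A))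
  ... | inj₁ refl | inj₂ (inj₂ (refl , refl)) = ⊥-elim (disj (flipAdj G A) (flipAdj G A′))
  ... | inj₂ (inj₁ (refl , refl)) | inj₁ refl = ⊥-elim (disj A′ A)
  ... | inj₂ (inj₂ (refl , refl)) | inj₁ refl = ⊥-elim (disj A A′)
  ... | inj₂ (inj₁ (refl , refl)) | inj₂ (inj₁ (refl , _)) = contradiction refl (adj-≢ G A)
  ... | inj₂ (inj₁ (refl , refl)) | inj₂ (inj₂ (refl , _)) = contradiction (refl , refl) n₁
  ... | inj₂ (inj₂ (refl , refl)) | inj₂ (inj₁ (refl , _)) = contradiction (refl , refl) n₂
  ... | inj₂ (inj₂ (refl , refl)) | inj₂ (inj₂ (refl , _)) = contradiction refl (adj-≢ G A)

  d : Dart G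
  d = dart u w auw

  ¬o : ¬ O σ₀ d (α₀ d)
  ¬o o = u≢w (O-tl o)

  open Merge σ₀ α₀ σ₀-inj α₀-invol d (α₀-moved d) ¬o

  cα : Dart G → Dart G
  cα = cut α₀ d

  orbit⇒label : ∀ {x y} → Add (O σ₀) d (α₀ d) x y → c (tl x) ≡ c (tl y)
  orbit⇒label (inj₁ o) = cong c (O-tl o)
  orbit⇒label (inj₂ (inj₁ (p , q))) = trans (cong c (O-tl p)) (trans (merge-off u w u≢w) (trans (sym (merge-w u w)) (cong c (O-tl q))))
  orbit⇒label (inj₂ (inj₂ (p , q))) = trans (cong c (O-tl p)) (trans (merge-w u w) (trans (sym (merge-off u w u≢w)) (cong c (O-tl q))))

  label⇒orbit : ∀ {x y} → c (tl x) ≡ c (tl y) → O merged x y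
  label⇒orbit {x} {y} e with merge-≡ u w {tl x} {tl y} e
  ... | inj₁ q = proj₁ merged-orbits (inj₁ (tl-O q))
  ... | inj₂ (inj₁ (p , q)) = proj₁ merged-orbits (inj₂ (inj₂ (tl-O p , tl-O (sym q))))
  ... | inj₂ (inj₂ (p , q)) = proj₁ merged-orbits (inj₂ (inj₁ (tl-O p , tl-O (sym q))))

  Realised : Fin n → Fin n → Set
  Realised x y = ∃[ d ] (Moved cα d × c (tl d) ≡ x × c (tl (cα d)) ≡ y)

  keep : ∀ x → x ≢ d → x ≢ α₀ d → ∀ {x′ y′} → c (tl x) ≡ x′ → c (hd x) ≡ y′ → Realised x′ y′
  keep x p q e e′ = x , (λ z → α₀-moved x (trans (sym same) z)) , e , trans (cong (c ∘ tl) same) e′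
    where
    same : cα x ≡ α₀ x
    same = cut-off α₀ α₀-invol d x p q

  realise : ∀ {x y} → Adj H x y → Realised x y
  realise {x} {y} h with hH h
  ... | p , q , inj₁ a = keep (dart x y a) (λ e → q (cong hd e)) (λ e → p (cong tl e)) (merge-off u w p) (merge-off u w q)
  ... | p , q , inj₂ (inj₁ (e , a)) = keep (dart w y a) (λ e → u≢w (sym (cong tl e)))
          (λ e′ → adj-≢ H h (trans e (sym (cong hd e′)))) (trans (merge-w u w) (sym e)) (merge-off u w q)
  ... | p , q , inj₂ (inj₂ (e , a)) = keep (dart x w a) (λ e′ → adj-≢ H h (trans (cong tl e′) (sym e)))
          (λ e → u≢w (sym (cong hd e))) (merge-off u w p) (trans (merge-w u w) (sym e))

  unique : ∀ {x y} → Moved cα x → Moved cα y → c (tl x) ≡ c (tl y) → c (tl (cα x)) ≡ c (tl (cα y)) → x ≡ y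
  unique {x} {y} mx my e e′ with cut-moved α₀ α₀-invol d mx | cut-moved α₀ α₀-invol d my
  ... | _ , nx , nx′ , qx | _ , _ , _ , qy =
    let p , q = same-edge (arc x) (arc y) (λ { (a , b) → nx′ (dart-≡ a b) }) (λ { (a , b) → nx (dart-≡ a b) }) e
                  (trans (cong (c ∘ tl) (sym qx)) (trans e′ (cong (c ∘ tl) qy)))
    in dart-≡ p q

  contracted : Map H
  contracted = record
    { σ = merged ; α = cα ; lab = c ∘ tl
    ; injσ = merged-inj
    ; inv = cut-invol α₀ α₀-invol d
    ; lab-σ = λ x → sym (orbit⇒label (proj₂ merged-orbits (E-f {merged} {merged} x)))
    ; lab-O = label⇒orbit
    ; real = realise
    ; uniq = unique }

  contracted-planar : IsPlane R → Planar H
  contracted-planar pl = prune contracted (plane-contract (toPlane pl))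

abstract

  contract : {G H : Graph n} → Planar G → ∀ {u w} → Adj G u w →
    (∀ {x y} → Adj H x y → MinorEdge G u w x y) → Planar H
  contract {n} {G} {H} pG {u} {w} auw hH =
    let R , pl = sub {H = G₁} pG (proj₁ ∘ K⁻) in Contraction.contracted-planar R a₁ disj hH′ pl
    where
    -- Common neighbours are detached from w, so that the contraction creates no parallel edges.
    K : Fin n → Fin n → Set
    K x y = Adj G x y × ¬ (x ≡ w × Adj G u y) × ¬ (y ≡ w × Adj G u x)
    K? : ∀ x y → Dec (K x y)
    K? x y = adj? G x y ×-dec (¬? (x Finₚ.≟ w ×-dec adj? G u y) ×-dec ¬? (y Finₚ.≟ w ×-dec adj? G u x))
    Ksy : ∀ {x y} → K x y → K y x
    Ksy (a , p , q) = flipAdj G a , q , p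
    Kir : ∀ {x} → ¬ K x x
    Kir (a , _) = adj-≢ G a refl
    G₁ : Graph n
    G₁ = mkGraph K? Ksy Kir
    K⁻ : ∀ {x y} → Adj G₁ x y → K x y
    K⁻ = mkGraph⁻ K? Ksy Kir
    K⁺ : ∀ {x y} → K x y → Adj G₁ x y
    K⁺ = mkGraph⁺ K? Ksy Kir
    a₁ : Adj G₁ u w
    a₁ = K⁺ (auw , (λ { (e , _) → adj-≢ G auw e }) , λ { (_ , a) → adj-≢ G a refl })
    disj : ∀ {x} → Adj G₁ u x → Adj G₁ w x → ⊥
    disj a b = proj₁ (proj₂ (K⁻ b)) (refl , proj₁ (K⁻ a))
    hH′ : ∀ {x y} → Adj H x y → MinorEdge G₁ u w x y
    hH′ {x} {y} h with hH h
    ... | p , q , inj₁ a = p , q , inj₁ (K⁺ (a , p ∘ proj₁ , q ∘ proj₁))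
    -- If y also sees u, its edge to w was detached, and the edge to u takes its place.
    ... | p , q , inj₂ (inj₁ (e , a)) = p , q , (case adj? G u y of λ
      { (yes a′) → inj₁ (subst (λ t → Adj G₁ t y) (sym e) (K⁺ (a′ , (λ { (e , _) → adj-≢ G auw e }) , q ∘ proj₁)))
      ; (no ¬a) → inj₂ (inj₁ (e , K⁺ (a , ¬a ∘ proj₂ , q ∘ proj₁))) })
    ... | p , q , inj₂ (inj₂ (e , a)) = p , q , (case adj? G u x of λ
      { (yes a′) → inj₁ (subst (Adj G₁ x) (sym e) (K⁺ (flipAdj G a′ , p ∘ proj₁ , λ { (e , _) → adj-≢ G auw e })))
      ; (no ¬a) → inj₂ (inj₂ (e , K⁺ (a , p ∘ proj₁ , ¬a ∘ proj₂))) })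

-- Neighbourhoods and corners

lookup-injective : {xs : List Elem} → Unique xs → ∀ i j → lookup xs i ≡ lookup xs j → i ≡ j
lookup-injective (_ ∷ _) zero zero _ = refl
lookup-injective {xs = _ ∷ xs} (p ∷ _) zero (suc j) e = contradiction e (All.lookup p (∈-lookup {xs = xs} j))
lookup-injective {xs = _ ∷ xs} (p ∷ _) (suc i) zero e = contradiction (sym e) (All.lookup p (∈-lookup {xs = xs} i))
lookup-injective (_ ∷ u) (suc i) (suc j) e = cong suc (lookup-injective u i j e)

length-⊆ : {xs ys : List Elem} → Unique xs → (∀ {x} → x ∈ xs → x ∈ ys) → length xs ≤ length ys
length-⊆ {xs = xs} {ys} u s = Finₚ.injective⇒≤ {f = λ i → index (s (∈-lookup {xs = xs} i))} λ {i} {j} e →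
  lookup-injective u i j (trans (lookup-index (s (∈-lookup i))) (trans (cong (lookup ys) e) (sym (lookup-index (s (∈-lookup j))))))

nbrs : Graph n → Fin n → List (Fin n)
nbrs {n} G v = filter (adj? G v) (allFin n)

nbrs-unique : (G : Graph n) → ∀ v → Unique (nbrs G v)
nbrs-unique {n} G v = Uniqueₚ.filter⁺ (adj? G v) (Uniqueₚ.allFin⁺ n)

∈-nbrs⁺ : (G : Graph n) → ∀ {v w} → Adj G v w → w ∈ nbrs G v
∈-nbrs⁺ G {v} {w} a = ∈-filter⁺ (adj? G v) (∈-allFin w) a

∈-nbrs⁻ : (G : Graph n) → ∀ {v w} → w ∈ nbrs G v → Adj G v w
∈-nbrs⁻ {n} G {v} i = proj₂ (∈-filter⁻ (adj? G v) {xs = allFin n} i)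

length-nbrs : (G : Graph n) → ∀ v → length (nbrs G v) ≡ degree G v
length-nbrs {n} G v = go (allFin n)
  where
  go : ∀ xs → length (filter (adj? G v) xs) ≡ sum (map (λ w → bool→ℕ (adj G v w)) xs)
  go [] = refl
  go (x ∷ xs) with adj G v x
  ... | true = cong suc (go xs)
  ... | false = go xs

del-neighbours : {G : Graph n} → Planar G → ∀ z →
  Σ[ H ∈ Graph n ] (Planar H × (∀ w → ¬ Adj H z w) × (∀ {x y} → x ≢ z → y ≢ z → Adj G x y → Adj H x y))
del-neighbours {n} {G} pG z = H , sub pG (proj₁ ∘ mkGraph⁻ P? sy ir) , (λ w a → proj₁ (proj₂ (mkGraph⁻ P? sy ir a)) refl) ,
  λ p q a → mkGraph⁺ P? sy ir (a , p , q)
  where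
  P : Fin n → Fin n → Set
  P x y = Adj G x y × x ≢ z × y ≢ z
  P? : ∀ x y → Dec (P x y)
  P? x y = adj? G x y ×-dec (¬? (x Finₚ.≟ z) ×-dec ¬? (y Finₚ.≟ z))
  sy : ∀ {x y} → P x y → P y x
  sy (a , p , q) = flipAdj G a , q , p
  ir : ∀ {x} → ¬ P x x
  ir (a , _) = adj-≢ G a refl
  H = mkGraph P? sy ir

data Path (G : Graph n) (P : Fin n → Set) : Fin n → Fin n → Set where
  stop : ∀ {a} → P a → Path G P a a
  move : ∀ {a b c} → P a → Adj G a b → Path G P b c → Path G P a c

module _ {G : Graph n} {P : Fin n → Set} where

  path-start : ∀ {a b} → Path G P a b → P a
  path-start (stop p) = p
  path-start (move p _ _) = p

  path-end : ∀ {a b} → Path G P a b → P b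
  path-end (stop p) = p
  path-end (move _ _ r) = path-end r

  path-trans : ∀ {a b c} → Path G P a b → Path G P b c → Path G P a c
  path-trans (stop _) r = r
  path-trans (move p e q) r = move p e (path-trans q r)

  path-sym : ∀ {a b} → Path G P a b → Path G P b a
  path-sym (stop p) = stop p
  path-sym (move p e q) = path-trans (path-sym q) (move (path-start q) (flipAdj G e) (stop p))

path-map : {G : Graph n} {P Q : Fin n → Set} → (∀ {a} → P a → Q a) → ∀ {a b} → Path G P a b → Path G Q a b
path-map f (stop p) = stop (f p)
path-map f (move p e q) = move (f p) e (path-map f q)

module Corners {G : Graph n} (R : Rotation G) (v : Fin n) (deg : degree G v ≡ 5) where

  open Rotated R public

  first : ∃[ w ] Adj G v w
  first with nbrs G v in e
  ... | [] = contradiction (trans (sym deg) (trans (sym (length-nbrs G v)) (cong length e))) λ ()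
  ... | w ∷ ws = w , ∈-nbrs⁻ G (subst (w ∈_) (sym e) (here refl))

  module From (w₀ : Fin n) (a₀ : Adj G v w₀) where

    -- The neighbours in cyclic order, with period five. The starting neighbour is a parameter so
    -- that a case can be renumbered.
    w : ℕ → Fin n
    w k = iter (rot R v) k w₀

    vw : ∀ k → Adj G v (w k)
    vw zero = a₀
    vw (suc k) = rot-adj R v (w k) (vw k)

    δ : ℕ → Dart G
    δ k = dart v (w k) (vw k)

    w-pred : ∀ i j → w (suc i) ≡ w (suc j) → w i ≡ w j
    w-pred i j e = cong hd (σ₀-inj {δ i} {δ j} (dart-≡ refl e))

    w-cancel : ∀ i j → w (i + j) ≡ w i → w j ≡ w 0
    w-cancel zero j e = e
    w-cancel (suc i) j e = w-cancel i j (w-pred (i + j) i e)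

    w-covers : ∀ {x} → Adj G v x → ∃[ k ] w k ≡ x
    w-covers a = rot-cyc R v w₀ _ a₀ a

    w-reduce : ∀ m → w (suc m) ≡ w 0 → ∀ fuel k → k ≤ fuel → ∃[ j ] (j < suc m × w j ≡ w k)
    w-reduce m e fuel k k≤ with suc m ≤? k
    ... | no m≰k = k , ≰⇒> m≰k , refl
    w-reduce m e (suc fuel) (suc k) (s≤s k≤) | yes (s≤s m≤k) with w-reduce m e fuel (k ∸ m) (≤-trans (m∸n≤m k m) k≤)
    ... | j , j< , q = j , j< , trans q (sym (trans (cong w (sym (trans (+-suc (k ∸ m) m) (cong suc (m∸n+n≡m m≤k)))))
                        (trans (iter-+ (rot R v) (k ∸ m) (suc m) w₀) (cong (iter (rot R v) (k ∸ m)) e))))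

    -- A shorter period could not cover the five neighbours.
    w-period-≥5 : ∀ m → w (suc m) ≡ w 0 → 5 ≤ suc m
    w-period-≥5 m e = subst₂ _≤_ (trans (length-nbrs G v) deg) (trans (length-map w (upTo (suc m))) (length-upTo (suc m)))
      (length-⊆ {ys = map w (upTo (suc m))} (nbrs-unique G v) λ i →
        let k , q = w-covers (∈-nbrs⁻ G i) ; j , j< , r = w-reduce m e k k ≤-refl
        in subst (_∈ map w (upTo (suc m))) (trans r q) (∈-map⁺ w (∈-upTo⁺ j<)))

    w-gap : ∀ i j → i < j → w i ≡ w j → 5 + i ≤ j
    w-gap i j i<j e = subst (5 + i ≤_) (trans (cong (_+ i) (suc-pred′ i<j)) (m∸n+n≡m (<⇒≤ i<j)))
      (+-monoˡ-≤ i (w-period-≥5 (j ∸ suc i) (w-cancel i _ (trans (cong w (trans (+-comm i _) (trans (cong (_+ i) (suc-pred′ i<j)) (m∸n+n≡m (<⇒≤ i<j))))) (sym e)))))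
      where
      suc-pred′ : ∀ {i j} → i < j → suc (j ∸ suc i) ≡ j ∸ i
      suc-pred′ {i} {suc j} (s≤s i≤j) = sym (+-∸-assoc 1 i≤j)

    w-inj : ∀ i j → i < 5 → j < 5 → w i ≡ w j → i ≡ j
    w-inj i j i< j< e with <-cmp i j
    ... | tri< lt _ _ = contradiction (≤-trans (m≤m+n 5 i) (w-gap i j lt e)) (<⇒≱ j<)
    ... | tri≈ _ q _ = q
    ... | tri> _ _ gt = contradiction (≤-trans (m≤m+n 5 j) (w-gap j i gt (sym e))) (<⇒≱ i<)

    abstract

      -- Six indices meet five neighbours. A repetition has a gap of at least five, so it can only
      -- be at 0 and 5.
      w-5 : w 5 ≡ w 0
      w-5 with Finₚ.pigeonhole {5} {6} (n<1+n 5) (λ i → subst Fin (trans (length-nbrs G v) deg) (index (∈-nbrs⁺ G (vw (toℕ i)))))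
      ... | i , j , i<j , e = trans (cong w (sym j≡5)) (trans (sym wij) (cong w i≡0))
        where
        unsubst : ∀ {m k} (q : m ≡ k) {x y : Fin m} → subst Fin q x ≡ subst Fin q y → x ≡ y
        unsubst refl p = p
        wij : w (toℕ i) ≡ w (toℕ j)
        wij = trans (lookup-index (∈-nbrs⁺ G (vw (toℕ i)))) (trans (cong (lookup (nbrs G v)) (unsubst _ e))
                (sym (lookup-index (∈-nbrs⁺ G (vw (toℕ j))))))
        gap : 5 + toℕ i ≤ toℕ j
        gap = w-gap _ _ i<j wij
        j≤5 : toℕ j ≤ 5
        j≤5 = ≤-pred (Finₚ.toℕ<n j)
        j≡5 : toℕ j ≡ 5
        j≡5 = ≤-antisym j≤5 (≤-trans (m≤m+n 5 (toℕ i)) gap)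
        i≡0 : toℕ i ≡ 0
        i≡0 = n≤0⇒n≡0 (+-cancelˡ-≤ 5 _ _ (≤-trans gap j≤5))

      w-nbr : ∀ {x} → Adj G v x → ∃[ k ] (k < 5 × w k ≡ x)
      w-nbr a = let k , q = w-covers a ; j , j< , r = w-reduce 4 w-5 k k ≤-refl in j , j< , trans r q

    δ-≡ : ∀ i j → w i ≡ w j → δ i ≡ δ j
    δ-≡ i j e = dart-≡ refl e

    module Split (pl : IsPlane R) {i j : ℕ} (i<5 : i < 5) (j<5 : j < 5) (i≢j : i ≢ j)
      (sf : SameFace R (δ (suc i)) (δ (suc j))) where

      -- `faceNext` sends the reverse of `δ i` to `δ (suc i)`, so the face of `δ (suc i)` has its
      -- corner between `w i` and `w (suc i)`. Cutting v open at two such corners is a swap at `δ i`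
      -- and `δ j`.
      σ′ : Dart G → Dart G
      σ′ = σ₀ ∘ swap (δ i) (δ j)

      off : ∀ d → d ≢ δ i → d ≢ δ j → σ′ d ≡ σ₀ d
      off = Transposed.off (swap-transposed σ₀ (λ e → i≢j (w-inj i j i<5 j<5 (cong hd e))))

      disconnected : ¬ E σ′ α₀ (δ i) (δ j)
      disconnected = split-disconnects σ₀-inj α₀-invol (toPlane pl) (λ e → i≢j (w-inj i j i<5 j<5 (cong hd e))) (tl-O refl)
        (to i ◅◅ (sameFace⇒O sf ◅◅ E-sym (to j)))
        where
        to : ∀ k → O (faceNext R) (α₀ (δ k)) (δ (suc k))
        to k = subst (O (faceNext R) (α₀ (δ k))) (dart-≡ refl refl) (E-f (α₀ (δ k)))

      around : ∀ {d d′} → tl d ≢ v → tl d ≡ tl d′ → E σ′ α₀ d d′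
      around {d} {d′} ne e with σ₀-orbit {d} {d′} e
      ... | k , q = subst (E σ′ α₀ d) q (go k)
        where
        go : ∀ k → E σ′ α₀ d (iter σ₀ k d)
        go zero = ε
        go (suc k) = go k ◅◅ Clo.return (inj₁ (off _ (bad i) (bad j)))
          where
          bad : ∀ m → iter σ₀ k d ≢ δ m
          bad m q = ne (trans (sym (proj₁ (σ₀-iter k d))) (cong tl q))

      along : ∀ {a b} → Path G (_≢ v) a b → ∀ {d d′} → tl d ≡ a → tl d′ ≡ b → E σ′ α₀ d d′
      along (stop p) refl q = around p (sym q)
      along (move {a} {b} p e r) refl q = around {d′ = dart a b e} p refl ◅◅ (E-g _ ◅◅ along r refl q)

      across : ∀ {s t} → Path G (_≢ v) (w s) (w t) → E σ′ α₀ (δ s) (δ t)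
      across {s} {t} r = E-g (δ s) ◅◅ (along r refl refl ◅◅ E-sym (E-g (δ t)))

      turn : ∀ k → k < 5 → k ≢ i → k ≢ j → E σ′ α₀ (δ k) (δ (suc k))
      turn k k< p q = Clo.return (inj₁ (off (δ k) (λ e → p (w-inj k i k< i<5 (cong hd e))) (λ e → q (w-inj k j k< j<5 (cong hd e)))))

    -- The swap is at 4, the cyclic predecessor of 0, and at 0: it leaves `w 0` alone on one part of
    -- v.
    split-one : IsPlane R → SameFace R (δ 0) (δ 1) → ∀ t → t < 5 → t ≢ 0 → ¬ Path G (_≢ v) (w 0) (w t)
    split-one pl sf t t< t≢0 r = disconnected (E-sym (up t t< t≢0) ◅◅ E-sym (across {0} {t} r))
      where
      open Split pl {4} {0} (s≤s (s≤s (s≤s (s≤s (s≤s z≤n))))) (s≤s z≤n) (λ ()) (subst (λ d → SameFace R d (δ 1)) (sym (δ-≡ 5 0 w-5)) sf)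
      up : ∀ t → t < 5 → t ≢ 0 → E σ′ α₀ (δ t) (δ 4)
      up 0 _ ne = contradiction refl ne
      up 1 lt _ = turn 1 lt (λ ()) (λ ()) ◅◅ (turn 2 (s≤s (s≤s (s≤s z≤n))) (λ ()) (λ ()) ◅◅ turn 3 (s≤s (s≤s (s≤s (s≤s z≤n)))) (λ ()) (λ ()))
      up 2 lt _ = turn 2 lt (λ ()) (λ ()) ◅◅ turn 3 (s≤s (s≤s (s≤s (s≤s z≤n)))) (λ ()) (λ ())
      up 3 lt _ = turn 3 lt (λ ()) (λ ())
      up 4 lt _ = ε
      up (suc (suc (suc (suc (suc _))))) (s≤s (s≤s (s≤s (s≤s (s≤s ()))))) _

    -- The swap at 4 and 1 divides the darts at v into 0, 1 and 2, 3, 4.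
    split-two : IsPlane R → SameFace R (δ 0) (δ 2) → ∀ s t → s < 2 → 2 ≤ t → t < 5 → ¬ Path G (_≢ v) (w s) (w t)
    split-two pl sf s t s<2 2≤t t< r = disconnected (E-sym (up t 2≤t t<) ◅◅ (E-sym (across {s} {t} r) ◅◅ low s s<2))
      where
      open Split pl {4} {1} (s≤s (s≤s (s≤s (s≤s (s≤s z≤n))))) (s≤s (s≤s z≤n)) (λ ()) (subst (λ d → SameFace R d (δ 2)) (sym (δ-≡ 5 0 w-5)) sf)
      low : ∀ s → s < 2 → E σ′ α₀ (δ s) (δ 1)
      low 0 _ = turn 0 (s≤s z≤n) (λ ()) (λ ())
      low 1 _ = ε
      low (suc (suc _)) (s≤s (s≤s ()))
      up : ∀ t → 2 ≤ t → t < 5 → E σ′ α₀ (δ t) (δ 4)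
      up 2 _ lt = turn 2 lt (λ ()) (λ ()) ◅◅ turn 3 (s≤s (s≤s (s≤s (s≤s z≤n)))) (λ ()) (λ ())
      up 3 _ lt = turn 3 lt (λ ()) (λ ())
      up 4 _ lt = ε
      up 1 (s≤s ()) _
      up (suc (suc (suc (suc (suc _))))) _ (s≤s (s≤s (s≤s (s≤s (s≤s ())))))

-- The complete graph on five vertices

product-count : ∀ a b → Count {Fin a × Fin b} _≡_ (a * b)
product-count a b = remQuot {a} b , (λ i j i≢j e → i≢j (trans (sym (Finₚ.combine-remQuot {a} b i))
  (trans (cong (λ p → Fin.combine (proj₁ p) (proj₂ p)) e) (Finₚ.combine-remQuot {a} b j)))) ,
  λ { (i , j) → Fin.combine i j , Finₚ.remQuot-combine i j }

module Complete5 (G : Graph 5) (full : ∀ {u w} → u ≢ w → Adj G u w) (R : Rotation G) (f c : ℕ) (cf : FaceCount R f) (cc : ComponentCount G c)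
  (eu : 2 * 5 + 2 * f + 2 * isolatedCount G ≡ 4 * c + dartCount G) where

  open Rotated R
  b : ∀ u w → adj G u w ≡ not ⌊ u Finₚ.≟ w ⌋
  b u w with u Finₚ.≟ w
  ... | yes refl = adj-irr G u
  ... | no ne = full ne
  deg : ∀ u → degree G u ≡ sum (map (λ w → bool→ℕ (not ⌊ u Finₚ.≟ w ⌋)) (allFin 5))
  deg u = cong sum (map-cong (λ w → cong bool→ℕ (b u w)) (allFin 5))
  e≡20 : dartCount G ≡ 20
  e≡20 = cong sum (map-cong deg (allFin 5))
  i≡0 : isolatedCount G ≡ 0
  i≡0 = cong sum (map-cong (λ v → cong (λ t → bool→ℕ (isZero t)) (deg v)) (allFin 5))
  conn : ∀ u w → Reach G u w
  conn u w with u Finₚ.≟ w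
  ... | yes refl = here
  ... | no ne = step (full ne) here
  c≡1 : ∀ c → ComponentCount G c → c ≡ 1
  c≡1 zero (_ , _ , cov) with () ← proj₁ (cov zero)
  c≡1 (suc zero) _ = refl
  c≡1 (suc (suc c)) (rep , dist , _) = contradiction (conn (rep zero) (rep (suc zero))) (dist zero (suc zero) λ ())
  f≡7 : f ≡ 7
  f≡7 = *-cancelˡ-≡ f 7 2 (+-cancelˡ-≡ 10 _ _ (trans (sym (+-identityʳ (10 + 2 * f)))
          (trans (subst₂ (λ x y → 10 + 2 * f + 2 * x ≡ y) i≡0 (cong₂ (λ x y → 4 * x + y) (c≡1 c cc) e≡20) eu) refl)))
  faces : Count (SameFace R) 7
  faces = subst (Count (SameFace R)) f≡7 cf
  rep : Fin 7 → Dart G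
  rep = proj₁ faces
  φ : Dart G → Dart G
  φ = faceNext R
  φ-fixfree : ∀ d → φ d ≢ d
  φ-fixfree d e = adj-≢ G (arc d) (sym (cong tl e))
  other : ∀ (x y : Fin 5) → ∃[ z ] (z ≢ x × z ≢ y)
  other x y with Finₚ.¬∀⟶∃¬ 5 (λ z → z ≡ x ⊎ z ≡ y) (λ z → (z Finₚ.≟ x) ⊎-dec (z Finₚ.≟ y)) bad
    where
    bad : ¬ (∀ z → z ≡ x ⊎ z ≡ y)
    bad h = Finₚ.<⇒notInjective {f = g} (s≤s (s≤s (s≤s z≤n))) inj
      where
      code : ∀ {z} → z ≡ x ⊎ z ≡ y → Fin 2
      code (inj₁ _) = zero
      code (inj₂ _) = suc zero
      g : Fin 5 → Fin 2
      g z = code (h z)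
      inj : ∀ {z z′} → g z ≡ g z′ → z ≡ z′
      inj {z} {z′} e with h z | h z′
      ... | inj₁ p | inj₁ q = trans p (sym q)
      ... | inj₂ p | inj₂ q = trans p (sym q)
  ... | z , nz = z , (nz ∘ inj₁) , (nz ∘ inj₂)
  -- A facial walk of length two would make u a fixed point of the rotation at w, which has to reach
  -- other neighbours too.
  φ²-fixfree : ∀ d → φ (φ d) ≢ d
  φ²-fixfree (dart u w a) e with other w u
  ... | z , z≢w , z≢u with rot-cyc R w u z (flipAdj G a) (full (z≢w ∘ sym))
  ... | k , q = z≢u (trans (sym q) (stay k))
    where
    stay : ∀ k → iter (rot R w) k u ≡ u
    stay zero = refl
    stay (suc k) = trans (cong (rot R w) (stay k)) (cong tl e)
  sameφ : ∀ i j d → toℕ {3} i < toℕ {3} j → iter φ (toℕ i) d ≢ iter φ (toℕ j) d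
  sameφ zero zero d () e
  sameφ zero (suc zero) d _ e = φ-fixfree d (sym e)
  sameφ zero (suc (suc zero)) d _ e = φ²-fixfree d (sym e)
  sameφ (suc zero) (suc (suc zero)) d _ e = φ-fixfree (φ d) (sym e)
  sameφ (suc zero) (suc zero) d (s≤s ()) e
  sameφ (suc (suc zero)) (suc zero) d (s≤s ()) e
  sameφ (suc (suc zero)) (suc (suc zero)) d (s≤s (s≤s ())) e
  dartAt : Fin 7 × Fin 3 → Dart G
  dartAt (i , j) = iter φ (toℕ j) (rep i)
  dartAt-inj : ∀ {p q} → dartAt p ≡ dartAt q → p ≡ q
  dartAt-inj {i , j} {i′ , j′} e with i Finₚ.≟ i′
  ... | no ne = contradiction (O⇒sameFace (O-iter (toℕ j) (rep i) ◅◅ subst (λ t → O φ t (rep i′)) (sym e) (E-sym (O-iter (toℕ j′) (rep i′)))))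
                  (proj₁ (proj₂ faces) i i′ ne)
  ... | yes refl with Finₚ.<-cmp j j′
  ...   | tri≈ _ refl _ = refl
  ...   | tri< lt _ _ = contradiction e (sameφ j j′ (rep i) lt)
  ...   | tri> _ _ gt = contradiction (sym e) (sameφ j′ j (rep i) gt)
  place : Fin 7 × Fin 3 → Σ (Fin 5 × Fin 5) (λ p → adjᵖ G p ≡ true)
  place q = (tl (dartAt q) , hd (dartAt q)) , arc (dartAt q)
  place-inj : ∀ {q q′} → proj₁ (place q) ≡ proj₁ (place q′) → q ≡ q′
  place-inj {q} {q′} e = dartAt-inj {q} {q′} (dart-≡ {d = dartAt q} {dartAt q′} (cong proj₁ e) (cong proj₂ e))

-- Euler's formula yields seven faces. Each contains at least three darts, since neither φ nor φ²
-- has a fixed point: 21 darts, but there are 20.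
complete-5 : (G : Graph 5) → (∀ {u w} → u ≢ w → Adj G u w) → ¬ Planar G
complete-5 G full (R , f , c , cf , cc , eu) = <⇒≱ (n<1+n 20) (count-≤ {R = _≡_} (on₁-equiv isEquivalence) place place-inj (product-count 7 3)
  (subst (Count (On₁ {P = λ p → adjᵖ G p ≡ true} _≡_)) e≡20 (dartCount-count G)))
  where open Complete5 G full R f c cf cc eu

remove-vertex : ∀ {n} {G : Graph (suc n)} → Planar G → ∀ z →
  Σ[ H ∈ Graph n ] (Planar H × (∀ {a b} → Adj G (punchIn z a) (punchIn z b) → Adj H a b))
remove-vertex pG z =
  let H , pH , iso , keep = del-neighbours pG z
      H′ , pH′ , same = del-vertex pH z iso
  in H′ , pH′ , λ {a} {b} e → trans (same a b) (keep (Finₚ.punchInᵢ≢i z a) (Finₚ.punchInᵢ≢i z b) e)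

Clique5 : Graph n → Set
Clique5 {n} G = Σ[ ι ∈ (Fin 5 → Fin n) ] ((∀ {i j} → ι i ≡ ι j → i ≡ j) × (∀ {i j} → i ≢ j → Adj G (ι i) (ι j)))

clique-onto : {G : Graph n} → Planar G → ((ι , _) : Clique5 G) → ¬ (∀ u → ∃[ i ] ι i ≡ u)
clique-onto {n} {G} pG (ι , inj , h) onto = go n≡5 G pG λ {u} {w} u≢w → subst₂ (Adj G) (proj₂ (onto u)) (proj₂ (onto w)) (h λ e →
    u≢w (trans (sym (proj₂ (onto u))) (trans (cong ι e) (proj₂ (onto w)))))
  where
  n≡5 : n ≡ 5
  n≡5 = ≤-antisym (Finₚ.injective⇒≤ {f = λ u → proj₁ (onto u)} λ {u} {w} e → trans (sym (proj₂ (onto u))) (trans (cong ι e) (proj₂ (onto w))))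
                  (Finₚ.injective⇒≤ {f = ι} inj)
  go : ∀ {m} → m ≡ 5 → (G : Graph m) → Planar G → ¬ (∀ {u w} → u ≢ w → Adj G u w)
  go refl G pG full = complete-5 G full pG

clique-avoiding : ∀ {n} {G : Graph (suc n)} {H : Graph n} z ((ι , _) : Clique5 G) → (∀ i → z ≢ ι i) →
  (∀ {a b} → Adj G (punchIn z a) (punchIn z b) → Adj H a b) → Clique5 H
clique-avoiding {G = G} z (ι , inj , h) z≢ keep =
  (λ i → punchOut (z≢ i)) , (λ {i} {j} e → inj (Finₚ.punchOut-injective (z≢ i) (z≢ j) e)) ,
  λ {i} {j} i≢j → keep (subst₂ (Adj G) (sym (Finₚ.punchIn-punchOut (z≢ i))) (sym (Finₚ.punchIn-punchOut (z≢ j))) (h i≢j))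

abstract

  no-K5 : ∀ n {G : Graph n} → Planar G → ¬ Clique5 G
  no-K5 zero pG (ι , _) with () ← ι zero
  no-K5 (suc n) {G} pG K@(ι , _) = case Finₚ.all? onto? of λ
    { (yes all) → clique-onto pG K all
    ; (no ¬all) →
        let z , nz = Finₚ.¬∀⟶∃¬ (suc n) _ onto? ¬all
            H , pH , keep = remove-vertex pG z
        in no-K5 n pH (clique-avoiding {G = G} {H} z K (λ i e → nz (i , sym e)) keep) }
    where
    onto? : ∀ u → Dec (∃[ i ] ι i ≡ u)
    onto? u = Finₚ.any? λ i → ι i Finₚ.≟ u

-- Contractions and K₅ minors

module _ (G : Graph n) (a b : Fin n) where

  private
    P : Fin n → Fin n → Set
    P x y = x ≢ y × MinorEdge G a b x y
    P? : ∀ x y → Dec (P x y)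
    P? x y = ¬? (x Finₚ.≟ y) ×-dec (¬? (x Finₚ.≟ b) ×-dec (¬? (y Finₚ.≟ b) ×-dec
      (adj? G x y ⊎-dec (((x Finₚ.≟ a) ×-dec adj? G b y) ⊎-dec ((y Finₚ.≟ a) ×-dec adj? G x b)))))
    sy : ∀ {x y} → P x y → P y x
    sy (ne , p , q , inj₁ e) = ne ∘ sym , q , p , inj₁ (flipAdj G e)
    sy (ne , p , q , inj₂ (inj₁ (r , e))) = ne ∘ sym , q , p , inj₂ (inj₂ (r , flipAdj G e))
    sy (ne , p , q , inj₂ (inj₂ (r , e))) = ne ∘ sym , q , p , inj₂ (inj₁ (r , flipAdj G e))
    ir : ∀ {x} → ¬ P x x
    ir (ne , _) = ne refl

  abstract
    contraction : Graph n
    contraction = mkGraph P? sy ir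

    contraction⁺ : ∀ {x y} → x ≢ y → MinorEdge G a b x y → Adj contraction x y
    contraction⁺ ne e = mkGraph⁺ P? sy ir (ne , e)

    contraction-planar : Planar G → Adj G a b → Planar contraction
    contraction-planar pG ab = contract {G = G} {contraction} pG ab (proj₂ ∘ mkGraph⁻ P? sy ir)

  contraction-keep : ∀ {x y} → x ≢ b → y ≢ b → Adj G x y → Adj contraction x y
  contraction-keep p q e = contraction⁺ (adj-≢ G e) (p , q , inj₁ e)

-- Contracting a x replaces the path a, x, b by an edge. Paths along which vertices are identified
-- are shortened in this way, without touching edges away from x.
smooth : {G : Graph n} → Planar G → ∀ {a x b} → Adj G a x → Adj G x b → a ≢ b →
  Σ[ H ∈ Graph n ] (Planar H × Adj H a b × (∀ {u w} → u ≢ x → w ≢ x → Adj G u w → Adj H u w))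
smooth {G = G} pG {a} {x} {b} ax xb a≢b = contraction G a x , contraction-planar G a x pG ax ,
  contraction⁺ G a x a≢b (adj-≢ G ax , adj-≢ G xb ∘ sym , inj₂ (inj₁ (refl , xb))) , contraction-keep G a x

module K5Minor (Q : Fin n → Set) {a : Fin n} (a∉Q : ¬ Q a) where

  Attached : Graph n → Fin n → Set
  Attached G y = ∃[ t ] (Path G (¬_ ∘ Q) a t × Adj G t y)

  len : ∀ {G : Graph n} {P : Fin n → Set} {x y} → Path G P x y → ℕ
  len (stop _) = 0
  len (move _ _ p) = suc (len p)

  module _ (G : Graph n) {b : Fin n} (b∉Q : ¬ Q b) (ab : Adj G a b) where

    G′ : Graph n
    G′ = contraction G a b

    a≢b : a ≢ b
    a≢b = adj-≢ G ab

    Q≢ : ∀ {y} → Q y → y ≢ b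
    Q≢ q refl = b∉Q q

    image : ∀ x → ∃[ x′ ] (x ≢ b × x′ ≡ x ⊎ x ≡ b × x′ ≡ a)
    image x with x Finₚ.≟ b
    ... | yes e = a , inj₂ (e , refl)
    ... | no ne = x , inj₁ (ne , refl)

    image-∉Q : ∀ x → ¬ Q x → ¬ Q (proj₁ (image x))
    image-∉Q x nq with image x
    ... | _ , inj₁ (_ , refl) = nq
    ... | _ , inj₂ (_ , refl) = a∉Q

    image-adj : ∀ x y → Adj G x y → proj₁ (image x) ≡ proj₁ (image y) ⊎ Adj G′ (proj₁ (image x)) (proj₁ (image y))
    image-adj x y e with image x | image y
    ... | _ , inj₁ (p , refl) | _ , inj₁ (q , refl) = inj₂ (contraction-keep G a b p q e)
    ... | _ , inj₁ (p , refl) | _ , inj₂ (refl , refl) with x Finₚ.≟ a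
    ...   | yes r = inj₁ r
    ...   | no ne = inj₂ (contraction⁺ G a b ne (p , a≢b , inj₂ (inj₂ (refl , e))))
    image-adj x y e | _ , inj₂ (refl , refl) | _ , inj₁ (q , refl) with y Finₚ.≟ a
    ...   | yes r = inj₁ (sym r)
    ...   | no ne = inj₂ (contraction⁺ G a b (ne ∘ sym) (a≢b , q , inj₂ (inj₁ (refl , e))))
    image-adj x y e | _ , inj₂ (refl , refl) | _ , inj₂ (refl , refl) = inj₁ refl

    image-path : ∀ {x t} (p : Path G (¬_ ∘ Q) x t) → Σ[ q ∈ Path G′ (¬_ ∘ Q) (proj₁ (image x)) (proj₁ (image t)) ] len q ≤ len p
    image-path {x} (stop nq) = stop (image-∉Q x nq) , z≤n
    image-path {x} (move {b = y} nq e p) with image-path p | image-adj x y e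
    ... | q , le | inj₁ r rewrite r = q , m≤n⇒m≤1+n le
    ... | q , le | inj₂ e′ = move (image-∉Q x nq) e′ q , s≤s le

    image-a : proj₁ (image a) ≡ a
    image-a with image a
    ... | _ , inj₁ (_ , r) = r
    ... | _ , inj₂ (_ , r) = r

    image-b : proj₁ (image b) ≡ a
    image-b with image b
    ... | _ , inj₁ (p , _) = contradiction refl p
    ... | _ , inj₂ (_ , r) = r

    image-nbr : ∀ {t y} → ¬ Q t → Q y → Adj G t y → Adj G′ (proj₁ (image t)) y
    image-nbr {t} {y} nt q e with image t
    ... | _ , inj₁ (p , refl) = contraction-keep G a b p (Q≢ q) e
    ... | _ , inj₂ (refl , refl) = contraction⁺ G a b (λ { refl → a∉Q q }) (a≢b , Q≢ q , inj₂ (inj₁ (refl , e)))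

    attached-image : ∀ {y} → Q y → Attached G y → Attached G′ y
    attached-image q (t , p , e) = proj₁ (image t) , subst (λ z → Path G′ (¬_ ∘ Q) z (proj₁ (image t))) image-a (proj₁ (image-path p)) , image-nbr (path-end p) q e

  record Shrunk (G G′ : Graph n) : Set where
    field
      pl : Planar G′
      keepQ : ∀ {x y} → Q x → Q y → Adj G x y → Adj G′ x y
      keepA : ∀ {y} → Q y → Adj G a y → Adj G′ a y
      keepAtt : ∀ {y} → Q y → Attached G y → Attached G′ y

  -- Contracting the first edge of the path into a shortens it, and the paths that attach other
  -- vertices are carried along by `image`. The fuel bounds the length because the image path is a
  -- new one.
  pull : ∀ fuel (G : Graph n) → Planar G → ∀ {t y} → Q y → (p : Path G (¬_ ∘ Q) a t) → len p ≤ fuel → Adj G t y →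
    Σ[ G′ ∈ Graph n ] (Shrunk G G′ × Adj G′ a y)
  pull fuel G pG q (stop _) _ e = G , record { pl = pG ; keepQ = λ _ _ → id ; keepA = λ _ → id ; keepAtt = λ _ → id } , e
  pull (suc fuel) G pG {t} {y} q (move {b = b} na ab p) (s≤s le) e =
    let nb = path-start p
        p′ , le′ = image-path G nb ab p
        p″ : Σ[ r ∈ Path (G′ G nb ab) (¬_ ∘ Q) a (proj₁ (image G nb ab t)) ] len r ≤ fuel
        p″ = subst (λ z → Σ[ r ∈ Path (G′ G nb ab) (¬_ ∘ Q) z (proj₁ (image G nb ab t)) ] len r ≤ fuel) (image-b G nb ab) (p′ , ≤-trans le′ le)
        H , sh , e′ = pull fuel (G′ G nb ab) (contraction-planar G a b pG ab) q (proj₁ p″) (proj₂ p″) (image-nbr G nb ab (path-end p) q e)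
        open Shrunk sh
    in H , record { pl = pl
                  ; keepQ = λ qx qy e → keepQ qx qy (contraction-keep G a b (Q≢ G nb ab qx) (Q≢ G nb ab qy) e)
                  ; keepA = λ qy e → keepA qy (contraction-keep G a b (a≢b G nb ab) (Q≢ G nb ab qy) e)
                  ; keepAtt = λ qy att → keepAtt qy (attached-image G nb ab qy att) } , e′

  no-K5-minor : (G : Graph n) → Planar G → (ι : Fin 4 → Fin n) → (∀ {i j} → ι i ≡ ι j → i ≡ j) → (∀ i → Q (ι i)) →
    (∀ {i j} → i ≢ j → Adj G (ι i) (ι j)) → ¬ (∀ i → Attached G (ι i))
  no-K5-minor G₀ p₀ ι inj qι clique att =
    let G₁ , s₁ , e₁ = go G₀ p₀ (# 0) (att (# 0))
        open Shrunk s₁ renaming (pl to p₁; keepQ to kq₁; keepA to ka₁; keepAtt to kt₁)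
        G₂ , s₂ , e₂ = go G₁ p₁ (# 1) (kt₁ (qι _) (att (# 1)))
        open Shrunk s₂ renaming (pl to p₂; keepQ to kq₂; keepA to ka₂; keepAtt to kt₂)
        G₃ , s₃ , e₃ = go G₂ p₂ (# 2) (kt₂ (qι _) (kt₁ (qι _) (att (# 2))))
        open Shrunk s₃ renaming (pl to p₃; keepQ to kq₃; keepA to ka₃; keepAtt to kt₃)
        G₄ , s₄ , e₄ = go G₃ p₃ (# 3) (kt₃ (qι _) (kt₂ (qι _) (kt₁ (qι _) (att (# 3)))))
        open Shrunk s₄ renaming (pl to p₄; keepQ to kq₄; keepA to ka₄; keepAtt to kt₄)
        nbr : ∀ i → Adj G₄ a (ι i)
        nbr = λ { zero → ka₄ (qι _) (ka₃ (qι _) (ka₂ (qι _) e₁))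
                ; (suc zero) → ka₄ (qι _) (ka₃ (qι _) e₂)
                ; (suc (suc zero)) → ka₄ (qι _) e₃
                ; (suc (suc (suc zero))) → e₄ }
        κ : Fin 5 → Fin n
        κ = λ { zero → a ; (suc i) → ι i }
        edges : ∀ {i j} → i ≢ j → Adj G₄ (κ i) (κ j)
        edges = λ { {zero} {zero} ne → contradiction refl ne
                  ; {zero} {suc j} ne → nbr j
                  ; {suc i} {zero} ne → flipAdj G₄ (nbr i)
                  ; {suc i} {suc j} ne → kq₄ (qι _) (qι _) (kq₃ (qι _) (qι _) (kq₂ (qι _) (qι _) (kq₁ (qι _) (qι _) (clique (ne ∘ cong suc))))) }
    in no-K5 n p₄ (κ , (λ { {zero} {zero} _ → refl
                          ; {zero} {suc j} e → contradiction (subst Q (sym e) (qι j)) a∉Q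
                          ; {suc i} {zero} e → contradiction (subst Q e (qι i)) a∉Q
                          ; {suc i} {suc j} e → cong suc (inj e) }) , edges)
    where
    go : ∀ G → Planar G → ∀ i → Attached G (ι i) → Σ[ G′ ∈ Graph n ] (Shrunk G G′ × Adj G′ a (ι i))
    go G pG i (t , p , e) = pull (len p) G pG (qι i) p ≤-refl e

-- Lists of colours

em : {P : Set} → ¬ ¬ Dec P
em k = k (no λ p → k (yes p))

-- Inside a refutation this makes predicates such as reachability decidable without an algorithm.
dec-all : {P : Fin n → Set} → ¬ ¬ (∀ u → Dec (P u))
dec-all {zero} k = k λ ()
dec-all {suc n} {P} k = em λ d → dec-all {n} {P ∘ suc} λ ds → k λ { zero → d ; (suc u) → ds u }

_∈ℕ?_ : (x : ℕ) (xs : List ℕ) → Dec (x ∈ xs)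
_∈ℕ?_ = DecMem._∈?_ _≟_

_∈F?_ : (x : Fin n) (xs : List (Fin n)) → Dec (x ∈ xs)
_∈F?_ = DecMem._∈?_ Finₚ._≟_

abstract

  cover₃ : ∀ (i j k l : Fin 3) → i ≢ j → i ≢ k → j ≢ k → l ≡ i ⊎ l ≡ j ⊎ l ≡ k
  cover₃ = toWitness {a? = Finₚ.all? λ i → Finₚ.all? λ j → Finₚ.all? λ k → Finₚ.all? λ l →
    ¬? (i Finₚ.≟ j) →-dec (¬? (i Finₚ.≟ k) →-dec (¬? (j Finₚ.≟ k) →-dec ((l Finₚ.≟ i) ⊎-dec ((l Finₚ.≟ j) ⊎-dec (l Finₚ.≟ k)))))} _

  third₃ : ∀ (i j : Fin 3) → ∃[ k ] (i ≢ k × j ≢ k)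
  third₃ = toWitness {a? = Finₚ.all? λ i → Finₚ.all? λ j → Finₚ.any? λ k → ¬? (i Finₚ.≟ k) ×-dec ¬? (j Finₚ.≟ k)} _

abstract

  avoid : {xs : List ℕ} → Unique xs → ∀ cs → length cs < length xs → ∃[ x ] (x ∈ xs × x ∉ cs)
  avoid {xs} u cs lt with Any.any? (λ x → ¬? (x ∈ℕ? cs)) xs
  ... | yes a = let x , x∈ , p = find a in x , x∈ , p
  ... | no ¬a = contradiction (length-⊆ u λ {x} x∈ → decidable-stable (x ∈ℕ? cs) λ p → ¬a (lose x∈ p)) (<⇒≱ lt)

-- Exhaustive search over the lists. Colourings are functions, hence the condition that `Q` respects
-- pointwise equality.
search : ∀ {n} (L : Fin n → List ℕ) (Q : (Fin n → ℕ) → Set) → (∀ c → Dec (Q c)) →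
  (∀ {c c′} → (∀ v → c v ≡ c′ v) → Q c → Q c′) → Dec (Σ[ c ∈ (Fin n → ℕ) ] ((∀ v → c v ∈ L v) × Q c))
search {zero} L Q Q? resp with Q? (λ ())
... | yes q = yes ((λ ()) , (λ ()) , q)
... | no ¬q = no λ { (c , _ , q) → ¬q (resp (λ ()) q) }
search {suc n} L Q Q? resp = map′ (λ { (c , i , h , q) → c , (λ { zero → i ; (suc v) → h v }) , q }) (λ { (c , h , q) → c , h zero , h ∘ suc , q }) (go (L zero))
  where
  cons : ℕ → (Fin n → ℕ) → Fin (suc n) → ℕ
  cons x c zero = x
  cons x c (suc v) = c v
  cons-cong : ∀ x {c c′} → (∀ v → c v ≡ c′ v) → ∀ v → cons x c v ≡ cons x c′ v
  cons-cong x h zero = refl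
  cons-cong x h (suc v) = h v
  eta : ∀ c v → c v ≡ cons (c zero) (c ∘ suc) v
  eta c zero = refl
  eta c (suc v) = refl
  Sol : List ℕ → Set
  Sol xs = Σ[ c ∈ (Fin (suc n) → ℕ) ] (c zero ∈ xs × (∀ v → c (suc v) ∈ L (suc v)) × Q c)
  go : ∀ xs → Dec (Sol xs)
  go [] = no λ { (_ , () , _) }
  go (x ∷ xs) with search (L ∘ suc) (Q ∘ cons x) (Q? ∘ cons x) (λ h → resp (cons-cong x h)) | go xs
  ... | yes (c , h , q) | _ = yes (cons x c , here refl , h , q)
  ... | no _ | yes (c , i , h , q) = yes (c , there i , h , q)
  ... | no ¬s | no ¬t = no λ { (c , here refl , h , q) → ¬s (c ∘ suc , h , resp (eta c) q) ; (c , there i , h , q) → ¬t (c , i , h , q) }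

record Renaming : Set where
  field
    to from : ℕ → ℕ
    to-from : ∀ x → to (from x) ≡ x
    from-to : ∀ x → from (to x) ≡ x

-- A bijection of all colours that matches the lists position by position: each new pair is
-- corrected by a transposition, which does not disturb the other pairs.
matching : ∀ xs ys → Unique xs → Unique ys → length xs ≡ length ys →
  Σ[ π ∈ Renaming ] Pointwise (λ x y → Renaming.from π x ≡ y) xs ys
matching [] [] _ _ _ = record { to = id ; from = id ; to-from = λ _ → refl ; from-to = λ _ → refl } , []
matching (x ∷ xs) (y ∷ ys) (px ∷ ux) (py ∷ uy) e with matching xs ys ux uy (suc-injective e)
... | π , pw = record
      { to = to ∘ s ; from = s ∘ from
      ; to-from = λ z → trans (cong to (swapWith-invol _≟_ y (from x) (from z))) (to-from z)
      ; from-to = λ z → trans (cong s (from-to (s z))) (swapWith-invol _≟_ y (from x) z) } ,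
    swapWith-y _≟_ y (from x) ∷ go px py pw
  where
  open Renaming π
  s : ℕ → ℕ
  s = swapWith _≟_ y (from x)
  from-inj : ∀ {a b} → from a ≡ from b → a ≡ b
  from-inj {a} {b} e = trans (sym (to-from a)) (trans (cong to e) (to-from b))
  go : ∀ {as bs} → All (x ≢_) as → All (y ≢_) bs → Pointwise (λ a b → from a ≡ b) as bs → Pointwise (λ a b → s (from a) ≡ b) as bs
  go [] [] [] = []
  go (p ∷ ps) (q ∷ qs) (refl ∷ rs) = swapWith-off _≟_ (q ∘ sym) (λ e → p (sym (from-inj e))) ∷ go ps qs rs

arrange : {P : ℕ → Set} → (∀ x → Dec (P x)) → ∀ {xs} → Unique xs → Σ[ p ∈ List ℕ ] Σ[ q ∈ List ℕ ]
  (All P p × All (¬_ ∘ P) q × Unique p × Unique q × Unique (p ++ q) × length (p ++ q) ≡ length xs ×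
   (∀ {x} → x ∈ xs → x ∈ p ++ q) × (∀ {x} → x ∈ p ++ q → x ∈ xs))
arrange {P} P? {xs} u = p , q , All.tabulate (proj₂ ∘ ∈p) , All.tabulate (proj₂ ∘ ∈q) , up , uq , uu ,
  ≤-antisym (length-⊆ uu back) (length-⊆ u into) , into , back
  where
  p = filter P? xs
  q = filter (¬? ∘ P?) xs
  ∈p : ∀ {x} → x ∈ p → x ∈ xs × P x
  ∈p = ∈-filter⁻ P?
  ∈q : ∀ {x} → x ∈ q → x ∈ xs × ¬ P x
  ∈q = ∈-filter⁻ (¬? ∘ P?)
  up = Uniqueₚ.filter⁺ P? u
  uq = Uniqueₚ.filter⁺ (¬? ∘ P?) u
  uu : Unique (p ++ q)
  uu = Uniqueₚ.++⁺ up uq λ { (i , j) → proj₂ (∈q j) (proj₂ (∈p i)) }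
  into : ∀ {x} → x ∈ xs → x ∈ p ++ q
  into {x} i with P? x
  ... | yes px = ∈-++⁺ˡ (∈-filter⁺ P? i px)
  ... | no npx = ∈-++⁺ʳ p (∈-filter⁺ (¬? ∘ P?) i npx)
  back : ∀ {x} → x ∈ p ++ q → x ∈ xs
  back i with ∈-++⁻ p i
  ... | inj₁ j = proj₁ (∈p j)
  ... | inj₂ j = proj₁ (∈q j)

abstract

  -- List the colours of `la` with those in SA first, and those of `lb` with those outside SB first.
  -- At most |SA| ≤ 4 - |SB| come first in `la`, and at least 4 - |SB| in `lb`, so matching by
  -- position separates them.
  separating-renaming : ∀ la lb SA SB → length la ≡ 4 → Unique la → length lb ≡ 4 → Unique lb → length SA + length SB ≤ 4 →
    Σ[ π ∈ Renaming ] (∀ {x} → x ∈ la → Renaming.from π x ∈ lb × (x ∈ SA → Renaming.from π x ∉ SB))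
  separating-renaming la lb SA SB ea ua eb ub le
    with arrange (_∈ℕ? SA) ua | arrange (λ y → ¬? (y ∈ℕ? SB)) ub
  ... | p , q , pA , qA , up , _ , upq , lpq , into , _ | r , s , rB , sB , _ , us , urs , lrs , _ , back
    with matching (p ++ q) (r ++ s) upq urs (trans lpq (trans ea (sym (trans lrs eb))))
  ... | π , pw = π , λ i → let j , h = look p r short rB pw (into i) in back j , h
    where
    open Renaming π
    short : length p ≤ length r
    short = +-cancelʳ-≤ (length s) (length p) (length r) (≤-trans
      (+-mono-≤ (length-⊆ up (All.lookup pA)) (length-⊆ us λ {x} i → decidable-stable (x ∈ℕ? SB) (All.lookup sB i)))
      (≤-trans le (≤-reflexive (sym (trans (sym (length-++ r)) (trans lrs eb))))))
    member : ∀ {xs ys} → Pointwise (λ x y → from x ≡ y) xs ys → ∀ {x} → x ∈ xs → from x ∈ ys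
    member (e ∷ _) (here refl) = here e
    member (_ ∷ pw) (there i) = there (member pw i)
    look : ∀ p r → length p ≤ length r → All (_∉ SB) r → Pointwise (λ x y → from x ≡ y) (p ++ q) (r ++ s) →
      ∀ {x} → x ∈ p ++ q → from x ∈ r ++ s × (x ∈ SA → from x ∉ SB)
    look [] r _ _ pw i = member pw i , λ a → contradiction a (All.lookup qA i)
    look (_ ∷ p) (_ ∷ r) _ (ny ∷ _) (e ∷ _) (here refl) = here e , λ _ b → ny (subst (_∈ SB) e b)
    look (_ ∷ p) (_ ∷ r) (s≤s le) (_ ∷ nr) (_ ∷ pw) (there i) = let j , h = look p r le nr pw i in there j , h

-- Connected vertex sets

infixl 6 _∖_

abstract

  _∖_ : List (Fin n) → Fin n → List (Fin n)
  K ∖ u = filter (λ x → ¬? (x Finₚ.≟ u)) K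

  ∈-∖⁺ : ∀ {K : List (Fin n)} {u x} → x ∈ K → x ≢ u → x ∈ K ∖ u
  ∈-∖⁺ {u = u} = ∈-filter⁺ (λ x → ¬? (x Finₚ.≟ u))

  ∈-∖⁻ : ∀ {K : List (Fin n)} {u x} → x ∈ K ∖ u → x ∈ K × x ≢ u
  ∈-∖⁻ {u = u} = ∈-filter⁻ (λ x → ¬? (x Finₚ.≟ u))

  length-∖ : ∀ {K : List (Fin n)} {u} → u ∈ K → length (K ∖ u) < length K
  length-∖ {u = u} i = filter-notAll (λ x → ¬? (x Finₚ.≟ u)) _ (Any.map (λ { refl ne → ne refl }) i)

module _ (G : Graph n) where

  Connected : List (Fin n) → Set
  Connected K = ∀ {a b} → a ∈ K → b ∈ K → Path G (_∈ K) a b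

  crossing : ∀ {P : Fin n → Set} S {a b} → Path G P a b → a ∈ S → b ∉ S → ∃[ p ] ∃[ q ] (p ∈ S × q ∉ S × P q × Adj G p q)
  crossing S (stop _) i j = contradiction i j
  crossing S (move {a} {b} p e r) i j with b ∈F? S
  ... | yes k = crossing S r k j
  ... | no k = a , b , i , k , path-start r , e

  neighbour : ∀ {K a b} → Path G (_∈ K) a b → a ≢ b → ∃[ t ] (t ∈ K × Adj G a t)
  neighbour (stop _) ne = contradiction refl ne
  neighbour (move _ e r) ne = _ , path-start r , e

  connected-∷ : ∀ {S p q} → Connected S → p ∈ S → Adj G p q → Connected (q ∷ S)
  connected-∷ cS pS e (here refl) (here refl) = stop (here refl)
  connected-∷ cS pS e (here refl) (there j) = move (here refl) (flipAdj G e) (path-map there (cS pS j))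
  connected-∷ cS pS e (there i) (here refl) = path-trans (path-map there (cS i pS)) (move (there pS) e (stop (here refl)))
  connected-∷ cS pS e (there i) (there j) = path-map there (cS i j)

  -- Grown from y one vertex at a time, a connected set reaches all of K but one vertex, which is therefore not a cut vertex.
  noncut : ∀ {K y x} → Connected K → y ∈ K → x ∈ K → x ≢ y → ∃[ u ] (u ∈ K × u ≢ y × Connected (K ∖ u))
  noncut {K} {y} cK yK xK x≢y =
    grow (length K) (y ∷ []) (m≤n+m (length K) 1) ([] ∷ []) (λ { (here refl) (here refl) → stop (here refl) }) (here refl)
      (λ { (here refl) → yK }) xK (λ { (here e) → x≢y e })
    where
    grow : ∀ fuel S → length K ≤ length S + fuel → Unique S → Connected S → y ∈ S → (∀ {s} → s ∈ S → s ∈ K) → ∀ {x} → x ∈ K → x ∉ S →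
      ∃[ u ] (u ∈ K × u ≢ y × Connected (K ∖ u))
    grow zero S le uS cS yS S⊆ {x} xK x∉ = contradiction
      (≤-trans (length-⊆ {xs = x ∷ S} (All.tabulate (λ i e → x∉ (subst (_∈ S) (sym e) i)) ∷ uS) λ { (here refl) → xK ; (there i) → S⊆ i })
        (≤-trans le (≤-reflexive (+-identityʳ (length S))))) 1+n≰n
    grow (suc fuel) S le uS cS yS S⊆ {x} xK x∉ with Any.any? (λ z → ¬? (z ∈F? S) ×-dec ¬? (z Finₚ.≟ x)) K
    ... | no none = x , xK , (λ { refl → x∉ yS }) , λ i j → path-map (λ s → ∈-∖⁺ (S⊆ s) λ { refl → x∉ s }) (cS (inS i) (inS j))
      where
      inS : ∀ {a} → a ∈ K ∖ x → a ∈ S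
      inS {a} i = let aK , a≢x = ∈-∖⁻ i in decidable-stable (a ∈F? S) λ a∉ → none (lose aK (a∉ , a≢x))
    ... | yes some with find some
    ... | z , zK , z∉ , z≢x with crossing S (cK yK xK) yS x∉
    ... | p , q , pS , q∉ , qK , e = next (q Finₚ.≟ x)
      where
      again : ∀ {t} → t ∈ K → t ∉ S → t ≢ q → ∃[ u ] (u ∈ K × u ≢ y × Connected (K ∖ u))
      again tK t∉ t≢q = grow fuel (q ∷ S) (≤-trans le (≤-reflexive (+-suc (length S) fuel)))
        (All.tabulate (λ i e → q∉ (subst (_∈ S) (sym e) i)) ∷ uS) (connected-∷ cS pS e) (there yS)
        (λ { (here refl) → qK ; (there i) → S⊆ i }) tK λ { (here r) → t≢q r ; (there i) → t∉ i }
      next : Dec (q ≡ x) → ∃[ u ] (u ∈ K × u ≢ y × Connected (K ∖ u))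
      next (yes refl) = again zK z∉ z≢x
      next (no q≢x) = again xK x∉ (q≢x ∘ sym)

-- Colouring minors

-- Polymorphic in the universe because families of predicates on colours are updated as well.
upd : ∀ {a} {A : Set a} → (Fin n → A) → Fin n → A → Fin n → A
upd c u x w with w Finₚ.≟ u
... | yes _ = x
... | no _ = c w

upd-at : ∀ {a} {A : Set a} (c : Fin n → A) → ∀ u x → upd c u x u ≡ x
upd-at c u x with u Finₚ.≟ u
... | yes _ = refl
... | no p = contradiction refl p

upd-off : ∀ {a} {A : Set a} (c : Fin n → A) → ∀ {u x w} → w ≢ u → upd c u x w ≡ c w
upd-off c {u} {x} {w} ne with w Finₚ.≟ u
... | yes e = contradiction e ne
... | no _ = refl

mix : {P : Fin n → Set} → (∀ u → Dec (P u)) → (Fin n → ℕ) → (Fin n → ℕ) → Fin n → ℕ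
mix P? c c′ u with P? u
... | yes _ = c u
... | no _ = c′ u

mix-yes : ∀ {P : Fin n → Set} (P? : ∀ u → Dec (P u)) {c c′ u} → P u → mix P? c c′ u ≡ c u
mix-yes P? {u = u} p with P? u
... | yes _ = refl
... | no np = contradiction p np

mix-no : ∀ {P : Fin n → Set} (P? : ∀ u → Dec (P u)) {c c′ u} → ¬ P u → mix P? c c′ u ≡ c′ u
mix-no P? {u = u} np with P? u
... | yes p = contradiction p np
... | no _ = refl

choosable-lift : ∀ {n} (H : Graph (suc n)) (H′ : Graph n) z → (∀ w → ¬ Adj H z w) →
  (∀ a b → adj H′ a b ≡ adj H (punchIn z a) (punchIn z b)) → Choosable4 H′ → Choosable4 H
choosable-lift {n} H H′ z iso same choose L hL with choose (L ∘ punchIn z) (hL ∘ punchIn z) | L z in eL | hL z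
... | _ | [] | () , _
... | c , c∈ , c≢ | x ∷ _ | _ = c′ , c′∈ , c′≢
  where
  c′ : Fin (suc n) → ℕ
  c′ u with z Finₚ.≟ u
  ... | yes _ = x
  ... | no z≢u = c (punchOut z≢u)
  c′∈ : ∀ u → c′ u ∈ L u
  c′∈ u with z Finₚ.≟ u
  ... | yes refl = subst (x ∈_) (sym eL) (here refl)
  ... | no z≢u = subst (λ t → c (punchOut z≢u) ∈ L t) (Finₚ.punchIn-punchOut z≢u) (c∈ (punchOut z≢u))
  c′≢ : ∀ u w → Adj H u w → c′ u ≢ c′ w
  c′≢ u w a with z Finₚ.≟ u | z Finₚ.≟ w
  ... | yes refl | _ = contradiction a (iso w)
  ... | no _ | yes refl = contradiction (flipAdj H a) (iso u)
  ... | no p | no q = c≢ (punchOut p) (punchOut q)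
    (trans (same _ _) (subst₂ (Adj H) (sym (Finₚ.punchIn-punchOut p)) (sym (Finₚ.punchIn-punchOut q)) a))

-- An isolated vertex stands for a missing one: minimality applies after its removal.
small-choosable : {G : Graph n} → MinimalNon4ChoosablePlanar G →
  (H : Graph n) → Planar H → ∀ z → (∀ w → ¬ Adj H z w) → Choosable4 H
small-choosable {suc n} (_ , _ , min) H pH z iso =
  let H′ , pH′ , same = del-vertex pH z iso in choosable-lift H H′ z iso same (min n H′ (n<1+n n) pH′)

Low : Graph n → Fin n → Set
Low G u = degree G u ≤ 4

low-nbrs : {G : Graph n} → ∀ {u} → Low G u → ∀ {ws} → Unique ws → All (Adj G u) ws → length ws ≤ 4
low-nbrs {G = G} {u} low uws adj = ≤-trans (length-⊆ uws λ i → ∈-nbrs⁺ G (All.lookup adj i)) (subst (_≤ 4) (sym (length-nbrs G u)) low)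

record BadLists (n : ℕ) : Set where
  field
    G   : Graph n
    min : MinimalNon4ChoosablePlanar G
    L   : Fin n → List ℕ
    hL  : ∀ v → length (L v) ≡ 4 × Unique (L v)
    unc : ¬ (Σ[ c ∈ (Fin n → ℕ) ] ((∀ v → c v ∈ L v) × (∀ u w → Adj G u w → c u ≢ c w)))

-- Every statement is refuted by colouring smaller minors, so the argument may be classical throughout.
module Uncolourable {n : ℕ} (U : BadLists n) where

  open BadLists U public

  V : Set
  V = Fin n

  planarG : Planar G
  planarG = proj₁ min

  small : (H : Graph n) → Planar H → ∀ z → (∀ w → ¬ Adj H z w) → Choosable4 H
  small = small-choosable min

  -- Colourings are total and only judged on S, so colourings of disjoint sets can be mixed and
  -- extended.
  Good : (V → Set) → (V → ℕ) → Set
  Good S c = (∀ u → S u → c u ∈ L u) × (∀ u w → S u → S w → Adj G u w → c u ≢ c w)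

  good-cong : ∀ {S c c′} → (∀ u → S u → c′ u ≡ c u) → Good S c → Good S c′
  good-cong {S} {c} {c′} e (i , p) =
    (λ u s → subst (_∈ L u) (sym (e u s)) (i u s)) ,
    λ u w s t a q → p u w s t a (trans (sym (e u s)) (trans q (e w t)))

  good-⊆ : ∀ {S T c} → (∀ u → T u → S u) → Good S c → Good T c
  good-⊆ f (i , p) = (λ u → i u ∘ f u) , λ u w s t → p u w (f u s) (f w t)

  not-all-good : ∀ {c} → ¬ Good (λ _ → V) c
  not-all-good {c} (i , p) = unc (c , (λ v → i v v) , λ u w → p u w u w)

  module _ {S : V → Set} (S? : ∀ u → Dec (S u)) where

    mix-good : ∀ {T c c′} → (∀ u → T u → ¬ S u) → Good S c → Good T c′ →
      Good S (mix S? c c′) × Good T (mix S? c c′)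
    mix-good disj g h = good-cong (λ u s → mix-yes S? s) g , good-cong (λ u t → mix-no S? (disj u t)) h

  abstract

    colour : {S : V → Set} → (∀ u → Dec (S u)) → ∀ z → ¬ S z → ∃[ c ] Good S c
    colour {S} S? z nz =
      let c , i , p = small (mkGraph P? sy ir) (sub planarG (proj₁ ∘ P⁻)) z (λ w a → nz (proj₁ (proj₂ (P⁻ a)))) L hL
      in c , (λ u _ → i u) , λ u w s t a → p u w (mkGraph⁺ P? sy ir (a , s , t))
      where
      P : V → V → Set
      P x y = Adj G x y × S x × S y
      P? : ∀ x y → Dec (P x y)
      P? x y = adj? G x y ×-dec (S? x ×-dec S? y)
      sy : ∀ {x y} → P x y → P y x
      sy (a , p , q) = flipAdj G a , q , p
      ir : ∀ {x} → ¬ P x x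
      ir (a , _) = adj-≢ G a refl
      P⁻ : ∀ {x y} → Adj (mkGraph P? sy ir) x y → P x y
      P⁻ = mkGraph⁻ P? sy ir

  Free : (V → Set) → (V → ℕ) → V → ℕ → Set
  Free S c u x = x ∈ L u × (∀ w → S w → Adj G u w → c w ≢ x)

  abstract

    -- All but |ps| neighbours at most are coloured, and each rules out at most one of the four
    -- colours.
    free : ∀ {S} → (∀ u → Dec (S u)) → ∀ c u (ps : List V) → Unique ps → (∀ {p} → p ∈ ps → Adj G u p × ¬ S p) →
      ∃[ xs ] (Unique xs × (∀ {x} → x ∈ xs → Free S c u x) × (∀ {x} → Free S c u x → x ∈ xs) × 4 + length ps ≤ length xs + degree G u)
    free {S} S? c u ps ups hps = xs , Uniqueₚ.filter⁺ ok? (proj₂ (hL u)) , isFree , isIn , bound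
      where
      os : List V
      os = filter S? (nbrs G u)
      ok? : ∀ x → Dec (x ∉ map c os)
      ok? x = ¬? (x ∈ℕ? map c os)
      xs : List ℕ
      xs = filter ok? (L u)
      isFree : ∀ {x} → x ∈ xs → Free S c u x
      isFree i = let x∈ , x∉ = ∈-filter⁻ ok? {xs = L u} i in
        x∈ , λ w s a e → x∉ (subst (_∈ map c os) e (∈-map⁺ c (∈-filter⁺ S? (∈-nbrs⁺ G a) s)))
      isIn : ∀ {x} → Free S c u x → x ∈ xs
      isIn (x∈ , fr) = ∈-filter⁺ ok? x∈ λ i →
        let w , w∈ , e = ∈-map⁻ c i ; w∈n , s = ∈-filter⁻ S? {xs = nbrs G u} w∈ in fr w s (∈-nbrs⁻ G w∈n) (sym e)
      four : 4 ≤ length xs + length os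
      four = subst₂ _≤_ (proj₁ (hL u)) (trans (length-++ xs) (cong (length xs +_) (length-map c os)))
        (length-⊆ {ys = xs ++ map c os} (proj₂ (hL u)) into)
        where
        into : ∀ {x} → x ∈ L u → x ∈ xs ++ map c os
        into {x} i with x ∈ℕ? map c os
        ... | yes j = ∈-++⁺ʳ xs j
        ... | no j = ∈-++⁺ˡ (∈-filter⁺ ok? i j)
      few : length os + length ps ≤ degree G u
      few = subst₂ _≤_ (length-++ os) (length-nbrs G u)
        (length-⊆ (Uniqueₚ.++⁺ (Uniqueₚ.filter⁺ S? (nbrs-unique G u)) ups
            λ { (i , j) → proj₂ (hps j) (proj₂ (∈-filter⁻ S? {xs = nbrs G u} i)) })
          λ i → case ∈-++⁻ os i of λ { (inj₁ j) → proj₁ (∈-filter⁻ S? j) ; (inj₂ j) → ∈-nbrs⁺ G (proj₁ (hps j)) })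
      bound : 4 + length ps ≤ length xs + degree G u
      bound = ≤-trans (+-monoˡ-≤ (length ps) four) (≤-trans (≤-reflexive (+-assoc (length xs) _ _)) (+-monoʳ-≤ (length xs) few))

    free-low : ∀ {S} → (∀ u → Dec (S u)) → ∀ c {u} → Low G u → (ps : List V) → Unique ps → (∀ {p} → p ∈ ps → Adj G u p × ¬ S p) →
      ∃[ xs ] (Unique xs × (∀ {x} → x ∈ xs → Free S c u x) × (∀ {x} → Free S c u x → x ∈ xs) × length ps ≤ length xs)
    free-low S? c {u} low ps ups hps =
      let xs , uxs , fr , rf , le = free S? c u ps ups hps
      in xs , uxs , fr , rf , +-cancelʳ-≤ 4 _ _ (≤-trans (≤-reflexive (+-comm (length ps) 4)) (≤-trans le (+-monoʳ-≤ (length xs) low)))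

  extend : ∀ {S c u x} → ¬ S u → Good S c → Free S c u x → Good (λ w → w ≡ u ⊎ S w) (upd c u x)
  extend {S} {c} {u} {x} nu (i , p) (x∈ , fr) = mem , prop
    where
    keep : ∀ {w} → S w → upd c u x w ≡ c w
    keep s = upd-off c λ { refl → nu s }
    mem : ∀ w → w ≡ u ⊎ S w → upd c u x w ∈ L w
    mem w (inj₁ refl) = subst (_∈ L u) (sym (upd-at c u x)) x∈
    mem w (inj₂ s) = subst (_∈ L w) (sym (keep s)) (i w s)
    prop : ∀ w w′ → w ≡ u ⊎ S w → w′ ≡ u ⊎ S w′ → Adj G w w′ → upd c u x w ≢ upd c u x w′
    prop w w′ (inj₁ refl) (inj₁ refl) a _ = adj-≢ G a refl
    prop w w′ (inj₁ refl) (inj₂ s) a e = fr w′ s a (trans (sym (keep s)) (trans (sym e) (upd-at c u x)))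
    prop w w′ (inj₂ s) (inj₁ refl) a e = fr w s (flipAdj G a) (trans (sym (keep s)) (trans e (upd-at c u x)))
    prop w w′ (inj₂ s) (inj₂ s′) a e = p w w′ s s′ a (trans (sym (keep s)) (trans e (keep s′)))

  free-upd : ∀ {S c y s u t} → ¬ S y → Free S c u t → t ≢ s → Free (λ w → w ≡ y ⊎ S w) (upd c y s) u t
  free-upd {S} {c} {y} {s} ny (t∈ , fr) t≢s = t∈ , λ
    { w (inj₁ refl) _ e → t≢s (trans (sym e) (upd-at c y s))
    ; w (inj₂ sw) a e → fr w sw a (trans (sym (upd-off c λ { refl → ny sw })) e) }

  fill : ∀ {S} (x : Fin 3 → V) → (∀ {i j} → i ≢ j → Adj G (x i) (x j)) → (∀ i → ¬ S (x i)) → (∀ u → S u ⊎ ∃[ l ] u ≡ x l) →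
    ∀ {γ} → Good S γ → ∀ {i j k} → i ≢ j → i ≢ k → j ≢ k → ∀ {s t r} →
    Free S γ (x i) s → Free S γ (x j) t → Free S γ (x k) r → s ≢ t → s ≢ r → t ≢ r → ⊥
  fill {S} x xx x∉S every g {i} {j} {k} ij ik jk fs ft fr st sr tr =
    not-all-good (good-⊆ (λ u _ → everywhere u)
      (extend (λ { (inj₁ e) → adj-≢ G (xx jk) (sym e) ; (inj₂ (inj₁ e)) → adj-≢ G (xx ik) (sym e) ; (inj₂ (inj₂ s)) → x∉S k s })
        (extend (λ { (inj₁ e) → adj-≢ G (xx ij) (sym e) ; (inj₂ s) → x∉S j s }) (extend (x∉S i) g fs) (free-upd (x∉S i) ft (st ∘ sym)))
        (free-upd (λ { (inj₁ e) → adj-≢ G (xx ij) (sym e) ; (inj₂ s) → x∉S j s }) (free-upd (x∉S i) fr (sr ∘ sym)) (tr ∘ sym))))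
    where
    everywhere : ∀ u → u ≡ x k ⊎ (u ≡ x j ⊎ (u ≡ x i ⊎ S u))
    everywhere u with every u
    ... | inj₁ s = inj₂ (inj₂ (inj₂ s))
    ... | inj₂ (l , e) with cover₃ i j k l ij ik jk
    ...   | inj₁ refl = inj₂ (inj₂ (inj₁ e))
    ...   | inj₂ (inj₁ refl) = inj₂ (inj₁ e)
    ...   | inj₂ (inj₂ refl) = inj₁ e

  good-union : ∀ {A T c} → (∀ u → Dec (A u)) → (∀ {u w} → A u → T w → Adj G u w → A w) →
    Good A c → Good (λ u → T u × ¬ A u) c → Good T c
  good-union A? closed (iA , pA) (iB , pB) =
    (λ u t → case A? u of λ { (yes p) → iA u p ; (no np) → iB u (t , np) }) ,
    λ u w t t′ e → case A? u of λ
      { (yes p) → pA u w p (closed p t′ e) e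
      ; (no np) → case A? w of λ { (yes q) → contradiction (closed q t (flipAdj G e)) np ; (no nq) → pB u w (t , np) (t′ , nq) e } }

  -- Vertices of a connected set of low vertices are coloured one by one, each time one that does not cut the rest;
  -- its uncoloured neighbour leaves it a free colour.
  greedy : ∀ fuel {K r} → length K ≤ fuel → Connected G K → (∀ {u} → u ∈ K → Low G u) → r ∈ K →
    ∀ {S} → (∀ u → Dec (S u)) → (∀ {u} → u ∈ K → ¬ S u) → ∀ {c} → Good S c →
    ∃[ c′ ] (Good (λ u → S u ⊎ (u ∈ K × u ≢ r)) c′ × (∀ u → S u → c′ u ≡ c u))
  greedy fuel {K} {r} le cK low rK {S} S? dis {c} g with Any.any? (λ x → ¬? (x Finₚ.≟ r)) K
  ... | no only = c , good-⊆ (λ { u (inj₁ s) → s ; u (inj₂ (uK , u≢r)) → contradiction (lose uK u≢r) only }) g , λ _ _ → refl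
  greedy zero le cK low rK S? dis g | yes _ with () ← ≤-trans (length-∖ rK) le
  greedy (suc fuel) {K} {r} le cK low rK {S} S? dis {c} g | yes some with find some
  ... | y , yK , y≢r with noncut G cK rK yK y≢r
  ... | u , uK , u≢r , cK′ with neighbour G (cK uK rK) u≢r
  ... | t , tK , ut with free-low S? c (low uK) (t ∷ []) ([] ∷ []) (λ { (here refl) → ut , dis tK })
  ... | [] , _ , _ , _ , ()
  ... | x ∷ _ , _ , fr , _ , _ =
    let c′ , g′ , same = greedy fuel (≤-pred (≤-trans (length-∖ uK) le)) cK′ (low ∘ proj₁ ∘ ∈-∖⁻) (∈-∖⁺ rK (u≢r ∘ sym))
                           (λ w → (w Finₚ.≟ u) ⊎-dec S? w) (λ i → let wK , w≢u = ∈-∖⁻ i in λ { (inj₁ e) → w≢u e ; (inj₂ s) → dis wK s })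
                           (extend (dis uK) g (fr (here refl)))
    in c′ , good-⊆ (λ { w (inj₁ s) → inj₁ (inj₂ s)
                      ; w (inj₂ (wK , w≢r)) → case w Finₚ.≟ u of λ { (yes e) → inj₁ (inj₁ e) ; (no w≢u) → inj₂ (∈-∖⁺ wK w≢u , w≢r) } }) g′ ,
       λ w s → trans (same w (inj₂ s)) (upd-off c λ { refl → dis uK s })

  -- Identifying a ∈ A with b ∈ B after renaming the colours used on B: if the colours available at a and at b
  -- number at most four together, the renaming can make them disjoint.
  module Glue {G⁺ : Graph n} (pG⁺ : Planar G⁺) {A B Ex : V → Set}
    (A? : ∀ u → Dec (A u)) (B? : ∀ u → Dec (B u)) (Ex? : ∀ u → Dec (Ex u)) (disj : ∀ {u} → A u → ¬ B u)
    {a b : V} (aA : A a) (bB : B b) (ab : Adj G⁺ a b)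
    (keepA : ∀ {u w} → A u → A w → Adj G u w → Adj G⁺ u w) (keepB : ∀ {u w} → B u → B w → Adj G u w → Adj G⁺ u w)
    (ex : ∀ {y} → Ex y → A y × y ≢ a × Adj G⁺ b y) where

    -- After the contraction a inherits the neighbours of b in B and the vertices of `Ex`. The
    -- latter come from edges of `G⁺` between b and A; they force the colour of a to differ from
    -- theirs.
    data Edge (x y : V) : Set where
      inA  : A x → A y → Adj G x y → Edge x y
      inB  : x ≢ b → y ≢ b → B x → B y → Adj G x y → Edge x y
      fromA : x ≡ a → B y → Adj G b y → Edge x y
      toA  : y ≡ a → B x → Adj G b x → Edge x y
      exA  : x ≡ a → Ex y → Edge x y
      toEx : y ≡ a → Ex x → Edge x y

    edge? : ∀ x y → Dec (Edge x y)
    edge? x y = map′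
      (λ { (inj₁ (p , q , e)) → inA p q e
         ; (inj₂ (inj₁ (p , q , r , s , e))) → inB p q r s e
         ; (inj₂ (inj₂ (inj₁ (p , q , e)))) → fromA p q e
         ; (inj₂ (inj₂ (inj₂ (inj₁ (p , q , e))))) → toA p q e
         ; (inj₂ (inj₂ (inj₂ (inj₂ (inj₁ (p , q)))))) → exA p q
         ; (inj₂ (inj₂ (inj₂ (inj₂ (inj₂ (p , q)))))) → toEx p q })
      (λ { (inA p q e) → inj₁ (p , q , e)
         ; (inB p q r s e) → inj₂ (inj₁ (p , q , r , s , e))
         ; (fromA p q e) → inj₂ (inj₂ (inj₁ (p , q , e)))
         ; (toA p q e) → inj₂ (inj₂ (inj₂ (inj₁ (p , q , e))))
         ; (exA p q) → inj₂ (inj₂ (inj₂ (inj₂ (inj₁ (p , q)))))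
         ; (toEx p q) → inj₂ (inj₂ (inj₂ (inj₂ (inj₂ (p , q))))) })
      ((A? x ×-dec (A? y ×-dec adj? G x y)) ⊎-dec
       ((¬? (x Finₚ.≟ b) ×-dec (¬? (y Finₚ.≟ b) ×-dec (B? x ×-dec (B? y ×-dec adj? G x y)))) ⊎-dec
        (((x Finₚ.≟ a) ×-dec (B? y ×-dec adj? G b y)) ⊎-dec
         (((y Finₚ.≟ a) ×-dec (B? x ×-dec adj? G b x)) ⊎-dec
          (((x Finₚ.≟ a) ×-dec Ex? y) ⊎-dec ((y Finₚ.≟ a) ×-dec Ex? x))))))

    edge-sym : ∀ {x y} → Edge x y → Edge y x
    edge-sym (inA p q e) = inA q p (flipAdj G e)
    edge-sym (inB p q r s e) = inB q p s r (flipAdj G e)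
    edge-sym (fromA p q e) = toA p q e
    edge-sym (toA p q e) = fromA p q e
    edge-sym (exA p q) = toEx p q
    edge-sym (toEx p q) = exA p q

    edge-irr : ∀ {x} → ¬ Edge x x
    edge-irr (inA _ _ e) = adj-≢ G e refl
    edge-irr (inB _ _ _ _ e) = adj-≢ G e refl
    edge-irr (fromA refl q _) = disj aA q
    edge-irr (toA refl q _) = disj aA q
    edge-irr (exA refl q) = proj₁ (proj₂ (ex q)) refl
    edge-irr (toEx refl q) = proj₁ (proj₂ (ex q)) refl

    H : Graph n
    H = mkGraph edge? edge-sym edge-irr

    H⁻ : ∀ {x y} → Adj H x y → Edge x y
    H⁻ = mkGraph⁻ edge? edge-sym edge-irr

    H⁺ : ∀ {x y} → Edge x y → Adj H x y
    H⁺ = mkGraph⁺ edge? edge-sym edge-irr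

    A≢b : ∀ {x} → A x → x ≢ b
    A≢b p refl = disj p bB

    planarH : Planar H
    planarH = contract {G = G⁺} {H} pG⁺ {a} {b} ab (minor ∘ H⁻)
      where
      minor : ∀ {x y} → Edge x y → MinorEdge G⁺ a b x y
      minor (inA p q e) = A≢b p , A≢b q , inj₁ (keepA p q e)
      minor (inB p q r s e) = p , q , inj₁ (keepB r s e)
      minor (fromA refl q e) = A≢b aA , (λ { refl → adj-≢ G e refl }) , inj₂ (inj₁ (refl , keepB bB q e))
      minor (toA refl q e) = (λ { refl → adj-≢ G e refl }) , A≢b aA , inj₂ (inj₂ (refl , flipAdj G⁺ (keepB bB q e)))
      minor (exA refl q) = let p , _ , e = ex q in A≢b aA , A≢b p , inj₂ (inj₁ (refl , e))
      minor (toEx refl q) = let p , _ , e = ex q in A≢b p , A≢b aA , inj₂ (inj₂ (refl , flipAdj G⁺ e))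

    isolatedH : ∀ w → ¬ Adj H b w
    isolatedH w e with H⁻ e
    ... | inA p _ _ = A≢b p refl
    ... | inB p _ _ _ _ = p refl
    ... | fromA p _ _ = A≢b aA (sym p)
    ... | toA p q e = adj-≢ G e refl
    ... | exA p _ = A≢b aA (sym p)
    ... | toEx _ q = A≢b (proj₁ (ex q)) refl

    glue : ∀ SA SB → length SA + length SB ≤ 4 →
      ¬ (∀ γ → Good A γ → Good B γ → (∀ y → Ex y → γ a ≢ γ y) → γ a ∈ SA × γ b ∈ SB)
    glue SA SB le constrained with separating-renaming (L a) (L b) SA SB (proj₁ (hL a)) (proj₂ (hL a)) (proj₁ (hL b)) (proj₂ (hL b)) le
    ... | π , sep with small H planarH b isolatedH L′ hL′
      where
      open Renaming π
      L′ : V → List ℕ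
      L′ u with A? u
      ... | yes _ = L u
      ... | no _ = map to (L u)
      to-inj : ∀ {x y} → to x ≡ to y → x ≡ y
      to-inj {x} {y} e = trans (sym (from-to x)) (trans (cong from e) (from-to y))
      hL′ : ∀ u → length (L′ u) ≡ 4 × Unique (L′ u)
      hL′ u with A? u
      ... | yes _ = hL u
      ... | no _ = trans (length-map to (L u)) (proj₁ (hL u)) , Uniqueₚ.map⁺ to-inj (proj₂ (hL u))
    ... | h , h∈ , h≢ = proj₂ (sep (inL aA)) (subst (_∈ SA) (γA aA) (proj₁ chosen)) (subst (_∈ SB) γb (proj₂ chosen))
      where
      open Renaming π
      γ : V → ℕ
      γ u with A? u | u Finₚ.≟ b
      ... | yes _ | _ = h u
      -- Isolated in the minor, b receives the decoded colour of a, which the choice of π puts into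
      -- `L b`.
      ... | no _ | yes _ = from (h a)
      ... | no _ | no _ = from (h u)
      γA : ∀ {u} → A u → γ u ≡ h u
      γA {u} p with A? u | u Finₚ.≟ b
      ... | yes _ | _ = refl
      ... | no np | _ = contradiction p np
      γb : γ b ≡ from (h a)
      γb with A? b | b Finₚ.≟ b
      ... | yes p | _ = contradiction bB (disj p)
      ... | no _ | yes _ = refl
      ... | no _ | no q = contradiction refl q
      γB : ∀ {u} → B u → u ≢ b → γ u ≡ from (h u)
      γB {u} p u≢b with A? u | u Finₚ.≟ b
      ... | yes q | _ = contradiction p (disj q)
      ... | no _ | yes q = contradiction q u≢b
      ... | no _ | no _ = refl
      inL : ∀ {u} → A u → h u ∈ L u
      inL {u} p with A? u | h∈ u
      ... | yes _ | i = i
      ... | no np | _ = contradiction p np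
      inB′ : ∀ {u} → B u → from (h u) ∈ L u
      inB′ {u} p with A? u | h∈ u
      ... | yes q | _ = contradiction p (disj q)
      ... | no _ | i = let x , x∈ , e = ∈-map⁻ to i in subst (_∈ L u) (sym (trans (cong from e) (from-to x))) x∈
      from-inj : ∀ {x y} → from x ≡ from y → x ≡ y
      from-inj {x} {y} e = trans (sym (to-from x)) (trans (cong to e) (to-from y))
      goodA : Good A γ
      goodA = (λ u p → subst (_∈ L u) (sym (γA p)) (inL p)) ,
        λ u w p q e r → h≢ u w (H⁺ (inA p q e)) (trans (sym (γA p)) (trans r (γA q)))
      goodB : Good B γ
      goodB = mem , prop
        where
        mem : ∀ u → B u → γ u ∈ L u
        mem u p = case u Finₚ.≟ b of λ
          { (yes refl) → subst (_∈ L b) (sym γb) (proj₁ (sep (inL aA)))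
          ; (no u≢b) → subst (_∈ L u) (sym (γB p u≢b)) (inB′ p) }
        prop : ∀ u w → B u → B w → Adj G u w → γ u ≢ γ w
        prop u w p q e r = case u Finₚ.≟ b of λ
          { (yes refl) → case w Finₚ.≟ b of λ
              { (yes refl) → adj-≢ G e refl
              ; (no w≢b) → h≢ a w (H⁺ (fromA refl q e)) (from-inj (trans (sym γb) (trans r (γB q w≢b)))) }
          ; (no u≢b) → case w Finₚ.≟ b of λ
              { (yes refl) → h≢ u a (H⁺ (toA refl p (flipAdj G e))) (from-inj (trans (sym (γB p u≢b)) (trans r γb)))
              ; (no w≢b) → h≢ u w (H⁺ (inB u≢b w≢b p q e)) (from-inj (trans (sym (γB p u≢b)) (trans r (γB q w≢b)))) } }
      chosen : γ a ∈ SA × γ b ∈ SB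
      chosen = constrained γ goodA goodB λ y q r → h≢ a y (H⁺ (exA refl q)) (trans (sym (γA aA)) (trans r (γA (proj₁ (ex q)))))

  none? : ∀ (u : V) → Dec ⊥
  none? _ = no id

  -- Only the edge v w joins the component of w in G - v to the rest, so in any pair of colourings
  -- of the two sides v and w agree. Each then attains a single colour, too few for `Glue`.
  no-bridge : ∀ {v w} → Adj G v w → ¬ (∀ {t} → Adj G v t → t ≢ w → ¬ Path G (_≢ v) w t)
  no-bridge {v} {w} vw alone = dec-all {P = A} λ A? →
    let B? = λ u → ¬? (A? u)
        c , gc = colour A? v nv
        c′ , gc′ = colour B? w (λ q → q wA)
        γ₀A , γ₀B = mix-good A? (λ _ p → p) gc gc′
    in Glue.glue {G⁺ = G} planarG {Ex = λ _ → ⊥} A? B? none? (λ p q → q p) {w} {v} wA nv (flipAdj G vw) (λ _ _ → id) (λ _ _ → id) (λ ())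
         (mix A? c c′ v ∷ []) (mix A? c c′ w ∷ []) (s≤s (s≤s z≤n))
         λ γ gA gB _ → here (same A? gA γ₀B) , here (sym (same A? γ₀A gB))
    where
    A : V → Set
    A = Path G (_≢ v) w
    wA : A w
    wA = stop (adj-≢ G vw ∘ sym)
    nv : ¬ A v
    nv r = path-end r refl
    same : (∀ u → Dec (A u)) → ∀ {c c′} → Good A c → Good (¬_ ∘ A) c′ → c w ≡ c′ v
    same A? {c} {c′} gA gB = decidable-stable (c w ≟ c′ v) λ ne → not-all-good (
      let (iA , pA) , (iB , pB) = mix-good A? (λ _ p → p) gA gB in
      (λ u _ → case A? u of λ { (yes p) → iA u p ; (no p) → iB u p }) ,
      λ u t _ _ e → case A? u of λ
        { (yes p) → case A? t of λ
            { (yes q) → pA u t p q e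
            ; (no q) → λ r → ne (trans (sym (mix-yes A? wA)) (trans (cross p q e r) (mix-no A? nv))) }
        ; (no p) → case A? t of λ
            { (yes q) → λ r → ne (trans (sym (mix-yes A? wA)) (trans (cross q p (flipAdj G e) (sym r)) (mix-no A? nv)))
            ; (no q) → pB u t p q e } })
      where
      cross : ∀ {u t} → A u → ¬ A t → Adj G u t → mix A? c c′ u ≡ mix A? c c′ t → mix A? c c′ w ≡ mix A? c c′ v
      cross {u} {t} p q e r with t Finₚ.≟ v
      ... | no t≢v = contradiction (path-trans p (move (path-end p) e (stop t≢v))) q
      ... | yes refl with u Finₚ.≟ w
      ...   | yes refl = r
      ...   | no u≢w = contradiction p (alone (flipAdj G e) u≢w)

-- Four mutually adjacent vertices

module _ {xs ys zs : List ℕ} (ux : Unique xs) (uy : Unique ys) (uz : Unique zs) (ly : 2 ≤ length ys) (lz : 2 ≤ length zs) where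

  -- A system of distinct representatives, that is, a colouring of the triangle that is left.
  Rainbow : Set
  Rainbow = ∃[ s ] ∃[ t ] ∃[ r ] (s ∈ xs × t ∈ ys × r ∈ zs × s ≢ t × s ≢ r × t ≢ r)

  rainbow-private : ∀ {s} → s ∈ xs → s ∉ ys → Rainbow
  rainbow-private {s} s∈ s∉ =
    let r , r∈ , r∉ = avoid uz (s ∷ []) lz
        t , t∈ , t∉ = avoid uy (r ∷ []) ly
    in s , t , r , s∈ , t∈ , r∈ , (λ e → s∉ (subst (_∈ ys) (sym e) t∈)) , (λ e → r∉ (here (sym e))) , λ e → t∉ (here e)

  rainbow-large : 3 ≤ length xs → Rainbow
  rainbow-large lx =
    let t , t∈ , _ = avoid uy [] (≤-trans (s≤s z≤n) ly)
        r , r∈ , r∉ = avoid uz (t ∷ []) lz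
        s , s∈ , s∉ = avoid ux (t ∷ r ∷ []) lx
    in s , t , r , s∈ , t∈ , r∈ , (λ e → s∉ (here e)) , (λ e → s∉ (there (here e))) , λ e → r∉ (here (sym e))

split-list : {P : ℕ → Set} (xs : List ℕ) → ¬ ¬ (Σ[ p ∈ List ℕ ] Σ[ q ∈ List ℕ ]
  (length p + length q ≡ length xs × (∀ {x} → x ∈ xs → P x → x ∈ p) × (∀ {x} → x ∈ xs → ¬ P x → x ∈ q)))
split-list [] k = k ([] , [] , refl , (λ ()) , (λ ()))
split-list {P} (x ∷ xs) k = split-list {P} xs λ { (p , q , e , hp , hq) → em {P x} λ
  { (yes px) → k (x ∷ p , q , cong suc e , (λ { (here refl) _ → here refl ; (there i) h → there (hp i h) }) ,
                  λ { (here refl) np → contradiction px np ; (there i) h → hq i h })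
  ; (no np) → k (p , x ∷ q , trans (+-suc (length p) (length q)) (cong suc e) , (λ { (here refl) px → contradiction px np ; (there i) h → hp i h }) ,
                  λ { (here refl) _ → here refl ; (there i) h → there (hq i h) }) } }

record Tetra {n : ℕ} (U : BadLists n) : Set where
  open BadLists U
  field
    v     : Fin n
    deg-v : degree G v ≤ 5
    x     : Fin 3 → Fin n
    vx    : ∀ i → Adj G v (x i)
    xx    : ∀ {i j} → i ≢ j → Adj G (x i) (x j)
    low   : ∀ i → Low G (x i)

module Tetrahedron {n : ℕ} (U : BadLists n) (T₀ : Tetra U) where

  open Uncolourable U
  open Tetra T₀

  S : V → Set
  S u = ∀ i → u ≢ x i

  S? : ∀ u → Dec (S u)
  S? u = Finₚ.all? λ i → ¬? (u Finₚ.≟ x i)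

  Sv : S v
  Sv i = adj-≢ G (vx i)

  x∉S : ∀ i → ¬ S (x i)
  x∉S i s = s i refl

  everywhere : ∀ u → S u ⊎ ∃[ l ] u ≡ x l
  everywhere u with Finₚ.any? (λ l → u Finₚ.≟ x l)
  ... | no none = inj₁ λ l e → none (l , e)
  ... | yes e = inj₂ e

  -- The second component says that at most two colours are left over at x i.
  stuck : ∀ {γ} → Good S γ → ∀ {i j} → i ≢ j →
    (∀ {t} → Free S γ (x i) t → Free S γ (x j) t) × (∀ s → ¬ (∀ t → t ∈ L (x i) → t ≢ s → Free S γ (x i) t))
  stuck {γ} g {i} {j} ij with third₃ i j
  ... | k , ik , jk with options i j k ij ik jk | options j i k (ij ∘ sym) jk ik | options k i j (ik ∘ sym) (jk ∘ sym) ij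
    where
    options : ∀ i j k → i ≢ j → i ≢ k → j ≢ k →
      ∃[ xs ] (Unique xs × (∀ {t} → t ∈ xs → Free S γ (x i) t) × (∀ {t} → Free S γ (x i) t → t ∈ xs) × 2 ≤ length xs)
    options i j k ij ik jk = free-low S? γ (low i) (x j ∷ x k ∷ []) ((adj-≢ G (xx jk) ∷ []) ∷ [] ∷ [])
      λ { (here refl) → xx ij , x∉S j ; (there (here refl)) → xx ik , x∉S k }
  ... | xs , ux , fx , rx , lx | ys , uy , fy , ry , ly | zs , uz , fz , _ , lz = sub′ , big
    where
    none : ¬ Rainbow ux uy uz ly lz
    none (s , t , r , s∈ , t∈ , r∈ , st , sr , tr) = fill x xx x∉S everywhere g ij ik jk (fx s∈) (fy t∈) (fz r∈) st sr tr
    sub′ : ∀ {t} → Free S γ (x i) t → Free S γ (x j) t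
    sub′ {t} f = fy (decidable-stable (t ∈ℕ? ys) λ t∉ → none (rainbow-private ux uy uz ly lz (rx f) t∉))
    big : ∀ s → ¬ (∀ t → t ∈ L (x i) → t ≢ s → Free S γ (x i) t)
    big s h = none (rainbow-large ux uy uz ly lz (≤-pred (subst (_≤ suc (length xs)) (proj₁ (hL (x i)))
      (length-⊆ {ys = s ∷ xs} (proj₂ (hL (x i))) λ {t} t∈ → case t ≟ s of λ { (yes e) → here e ; (no ne) → there (rx (h t t∈ ne)) }))))

  γ₀ : ∃[ γ ] Good S γ
  γ₀ = colour S? (x zero) (x∉S zero)

  Outer : Fin 3 → V → Set
  Outer i a = S a × a ≢ v × Adj G (x i) a × (∀ {w} → S w → Adj G (x i) w → w ≡ v ⊎ w ≡ a)

  -- If v were the only coloured neighbour, x i would keep three colours, against `stuck`. A second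
  -- outer neighbour would give x i degree five.
  outer : ∀ i → ∃[ a ] Outer i a
  outer i with Finₚ.any? (λ a → S? a ×-dec (¬? (a Finₚ.≟ v) ×-dec adj? G (x i) a))
  ... | no none = ⊥-elim (proj₂ (stuck (proj₂ γ₀) {i} (proj₁ (proj₂ (third₃ i i)))) (proj₁ γ₀ v) λ t t∈ t≢ → t∈ , λ w s e q →
          t≢ (trans (sym q) (cong (proj₁ γ₀) (decidable-stable (w Finₚ.≟ v) λ w≢v → none (w , s , w≢v , e)))))
  ... | yes (a , s , a≢v , e) = a , s , a≢v , e , only
    where
    only : ∀ {w} → S w → Adj G (x i) w → w ≡ v ⊎ w ≡ a
    only {w} sw ew with w Finₚ.≟ v | w Finₚ.≟ a
    ... | yes p | _ = inj₁ p
    ... | no _ | yes p = inj₂ p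
    ... | no w≢v | no w≢a with third₃ i i
    ...   | j , ij , _ with third₃ i j
    ...     | k , ik , jk = contradiction
                (low-nbrs {G = G} (low i) {w ∷ a ∷ v ∷ x j ∷ x k ∷ []}
                  ((w≢a ∷ w≢v ∷ sw j ∷ sw k ∷ []) ∷ (a≢v ∷ s j ∷ s k ∷ []) ∷ (Sv j ∷ Sv k ∷ []) ∷ (adj-≢ G (xx jk) ∷ []) ∷ [] ∷ [])
                  (ew ∷ e ∷ flipAdj G (vx i) ∷ xx ij ∷ xx ik ∷ []))
                1+n≰n

  a : Fin 3 → V
  a i = proj₁ (outer i)

  Sa : ∀ i → S (a i)
  Sa i = proj₁ (proj₂ (outer i))

  a≢v : ∀ i → a i ≢ v
  a≢v i = proj₁ (proj₂ (proj₂ (outer i)))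

  xa : ∀ i → Adj G (x i) (a i)
  xa i = proj₁ (proj₂ (proj₂ (proj₂ (outer i))))

  a-only : ∀ i {w} → S w → Adj G (x i) w → w ≡ v ⊎ w ≡ a i
  a-only i = proj₂ (proj₂ (proj₂ (proj₂ (outer i))))

  module _ {γ : V → ℕ} (g : Good S γ) where

    unblocked : ∀ i {t} → t ∈ L (x i) → t ≢ γ v → t ≢ γ (a i) → Free S γ (x i) t
    unblocked i t∈ p q = t∈ , λ w s e r → case a-only i s e of λ { (inj₁ refl) → p (sym r) ; (inj₂ refl) → q (sym r) }

    exact : ∀ i s → ¬ (∀ t → t ∈ L (x i) → t ≢ s → Free S γ (x i) t)
    exact i = proj₂ (stuck g {i} (proj₁ (proj₂ (third₃ i i))))

    v∈L : ∀ i → γ v ∈ L (x i)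
    v∈L i = decidable-stable (γ v ∈ℕ? L (x i)) λ v∉ → exact i (γ (a i)) λ t t∈ t≢ → unblocked i t∈ (λ { refl → v∉ t∈ }) t≢

    a∈L : ∀ i → γ (a i) ∈ L (x i)
    a∈L i = decidable-stable (γ (a i) ∈ℕ? L (x i)) λ a∉ → exact i (γ v) λ t t∈ t≢ → unblocked i t∈ t≢ (λ { refl → a∉ t∈ })

    v≢a : ∀ i → γ v ≢ γ (a i)
    v≢a i e = exact i (γ v) λ t t∈ t≢ → unblocked i t∈ t≢ (λ q → t≢ (trans q (sym e)))

    -- By `stuck` the colours left over coincide at all three vertices, and γ v lies in every list.
    -- So the list of x i without the colour of a i is the same for every i.
    same-rest : ∀ {i j} → i ≢ j → ∀ {t} → t ∈ L (x i) → t ≢ γ (a i) → t ∈ L (x j) × t ≢ γ (a j)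
    same-rest {i} {j} ij {t} t∈ t≢ = case t ≟ γ v of λ
      { (yes refl) → v∈L j , v≢a j
      ; (no p) → let t∈′ , fr = proj₁ (stuck g ij) (unblocked i t∈ p t≢) in t∈′ , λ q → fr (a j) (Sa j) (xa j) (sym q) }

  T : V → Set
  T u = S u × u ≢ v

  T? : ∀ u → Dec (T u)
  T? u = S? u ×-dec ¬? (u Finₚ.≟ v)

  Ta : ∀ i → T (a i)
  Ta i = Sa i , a≢v i

  -- At most two neighbours of v are in T, so v can be coloured afterwards. This carries the facts
  -- above over to colourings that ignore v.
  extend-v : ∀ {γ} → Good T γ → ∃[ γ′ ] (Good S γ′ × (∀ {u} → u ≢ v → γ′ u ≡ γ u))
  extend-v {γ} g with free T? γ v (x (# 0) ∷ x (# 1) ∷ x (# 2) ∷ [])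
    ((adj-≢ G (xx λ ()) ∷ adj-≢ G (xx λ ()) ∷ []) ∷ (adj-≢ G (xx λ ()) ∷ []) ∷ [] ∷ [])
    (λ { (here refl) → vx _ , (λ t → x∉S _ (proj₁ t)) ; (there (here refl)) → vx _ , (λ t → x∉S _ (proj₁ t))
       ; (there (there (here refl))) → vx _ , (λ t → x∉S _ (proj₁ t)) })
  ... | [] , _ , _ , _ , le = contradiction (≤-trans le deg-v) (<⇒≱ (s≤s (s≤s (s≤s (s≤s (s≤s (s≤s z≤n)))))))
  ... | t ∷ _ , _ , fr , _ , _ = upd γ v t ,
    good-⊆ (λ u s → case u Finₚ.≟ v of λ { (yes e) → inj₁ e ; (no ne) → inj₂ (s , ne) }) (extend (λ tv → proj₂ tv refl) g (fr (here refl))) ,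
    λ ne → upd-off γ ne

  rest : ∀ {γ} → Good T γ → ∀ {i j} → i ≢ j → ∀ {t} → t ∈ L (x i) → t ≢ γ (a i) → t ∈ L (x j) × t ≢ γ (a j)
  rest g {i} {j} ij t∈ t≢ = let γ′ , g′ , e = extend-v g ; p , q = same-rest g′ ij t∈ (λ r → t≢ (trans r (e (a≢v i)))) in p , λ r → q (trans r (sym (e (a≢v j))))

  used : ∀ {γ} → Good T γ → ∀ i → γ (a i) ∈ L (x i)
  used g i = let γ′ , g′ , e = extend-v g in subst (_∈ L (x i)) (e (a≢v i)) (a∈L g′ i)

  -- Otherwise the component of a i and the rest of T are coloured independently, while by `rest` a
  -- change at one end would have to show at the other. Each end attains one colour, and the two are
  -- identified along a i, x i, x j, a j.
  linked : ∀ {i j} → i ≢ j → ¬ ¬ Path G T (a i) (a j)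
  linked {i} {j} ij apart = dec-all {P = A} λ A? →
    let B? = λ u → T? u ×-dec ¬? (A? u)
        c , gc = colour A? v nv
        c′ , gc′ = colour B? v (λ { ((_ , ne) , _) → ne refl })
        γA , γB = mix-good A? (λ _ → proj₂) gc gc′
    in Glue.glue {G⁺ = proj₁ G₂} (proj₁ (proj₂ G₂)) {Ex = λ _ → ⊥} A? B? none? (λ p q → proj₂ q p) {a i} {a j} aA (Ta j , apart)
         (proj₁ (proj₂ (proj₂ G₂)))
         (λ p q → keep (path-end p) (path-end q)) (λ p q → keep (proj₁ p) (proj₁ q)) (λ ())
         (mix A? c c′ (a i) ∷ []) (mix A? c c′ (a j) ∷ []) (s≤s (s≤s z≤n))
         λ γ gA gB _ → here (fixed A? gA γA γB) , here (fixed′ A? γA γB gB)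
    where
    A : V → Set
    A = Path G T (a i)
    aA : A (a i)
    aA = stop (Ta i)
    nv : ¬ A v
    nv r = proj₂ (path-end r) refl
    closed : ∀ {u w} → A u → T w → Adj G u w → A w
    closed p t e = path-trans p (move (path-end p) e (stop t))
    ai≢aj : a i ≢ a j
    ai≢aj e = apart (subst (Path G T (a i)) e (stop (Ta i)))
    G₁ = smooth {G = G} planarG (flipAdj G (xa i)) (xx ij) (Sa i j)
    G₂ = smooth {G = proj₁ G₁} (proj₁ (proj₂ G₁)) (proj₁ (proj₂ (proj₂ G₁)))
           (proj₂ (proj₂ (proj₂ G₁)) (adj-≢ G (xx ij) ∘ sym) (Sa j i) (xa j)) ai≢aj
    keep : ∀ {u w} → T u → T w → Adj G u w → Adj (proj₁ G₂) u w
    keep (s , _) (s′ , _) e = proj₂ (proj₂ (proj₂ G₂)) (s j) (s′ j) (proj₂ (proj₂ (proj₂ G₁)) (s i) (s′ i) e)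
    B : V → Set
    B u = T u × ¬ A u
    module _ (A? : ∀ u → Dec (A u)) where
      both : ∀ {c c′} → Good A c → Good B c′ → Good T (mix A? c c′)
      both gA gB = let p , q = mix-good A? (λ _ → proj₂) gA gB in good-union A? closed p q
      here-A : ∀ {c c′} → mix A? c c′ (a i) ≡ c (a i)
      here-A = mix-yes A? aA
      here-B : ∀ {c c′} → mix A? c c′ (a j) ≡ c′ (a j)
      here-B = mix-no A? apart
      -- If a i could take another colour than in γ, the colour it has in γ would be left over at x i but not at x j.
      fixed : ∀ {γ c} → Good A γ → Good A c → Good B c → γ (a i) ≡ c (a i)
      fixed {γ} {c} gγ gA gB = decidable-stable (γ (a i) ≟ c (a i)) λ ne →
        let t∈ = subst (_∈ L (x i)) here-A (used (both gA gB) i)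
            t∈′ , t≢ = rest (both gγ gB) ij t∈ λ e → ne (sym (trans e here-A))
            _ , t≢′ = rest (both gA gB) (ij ∘ sym) t∈′ λ e → t≢ (trans e (trans here-B (sym here-B)))
        in t≢′ (sym here-A)
      fixed′ : ∀ {γ c} → Good A c → Good B c → Good B γ → γ (a j) ≡ c (a j)
      fixed′ {γ} {c} gA gB gγ = decidable-stable (γ (a j) ≟ c (a j)) λ ne →
        let t∈ = subst (_∈ L (x j)) here-B (used (both gA gB) j)
            t∈′ , t≢ = rest (both gA gγ) (ij ∘ sym) t∈ λ e → ne (sym (trans e here-B))
            _ , t≢′ = rest (both gA gB) ij t∈′ λ e → t≢ (trans e (trans here-A (sym here-A)))
        in t≢′ (sym here-B)

  Q : V → Set
  Q u = ¬ T u

  to-∉Q : ∀ {b c} → Path G T b c → Path G (¬_ ∘ Q) b c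
  to-∉Q = path-map λ t q → q t

  -- Otherwise contracting paths into the first a i makes it adjacent to v and to all x i, a K₅.
  separated : Path G T (a (# 0)) (a (# 1)) → Path G T (a (# 0)) (a (# 2)) → ∀ {w} → Adj G v w → ¬ Path G T (a (# 0)) w
  separated p₁ p₂ {w} vw p = K5Minor.no-K5-minor Q (λ q → q (Ta (# 0))) G planarG ι ι-inj ι-Q ι-adj att
    where
    ι : Fin 4 → V
    ι zero = v
    ι (suc i) = x i
    ι-inj : ∀ {i j} → ι i ≡ ι j → i ≡ j
    ι-inj {zero} {zero} _ = refl
    ι-inj {zero} {suc j} e = contradiction e (Sv j)
    ι-inj {suc i} {zero} e = contradiction (sym e) (Sv i)
    ι-inj {suc i} {suc j} e = cong suc (decidable-stable (i Finₚ.≟ j) λ ne → adj-≢ G (xx ne) e)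
    ι-Q : ∀ i → Q (ι i)
    ι-Q zero t = proj₂ t refl
    ι-Q (suc i) t = x∉S i (proj₁ t)
    ι-adj : ∀ {i j} → i ≢ j → Adj G (ι i) (ι j)
    ι-adj {zero} {zero} ne = contradiction refl ne
    ι-adj {zero} {suc j} _ = vx j
    ι-adj {suc i} {zero} _ = flipAdj G (vx i)
    ι-adj {suc i} {suc j} ne = xx (ne ∘ cong suc)
    att : ∀ i → K5Minor.Attached Q (λ q → q (Ta (# 0))) G (ι i)
    att zero = w , to-∉Q p , flipAdj G vw
    att (suc zero) = a (# 0) , to-∉Q (stop (Ta (# 0))) , flipAdj G (xa (# 0))
    att (suc (suc zero)) = a (# 1) , to-∉Q p₁ , flipAdj G (xa (# 1))
    att (suc (suc (suc zero))) = a (# 2) , to-∉Q p₂ , flipAdj G (xa (# 2))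

  -- Colours of a₀ on A and of v on B all lie in the list of the first x i. None occurs on both
  -- sides, since mixing the colourings would contradict `v≢a`. So there are at most four, too few
  -- for `Glue` along the path from a₀ through that vertex to v.
  impossible : ⊥
  impossible = linked {# 0} {# 1} (λ ()) λ p₁ → linked {# 0} {# 2} (λ ()) λ p₂ → dec-all {P = A} λ A? → glued p₁ p₂ A?
    where
    a₀ = a (# 0)
    A : V → Set
    A = Path G T a₀
    aA : A a₀
    aA = stop (Ta (# 0))
    nv : ¬ A v
    nv r = proj₂ (path-end r) refl
    B : V → Set
    B u = S u × ¬ A u
    glued : Path G T a₀ (a (# 1)) → Path G T a₀ (a (# 2)) → (∀ u → Dec (A u)) → ⊥
    glued p₁ p₂ A? = split-list {Attained} (L (x (# 0))) λ { (SA , SB , le , inA , inB) →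
        Glue.glue {G⁺ = proj₁ G₁} (proj₁ (proj₂ G₁)) {Ex = λ _ → ⊥} A? B? none? (λ p q → proj₂ q p) {a₀} {v} aA (Sv , nv)
          (proj₁ (proj₂ (proj₂ G₁)))
          (λ p q → keep (proj₁ (path-end p)) (proj₁ (path-end q))) (λ p q → keep (proj₁ p) (proj₁ q)) (λ ())
          SA SB (≤-reflexive (trans le (proj₁ (hL (x (# 0))))))
          λ γ gA gB _ → inA (a∈L (both gA gB) (# 0)) (γ , gA , refl) ,
            inB (v∈L (both gA gB) (# 0)) λ { (γ′ , gA′ , e) → clash gA′ gB e } }
      where
      B? : ∀ u → Dec (B u)
      B? u = S? u ×-dec ¬? (A? u)
      Attained : ℕ → Set
      Attained t = Σ[ γ ∈ (V → ℕ) ] (Good A γ × γ a₀ ≡ t)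
      closed : ∀ {u w} → A u → S w → Adj G u w → A w
      closed {u} {w} p s e = case w Finₚ.≟ v of λ
        { (yes refl) → ⊥-elim (separated p₁ p₂ (flipAdj G e) p)
        ; (no ne) → path-trans p (move (path-end p) e (stop (s , ne))) }
      both : ∀ {c} → Good A c → Good B c → Good S c
      both = good-union A? closed
      clash : ∀ {γ γ′} → Good A γ′ → Good B γ → γ′ a₀ ≢ γ v
      clash {γ} {γ′} gA gB e = let p , q = mix-good A? (λ _ → proj₂) gA gB in
        v≢a (both p q) (# 0) (trans (mix-no A? nv) (trans (sym e) (sym (mix-yes A? aA))))
      G₁ = smooth {G = G} planarG (flipAdj G (xa (# 0))) (flipAdj G (vx (# 0))) (a≢v (# 0))
      keep : ∀ {u w} → S u → S w → Adj G u w → Adj (proj₁ G₁) u w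
      keep s s′ e = proj₂ (proj₂ (proj₂ G₁)) (s (# 0)) (s′ (# 0)) e

-- Minimal connected sets

module _ (G : Graph n) where

  connected-insert : ∀ {S S′ t u} → Connected G S → t ∈ S → Adj G t u →
    (∀ {x} → x ∈ S′ → x ≡ u ⊎ x ∈ S) → u ∈ S′ → (∀ {x} → x ∈ S → x ∈ S′) → Connected G S′
  connected-insert {S} {S′} {t} {u} cS tS tu from uS′ to i j =
    path-map (λ { (here refl) → uS′ ; (there k) → to k }) (connected-∷ G cS tS tu (dir (from i)) (dir (from j)))
    where
    dir : ∀ {x} → x ≡ u ⊎ x ∈ S → x ∈ u ∷ S
    dir (inj₁ e) = here e
    dir (inj₂ k) = there k

  connected-reinsert : ∀ {K u y t} → u ∈ K → u ≢ y → t ∈ K → t ≢ y → Adj G u t → Connected G (K ∖ u ∖ y) → Connected G (K ∖ y)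
  connected-reinsert {K} {u} {y} uK u≢y tK t≢y e c =
    connected-insert c (∈-∖⁺ (∈-∖⁺ tK (adj-≢ G e ∘ sym)) t≢y) (flipAdj G e)
      (λ {x} i → let xK , x≢y = ∈-∖⁻ i in case x Finₚ.≟ u of λ { (yes q) → inj₁ q ; (no q) → inj₂ (∈-∖⁺ (∈-∖⁺ xK q) x≢y) })
      (∈-∖⁺ uK u≢y) (λ i → let j , q = ∈-∖⁻ i in ∈-∖⁺ (proj₁ (∈-∖⁻ j)) q)

  -- At a `leaf` a single leg arrives and a single edge leads on, so the leg can be prolonged
  -- through it. The other two shapes are the cores where this stops.
  data Shape (K : List (Fin n)) (p : Fin 3 → Fin n) : Set where
    single : ∀ x → (∀ {u} → u ∈ K → u ≡ x) → Shape K p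
    triangle : (∀ {i j} → i ≢ j → Adj G (p i) (p j)) → (∀ {u} → u ∈ K → ∃[ i ] u ≡ p i) → Shape K p
    leaf : ∀ i → (∀ {j} → j ≢ i → p j ≢ p i) → Connected G (K ∖ p i) → ∀ {w} → w ∈ K → Adj G (p i) w →
      (∀ {t} → t ∈ K → Adj G (p i) t → t ≡ w) → Shape K p

  module _ {K : List (Fin n)} {p : Fin 3 → Fin n} (cK : Connected G K) (pK : ∀ i → p i ∈ K)
    (ports : ∀ {u} → u ∈ K → Connected G (K ∖ u) → ∃[ i ] u ≡ p i) where

    Fork : Fin n → Set
    Fork u = ∃[ t ] ∃[ t′ ] (t ≢ t′ × t ∈ K × t′ ∈ K × Adj G u t × Adj G u t′)

    fork-avoiding : ∀ {u} → Fork u → ∀ y → ∃[ t ] (t ≢ y × t ∈ K × Adj G u t)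
    fork-avoiding (t , t′ , ne , tK , t′K , e , e′) y with t Finₚ.≟ y
    ... | yes refl = t′ , ne ∘ sym , t′K , e′
    ... | no t≢y = t , t≢y , tK , e

    leaf-or-fork : ∀ i → (∀ {j} → j ≢ i → p j ≢ p i) → Connected G (K ∖ p i) → ∀ {z} → z ∈ K → p i ≢ z → Shape K p ⊎ Fork (p i)
    leaf-or-fork i alone cut zK ne with neighbour G (cK (pK i) zK) ne
    ... | t , tK , e with Any.any? (λ t′ → adj? G (p i) t′ ×-dec ¬? (t′ Finₚ.≟ t)) K
    ...   | no none = inj₁ (leaf i alone cut tK e λ {t′} t′K e′ → decidable-stable (t′ Finₚ.≟ t) λ ne′ → none (lose t′K (e′ , ne′)))
    ...   | yes some with find some
    ...     | t′ , t′K , e′ , ne′ = inj₂ (t , t′ , ne′ ∘ sym , tK , t′K , e , e′)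

    -- A fork keeps a neighbour when y is removed, so it can be put back without making y a cut
    -- vertex.
    reinsert : ∀ {u y} → u ∈ K → Fork u → u ≢ y → Connected G (K ∖ u ∖ y) → Connected G (K ∖ y)
    reinsert {u} {y} uK fork u≢y c = let t , t≢y , tK , e = fork-avoiding fork y in connected-reinsert uK u≢y tK t≢y e c

    module _ {i j k : Fin 3} (ij : i ≢ j) (ik : i ≢ k) (jk : j ≢ k) (pij : p i ≢ p j) (pik : p i ≢ p k) (pjk : p j ≢ p k)
      (fi : Fork (p i)) (fj : Fork (p j)) (fk : Fork (p k)) (c″ : Connected G (K ∖ p i ∖ p j)) where

      private
        u = p i
        y = p j
        z = p k
        M = K ∖ u ∖ y

      ∈M⁻ : ∀ {s} → s ∈ M → s ∈ K × s ≢ u × s ≢ y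
      ∈M⁻ m = let m′ , q = ∈-∖⁻ m ; m″ , r = ∈-∖⁻ m′ in m″ , r , q

      ∈M⁺ : ∀ {s} → s ∈ K → s ≢ u → s ≢ y → s ∈ M
      ∈M⁺ a b c = ∈-∖⁺ (∈-∖⁺ a b) c

      not-port : ∀ {s} → s ∈ M → s ≢ z → ¬ Connected G (K ∖ s)
      not-port {s} sM s≢z c with ∈M⁻ sM
      ... | sK , s≢u , s≢y with ports sK c
      ... | l , refl with cover₃ i j k l ij ik jk
      ...   | inj₁ refl = s≢u refl
      ...   | inj₂ (inj₁ refl) = s≢y refl
      ...   | inj₂ (inj₂ refl) = s≢z refl

      -- Otherwise s would be a further non-cut vertex of K.
      pendant : ∀ {s} → s ∈ M → s ≢ z → Connected G (M ∖ s) → ∀ {t} → t ∈ K → Adj G u t ⊎ Adj G y t → t ≡ u ⊎ t ≡ y ⊎ t ≡ s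
      pendant {s} sM s≢z c {t} tK e with t Finₚ.≟ u | t Finₚ.≟ y | t Finₚ.≟ s
      ... | yes q | _ | _ = inj₁ q
      ... | no _ | yes q | _ = inj₂ (inj₁ q)
      ... | no _ | no _ | yes q = inj₂ (inj₂ q)
      ... | no t≢u | no t≢y | no t≢s with ∈M⁻ sM
      ...   | sK , s≢u , s≢y = ⊥-elim (not-port sM s≢z (both e))
        where
        tM : t ∈ M ∖ s
        tM = ∈-∖⁺ (∈M⁺ tK t≢u t≢y) t≢s
        attach : ∀ {a b} → a ∈ K → b ∈ K → a ≢ s → b ≢ s → a ≢ b → Fork b →
          (∀ {x} → x ∈ M ∖ s → x ∈ K × x ≢ a × x ≢ b × x ≢ s) → (∀ {x} → x ∈ K → x ≢ a → x ≢ b → x ≢ s → x ∈ M ∖ s) →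
          Adj G a t → Connected G (K ∖ s)
        attach {a} {b} aK bK a≢s b≢s a≢b fb out into at =
          let r , r≢s , rK , br = fork-avoiding fb s in
          connected-insert (connected-insert {S′ = K ∖ b ∖ s} c tM (flipAdj G at)
              (λ {x} i → let i′ , x≢s = ∈-∖⁻ i ; xK , x≢b = ∈-∖⁻ i′ in case x Finₚ.≟ a of λ { (yes q) → inj₁ q ; (no q) → inj₂ (into xK q x≢b x≢s) })
              (∈-∖⁺ (∈-∖⁺ aK a≢b) a≢s) (λ i → let xK , _ , x≢b , x≢s = out i in ∈-∖⁺ (∈-∖⁺ xK x≢b) x≢s))
            (∈-∖⁺ (∈-∖⁺ rK (adj-≢ G br ∘ sym)) r≢s) (flipAdj G br)
            (λ {x} i → let xK , x≢s = ∈-∖⁻ i in case x Finₚ.≟ b of λ { (yes q) → inj₁ q ; (no q) → inj₂ (∈-∖⁺ (∈-∖⁺ xK q) x≢s) })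
            (∈-∖⁺ bK b≢s) (λ i → let i′ , x≢s = ∈-∖⁻ i in ∈-∖⁺ (proj₁ (∈-∖⁻ i′)) x≢s)
        both : Adj G u t ⊎ Adj G y t → Connected G (K ∖ s)
        both (inj₁ ut) = attach (pK i) (pK j) (s≢u ∘ sym) (s≢y ∘ sym) pij fj
          (λ m → let m′ , q = ∈-∖⁻ m ; a , b , c = ∈M⁻ m′ in a , b , c , q) (λ a b c d → ∈-∖⁺ (∈M⁺ a b c) d) ut
        both (inj₂ yt) = attach (pK j) (pK i) (s≢y ∘ sym) (s≢u ∘ sym) (pij ∘ sym) fi
          (λ m → let m′ , q = ∈-∖⁻ m ; a , b , c = ∈M⁻ m′ in a , c , b , q) (λ a b c d → ∈-∖⁺ (∈M⁺ a c b) d) yt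

      zM : z ∈ M
      zM = ∈M⁺ (pK k) (pik ∘ sym) (pjk ∘ sym)

      u~s : ∀ {s} → s ∈ M → s ≢ z → Connected G (M ∖ s) → Adj G u s
      u~s {s} sM s≢z c with fork-avoiding fi y
      ... | t , t≢y , tK , e with pendant sM s≢z c tK (inj₁ e)
      ...   | inj₁ refl = contradiction refl (adj-≢ G e)
      ...   | inj₂ (inj₁ q) = contradiction q t≢y
      ...   | inj₂ (inj₂ refl) = e

      -- u is adjacent to s, but by `pendant` its neighbours are among y and r.
      one-pendant : ∀ {s r} → s ∈ M → s ≢ z → Connected G (M ∖ s) → r ∈ M → r ≢ z → Connected G (M ∖ r) → s ≡ r
      one-pendant sM s≢z cs rM r≢z cr with ∈M⁻ sM
      ... | sK , s≢u , s≢y with pendant rM r≢z cr sK (inj₁ (u~s sM s≢z cs))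
      ...   | inj₁ q = contradiction q s≢u
      ...   | inj₂ (inj₁ q) = contradiction q s≢y
      ...   | inj₂ (inj₂ q) = q

      -- M would have a non-cut vertex s other than z, and only one. So z is non-cut as well, and M
      -- without z has a non-cut vertex r other than s. The fork z can be put back, which makes r
      -- non-cut in M.
      no-others : ∀ {r} → r ∈ M → r ≡ z
      no-others {r} rM = decidable-stable (r Finₚ.≟ z) λ r≢z → absurd r≢z
        where
        absurd : r ≢ z → ⊥
        absurd r≢z with noncut G c″ zM rM r≢z
        ... | s , sM , s≢z , cs with noncut G c″ sM zM (s≢z ∘ sym)
        ... | s′ , s′M , s′≢s , cs′ with s′ Finₚ.≟ z
        ...   | no s′≢z = s′≢s (sym (one-pendant sM s≢z cs s′M s′≢z cs′))
        ...   | yes refl = third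
          where
          inM : ∀ {t} → t ∈ K → Adj G z t → t ∈ M
          inM {t} tK zt = ∈M⁺ tK
            (λ { refl → out (pendant sM s≢z cs (pK k) (inj₁ (flipAdj G zt))) })
            (λ { refl → out (pendant sM s≢z cs (pK k) (inj₂ (flipAdj G zt))) })
            where
            out : z ≡ u ⊎ z ≡ y ⊎ z ≡ s → ⊥
            out (inj₁ q) = pik (sym q)
            out (inj₂ (inj₁ q)) = pjk (sym q)
            out (inj₂ (inj₂ q)) = s≢z (sym q)
          off : ∀ {t} → t ∈ K → Adj G z t → t ∈ M ∖ z
          off tK zt = ∈-∖⁺ (inM tK zt) (adj-≢ G zt ∘ sym)
          third : ⊥
          third with fork-avoiding fk s
          ... | t , t≢s , tK , zt with noncut G cs′ (∈-∖⁺ sM s≢z) (off tK zt) t≢s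
          ... | r , rM , r≢s , cr with ∈-∖⁻ rM
          ... | rM′ , r≢z = r≢s (one-pendant rM′ r≢z cr′ sM s≢z cs)
            where
            cr′ : Connected G (M ∖ r)
            cr′ = let h , h≢r , hK , zh = fork-avoiding fk r in connected-reinsert zM (r≢z ∘ sym) (inM hK zh) h≢r zh cr

      all-ports : ∀ {t} → t ∈ K → t ≡ u ⊎ t ≡ y ⊎ t ≡ z
      all-ports {t} tK with t Finₚ.≟ u | t Finₚ.≟ y
      ... | yes q | _ = inj₁ q
      ... | no _ | yes q = inj₂ (inj₁ q)
      ... | no a | no b = inj₂ (inj₂ (no-others (∈M⁺ tK a b)))

      is-triangle : Shape K p
      is-triangle = triangle adjacent λ tK → case all-ports tK of λ { (inj₁ q) → i , q ; (inj₂ (inj₁ q)) → j , q ; (inj₂ (inj₂ q)) → k , q }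
        where
        uy : Adj G u y
        uy with fork-avoiding fi z
        ... | t , t≢z , tK , e with all-ports tK
        ...   | inj₁ refl = contradiction refl (adj-≢ G e)
        ...   | inj₂ (inj₁ refl) = e
        ...   | inj₂ (inj₂ q) = contradiction q t≢z
        uz : Adj G u z
        uz with fork-avoiding fi y
        ... | t , t≢y , tK , e with all-ports tK
        ...   | inj₁ refl = contradiction refl (adj-≢ G e)
        ...   | inj₂ (inj₁ q) = contradiction q t≢y
        ...   | inj₂ (inj₂ refl) = e
        yz : Adj G y z
        yz with fork-avoiding fj u
        ... | t , t≢u , tK , e with all-ports tK
        ...   | inj₁ q = contradiction q t≢u
        ...   | inj₂ (inj₁ refl) = contradiction refl (adj-≢ G e)
        ...   | inj₂ (inj₂ refl) = e
        adjacent : ∀ {a b} → a ≢ b → Adj G (p a) (p b)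
        adjacent {a} {b} ab with cover₃ i j k a ij ik jk | cover₃ i j k b ij ik jk
        ... | inj₁ refl | inj₁ refl = contradiction refl ab
        ... | inj₁ refl | inj₂ (inj₁ refl) = uy
        ... | inj₁ refl | inj₂ (inj₂ refl) = uz
        ... | inj₂ (inj₁ refl) | inj₁ refl = flipAdj G uy
        ... | inj₂ (inj₁ refl) | inj₂ (inj₁ refl) = contradiction refl ab
        ... | inj₂ (inj₁ refl) | inj₂ (inj₂ refl) = yz
        ... | inj₂ (inj₂ refl) | inj₁ refl = flipAdj G uz
        ... | inj₂ (inj₂ refl) | inj₂ (inj₁ refl) = flipAdj G yz
        ... | inj₂ (inj₂ refl) | inj₂ (inj₂ refl) = contradiction refl ab

    -- u = p i carries a single port and has two neighbours; two non-cut vertices of K ∖ u are the other two ports.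
    forked : ∀ i → Connected G (K ∖ p i) → (∀ {j} → j ≢ i → p j ≢ p i) → Fork (p i) → Shape K p
    forked i c alone f@(t , t′ , t≢t′ , tK , t′K , e , e′) with ∈-∖⁺ tK (adj-≢ G e ∘ sym) | ∈-∖⁺ t′K (adj-≢ G e′ ∘ sym)
    ... | tK′ | t′K′ with noncut G c tK′ t′K′ (t≢t′ ∘ sym)
    ... | y , yK′ , y≢t , cy with noncut G c yK′ tK′ (y≢t ∘ sym)
    ... | z , zK′ , z≢y , cz with ∈-∖⁻ yK′ | ∈-∖⁻ zK′
    ... | yK , y≢u | zK , z≢u
      with ports yK (reinsert (pK i) f (y≢u ∘ sym) cy) | ports zK (reinsert (pK i) f (z≢u ∘ sym) cz)
    ... | j , refl | k , refl
      with leaf-or-fork j (aloneJ) (reinsert (pK i) f (y≢u ∘ sym) cy) (pK i) y≢u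
         | leaf-or-fork k (aloneK) (reinsert (pK i) f (z≢u ∘ sym) cz) (pK i) z≢u
      where
      cases : ∀ {l} → l ≡ i ⊎ l ≡ j ⊎ l ≡ k
      cases {l} = cover₃ i j k l (λ { refl → y≢u refl }) (λ { refl → z≢u refl }) (λ { refl → z≢y refl })
      aloneJ : ∀ {l} → l ≢ j → p l ≢ p j
      aloneJ {l} ne with cases {l}
      ... | inj₁ refl = y≢u ∘ sym
      ... | inj₂ (inj₁ q) = contradiction q ne
      ... | inj₂ (inj₂ refl) = z≢y
      aloneK : ∀ {l} → l ≢ k → p l ≢ p k
      aloneK {l} ne with cases {l}
      ... | inj₁ refl = z≢u ∘ sym
      ... | inj₂ (inj₁ refl) = z≢y ∘ sym
      ... | inj₂ (inj₂ q) = contradiction q ne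
    ... | inj₁ sh | _ = sh
    ... | inj₂ _ | inj₁ sh = sh
    ... | inj₂ fj | inj₂ fk = is-triangle (λ { refl → y≢u refl }) (λ { refl → z≢u refl }) (λ { refl → z≢y refl })
                                (y≢u ∘ sym) (z≢u ∘ sym) (z≢y ∘ sym) f fj fk cy

    pick : ∀ j → Connected G (K ∖ p j) → (∀ {l} → l ≢ j → p l ≢ p j) → ∀ {z} → z ∈ K → p j ≢ z → Shape K p
    pick j c al zK ne with leaf-or-fork j al c zK ne
    ... | inj₁ sh = sh
    ... | inj₂ f = forked j c al f

    -- Two non-cut vertices are ports. The third leg cannot arrive at both, so at one of them a
    -- single leg arrives.
    shape : Shape K p
    shape with Any.any? (λ y → ¬? (y Finₚ.≟ p zero)) K
    ... | no none = single (p zero) λ {u} uK → decidable-stable (u Finₚ.≟ p zero) λ ne → none (lose uK ne)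
    ... | yes some with find some
    ... | y , yK , y≢p with noncut G cK (pK zero) yK y≢p
    ... | u , uK , u≢p , cu with noncut G cK uK (pK zero) (u≢p ∘ sym)
    ... | u′ , u′K , u′≢u , cu′ with ports uK cu | ports u′K cu′
    ... | i , refl | j , refl with third₃ i j
    ... | k , ik , jk with p k Finₚ.≟ p i
    ...   | yes q = pick j cu′ alone (pK i) u′≢u
      where
      alone : ∀ {l} → l ≢ j → p l ≢ p j
      alone {l} ne e with cover₃ i j k l (λ { refl → u′≢u refl }) ik jk
      ... | inj₁ refl = u′≢u (sym e)
      ... | inj₂ (inj₁ r) = ne r
      ... | inj₂ (inj₂ refl) = u′≢u (trans (sym e) q)
    ...   | no q = pick i cu alone (pK j) (u′≢u ∘ sym)
      where
      alone : ∀ {l} → l ≢ i → p l ≢ p i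
      alone {l} ne e with cover₃ i j k l (λ { refl → u′≢u refl }) ik jk
      ... | inj₁ r = ne r
      ... | inj₂ (inj₁ refl) = u′≢u e
      ... | inj₂ (inj₂ refl) = q e

-- Three neighbours joined by low vertices

upd-case : ∀ {a m} {A : Set a} (f : Fin m → A) i x j → (j ≡ i × upd f i x j ≡ x) ⊎ (j ≢ i × upd f i x j ≡ f j)
upd-case f i x j with j Finₚ.≟ i
... | yes e = inj₁ (e , refl)
... | no ne = inj₂ (ne , refl)

Two : (ℕ → Set) → Set
Two P = ∃[ s ] ∃[ t ] (s ≢ t × P s × P t)

two : {P : ℕ → Set} {xs : List ℕ} → Unique xs → 2 ≤ length xs → (∀ {t} → t ∈ xs → P t) → Two P
two {xs = s ∷ t ∷ _} ((ne ∷ _) ∷ _) _ h = s , t , ne , h (here refl) , h (there (here refl))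
two {xs = _ ∷ []} _ (s≤s ()) _

two-avoid : {P : ℕ → Set} → Two P → ∀ e → ∃[ s ] (P s × s ≢ e)
two-avoid (s , t , ne , ps , pt) e with s ≟ e
... | yes refl = t , pt , ne ∘ sym
... | no q = s , ps , q

record LegData {n : ℕ} (U : BadLists n) (v : Fin n) : Set where
  open BadLists U
  field
    K₀     : List (Fin n)
    low    : ∀ {u} → u ∈ K₀ → Low G u
    v∉K₀   : v ∉ K₀
    p₀     : Fin 3 → Fin n
    p₀-inj : ∀ {i j} → p₀ i ≡ p₀ j → i ≡ j
    p₀K    : ∀ i → p₀ i ∈ K₀
    vp₀    : ∀ i → Adj G v (p₀ i)
    cK₀    : Connected G K₀
    ports₀ : ∀ {u} → u ∈ K₀ → Connected G (K₀ ∖ u) → ∃[ i ] u ≡ p₀ i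
    v-only : ∀ {u} → u ∈ K₀ → Adj G v u → ∃[ i ] u ≡ p₀ i

module Tripod {n : ℕ} (U : BadLists n) (v : Fin n) (deg-v : degree (BadLists.G U) v ≤ 5) where

  open Uncolourable U

  module Legs (LD : LegData U v) where

    open LegData LD

    Done : List V → V → Set
    Done K b = b ≡ v ⊎ (b ∈ K₀ × b ∉ K)

    -- The i-th leg runs from v to q i; p i is the vertex of the remaining set K in which it continues.
    record State (K : List V) (p q : Fin 3 → V) : Set where
      field
        conn  : Connected G K
        K⊆    : ∀ {u} → u ∈ K → u ∈ K₀
        pK    : ∀ i → p i ∈ K
        ports : ∀ {u} → u ∈ K → Connected G (K ∖ u) → ∃[ i ] u ≡ p i
        qp    : ∀ i → Adj G (q i) (p i)
        done  : ∀ i → Done K (q i)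
        only  : ∀ {b u} → u ∈ K → Done K b → Adj G b u → ∃[ i ] (b ≡ q i × u ≡ p i)
        apart : ∀ {i j} → p i ≡ p j → q i ≡ q j → i ≡ j
        -- Legs with a common end are still empty.
        tails : ∀ {i j} → i ≢ j → q i ≡ q j → q i ≡ v

      done∉K : ∀ {b} → Done K b → b ∉ K
      done∉K (inj₁ refl) i = v∉K₀ (K⊆ i)
      done∉K (inj₂ (_ , b∉)) i = b∉ i

    start : State K₀ p₀ (λ _ → v)
    start = record
      { conn = cK₀ ; K⊆ = id ; pK = p₀K ; ports = ports₀ ; qp = vp₀ ; done = λ _ → inj₁ refl
      ; only = λ { uK (inj₁ refl) e → let i , q = v-only uK e in i , refl , q ; uK (inj₂ (b , b∉)) e → contradiction b b∉ }
      ; apart = λ e _ → p₀-inj e ; tails = λ _ _ → refl }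

    module _ {K p q} (st : State K p q) (i : Fin 3) (alone : ∀ {j} → j ≢ i → p j ≢ p i) (c′ : Connected G (K ∖ p i))
      {w : V} (wK : w ∈ K) (uw : Adj G (p i) w) (unique : ∀ {t} → t ∈ K → Adj G (p i) t → t ≡ w) where
      open State st

      private
        u : V
        u = p i
        K′ : List V
        K′ = K ∖ u
        p′ q′ : Fin 3 → V
        p′ = upd p i w
        q′ = upd q i u

      w≢u : w ≢ u
      w≢u = adj-≢ G uw ∘ sym

      absorb : State K′ p′ q′
      absorb = record
        { conn = c′ ; K⊆ = K⊆ ∘ proj₁ ∘ ∈-∖⁻ ; pK = pK′ ; ports = ports′ ; qp = qp′ ; done = done′ ; only = only′
        ; apart = apart′ ; tails = tails′ }
        where
        pK′ : ∀ j → p′ j ∈ K′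
        pK′ j with upd-case p i w j
        ... | inj₁ (_ , e) = subst (_∈ K′) (sym e) (∈-∖⁺ wK w≢u)
        ... | inj₂ (ne , e) = subst (_∈ K′) (sym e) (∈-∖⁺ (pK j) (alone ne))
        off : ∀ {l} → p l ≢ u → l ≢ i
        off ne refl = ne refl
        ports′ : ∀ {t} → t ∈ K′ → Connected G (K′ ∖ t) → ∃[ j ] t ≡ p′ j
        ports′ {t} tK′ ct with ∈-∖⁻ tK′ | t Finₚ.≟ w
        ... | tK , t≢u | yes refl = i , sym (upd-at p i w)
        ... | tK , t≢u | no t≢w = let j , e = ports tK insert in j , trans e (sym (upd-off p (off λ r → t≢u (trans e r))))
          where
          insert : Connected G (K ∖ t)
          insert = connected-reinsert G (pK i) (t≢u ∘ sym) wK (t≢w ∘ sym) uw ct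
        qp′ : ∀ j → Adj G (q′ j) (p′ j)
        qp′ j with upd-case p i w j | upd-case q i u j
        ... | inj₁ (_ , e) | inj₁ (_ , e′) = subst₂ (Adj G) (sym e′) (sym e) uw
        ... | inj₂ (_ , e) | inj₂ (_ , e′) = subst₂ (Adj G) (sym e′) (sym e) (qp j)
        ... | inj₁ (a , _) | inj₂ (b , _) = contradiction a b
        ... | inj₂ (b , _) | inj₁ (a , _) = contradiction a b
        done′ : ∀ j → Done K′ (q′ j)
        done′ j with upd-case q i u j | done j
        ... | inj₁ (_ , e) | _ = subst (Done K′) (sym e) (inj₂ (K⊆ (pK i) , λ k → proj₂ (∈-∖⁻ k) refl))
        ... | inj₂ (_ , e) | inj₁ r = inj₁ (trans e r)
        ... | inj₂ (_ , e) | inj₂ (a , b) = subst (Done K′) (sym e) (inj₂ (a , b ∘ proj₁ ∘ ∈-∖⁻))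
        old : ∀ {b t} → t ∈ K′ → Done K b → Adj G b t → ∃[ l ] (b ≡ q′ l × t ≡ p′ l)
        old tK′ d e with ∈-∖⁻ tK′
        ... | tK , t≢u = let l , x , y = only tK d e ; ne = off λ r → t≢u (trans y r) in l , trans x (sym (upd-off q ne)) , trans y (sym (upd-off p ne))
        only′ : ∀ {b t} → t ∈ K′ → Done K′ b → Adj G b t → ∃[ l ] (b ≡ q′ l × t ≡ p′ l)
        only′ tK′ (inj₁ e) a = old tK′ (inj₁ e) a
        only′ {b} tK′ (inj₂ (bK₀ , b∉)) a with b ∈F? K
        ... | no b∉K = old tK′ (inj₂ (bK₀ , b∉K)) a
        ... | yes bK with b Finₚ.≟ u
        ...   | no ne = contradiction (∈-∖⁺ bK ne) b∉
        ...   | yes refl = i , sym (upd-at q i u) , trans (unique (proj₁ (∈-∖⁻ tK′)) a) (sym (upd-at p i w))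
        fresh : ∀ l → q l ≢ u
        fresh l e = done∉K (done l) (subst (_∈ K) (sym e) (pK i))
        apart′ : ∀ {j l} → p′ j ≡ p′ l → q′ j ≡ q′ l → j ≡ l
        apart′ {j} {l} ep eq with upd-case q i u j | upd-case q i u l
        ... | inj₁ (a , _) | inj₁ (b , _) = trans a (sym b)
        ... | inj₂ (a , x) | inj₂ (b , y) = apart (trans (sym (upd-off p a)) (trans ep (upd-off p b))) (trans (sym x) (trans eq y))
        ... | inj₁ (_ , x) | inj₂ (_ , y) = contradiction (trans (sym y) (trans (sym eq) x)) (fresh l)
        ... | inj₂ (_ , x) | inj₁ (_ , y) = contradiction (trans (sym x) (trans eq y)) (fresh j)
        tails′ : ∀ {j l} → j ≢ l → q′ j ≡ q′ l → q′ j ≡ v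
        tails′ {j} {l} jl eq with upd-case q i u j | upd-case q i u l
        ... | inj₁ (a , _) | inj₁ (b , _) = contradiction (trans a (sym b)) jl
        ... | inj₂ (_ , x) | inj₂ (_ , y) = trans x (tails jl (trans (sym x) (trans eq y)))
        ... | inj₁ (_ , x) | inj₂ (_ , y) = contradiction (trans (sym y) (trans (sym eq) x)) (fresh l)
        ... | inj₂ (_ , x) | inj₁ (_ , y) = contradiction (trans (sym x) (trans eq y)) (fresh j)

    Single : List V → Set
    Single K = ∃[ x ] (∀ {u} → u ∈ K → u ≡ x)

    Triangle : List V → (Fin 3 → V) → Set
    Triangle K p = (∀ {i j} → i ≢ j → Adj G (p i) (p j)) × (∀ {u} → u ∈ K → ∃[ i ] u ≡ p i)

    record End : Set where
      field
        K : List V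
        p q : Fin 3 → V
        state : State K p q
        core : Single K ⊎ Triangle K p

    -- The absorptions are kept as data because they are used in both directions: the reference
    -- colouring is chosen for the last set, and the legs are then coloured again from the first one
    -- on.
    data Trip : (K : List V) (p q : Fin 3 → V) → Set where
      stop : ∀ {K p q} → State K p q → Single K ⊎ Triangle K p → Trip K p q
      abs  : ∀ {K p q} → State K p q → ∀ i → (∀ {j} → j ≢ i → p j ≢ p i) → ∀ {w} → w ∈ K → Adj G (p i) w →
        Trip (K ∖ p i) (upd p i w) (upd q i (p i)) → Trip K p q

    end : ∀ {K p q} → Trip K p q → End
    end (stop st c) = record { state = st ; core = c }
    end (abs _ _ _ _ _ tr) = end tr

    end-⊆ : ∀ {K p q} (tr : Trip K p q) → ∀ {u} → u ∈ End.K (end tr) → u ∈ K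
    end-⊆ (stop _ _) = id
    end-⊆ (abs _ _ _ _ _ tr) i = proj₁ (∈-∖⁻ (end-⊆ tr i))

    build : ∀ fuel {K p q} → length K ≤ fuel → State K p q → Trip K p q
    build fuel {K} {p} {q} le st with shape G (State.conn st) (State.pK st) (State.ports st)
    ... | single x h = stop st (inj₁ (x , h))
    ... | triangle a h = stop st (inj₂ (a , h))
    build zero le st | leaf i _ _ _ _ _ with () ← ≤-trans (length-∖ (State.pK st i)) le
    build (suc fuel) {K} {p} le st | leaf i alone c {w} wK e u =
      abs st i alone wK e (build fuel (≤-pred (≤-trans (length-∖ (State.pK st i)) le)) (absorb st i alone c wK e u))

    trip : Trip K₀ p₀ (λ _ → v)
    trip = build (length K₀) ≤-refl start

    O : V → Set
    O u = u ∉ K₀ × u ≢ v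

    O? : ∀ u → Dec (O u)
    O? u = ¬? (u ∈F? K₀) ×-dec ¬? (u Finₚ.≟ v)

    done∉O : ∀ {K b} → Done K b → ¬ O b
    done∉O (inj₁ e) (_ , ne) = ne e
    done∉O (inj₂ (b , _)) (b∉ , _) = b∉ b

    record EndColouring : Set where
      field
        T₀ : Trip K₀ p₀ (λ _ → v)
        g : V → ℕ
        g-good : Good (_∉ End.K (end T₀)) g
        g-end : Triangle (End.K (end T₀)) (End.p (end T₀)) → ∃[ i ] ∃[ j ] (i ≢ j × g (End.q (end T₀) i) ≢ g (End.q (end T₀) j))

    module Solve (EC : EndColouring) where

      open EndColouring EC

      v∉end : v ∉ End.K (end T₀)
      v∉end i = v∉K₀ (end-⊆ T₀ i)

      O∉end : ∀ {u} → O u → u ∉ End.K (end T₀)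
      O∉end (u∉ , _) i = u∉ (end-⊆ T₀ i)

      g-free : ∀ {u} → u ∉ End.K (end T₀) → Free O g u (g u)
      g-free {u} u∉ = proj₁ g-good u u∉ , λ w o a e → proj₂ g-good u w u∉ (O∉end o) a (sym e)

      abstract

        second : ∃[ c′ ] (Free O g v c′ × c′ ≢ g v)
        second =
          let xs , uxs , fr , _ , le = free O? g v (p₀ (# 0) ∷ p₀ (# 1) ∷ p₀ (# 2) ∷ [])
                (((λ e → case p₀-inj e of λ ()) ∷ (λ e → case p₀-inj e of λ ()) ∷ []) ∷ ((λ e → case p₀-inj e of λ ()) ∷ []) ∷ [] ∷ [])
                (λ { (here refl) → vp₀ _ , (λ o → proj₁ o (p₀K _)) ; (there (here refl)) → vp₀ _ , (λ o → proj₁ o (p₀K _))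
                   ; (there (there (here refl))) → vp₀ _ , (λ o → proj₁ o (p₀K _)) })
              t , t∈ , t∉ = avoid uxs (g v ∷ []) (+-cancelʳ-≤ 5 2 (length xs) (≤-trans le (+-monoʳ-≤ (length xs) deg-v)))
          in t , fr t∈ , λ e → t∉ (here e)

      colour-v : Bool → ℕ
      colour-v true = g v
      colour-v false = proj₁ second

      distinct : colour-v true ≢ colour-v false
      distinct e = proj₂ (proj₂ second) (sym e)

      -- In the two schemes true and false, v has the colour g v or a second one.  A leg is either flexible (its end has
      -- two options in some scheme) or tight: its end repeats the colour of v in both schemes, or the opposite one.
      Typed : (Bool → ℕ → Set) → Set
      Typed E = (∃[ s ] Two (E s)) ⊎ (E true (colour-v true) × E false (colour-v false)) ⊎ (E true (colour-v false) × E false (colour-v true))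

      -- `E i s` holds colours that the end of leg i can take in scheme s, and `colouring` says that
      -- the three legs choose independently.
      record Colours (K : List V) (p q : Fin 3 → V) : Set₁ where
        field
          E : Fin 3 → Bool → ℕ → Set
          some : ∀ i s → ∃[ e ] E i s e
          typed : ∀ i → Typed (E i)
          -- The scheme `true` contains the reference colouring; in this way `g-end` becomes usable
          -- at the triangle.
          g∈E : ∀ i → E i true (g (q i))
          colouring : ∀ s (e : Fin 3 → ℕ) → (∀ i → E i s (e i)) →
            ∃[ h ] (Good (_∉ K) h × (∀ i → h (q i) ≡ e i) × (∀ {u} → O u → h u ≡ g u))

      initial : Colours K₀ p₀ (λ _ → v)
      initial = record
        { E = λ _ s e → e ≡ colour-v s ; some = λ _ s → _ , refl ; typed = λ _ → inj₂ (inj₁ (refl , refl)) ; g∈E = λ _ → refl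
        ; colouring = λ s e he → upd g v (e zero) ,
            good-⊆ (λ u u∉ → case u Finₚ.≟ v of λ { (yes r) → inj₁ r ; (no ne) → inj₂ (u∉ , ne) })
              (extend (λ o → proj₂ o refl) (good-⊆ (λ u → O∉end) g-good) (fr s (he zero))) ,
            (λ i → trans (upd-at g v (e zero)) (trans (he zero) (sym (he i)))) , λ o → upd-off g (proj₂ o) }
        where
        fr : ∀ s {e} → e ≡ colour-v s → Free O g v e
        fr true refl = g-free v∉end
        fr false refl = proj₁ (proj₂ second)

      -- The neighbours of u outside K are vertices of `O`, where h agrees with g, and, by `only`,
      -- ends of legs that arrive at u.
      free-in : ∀ {K p q} (st : State K p q) {h : V → ℕ} (e : Fin 3 → ℕ) → (∀ i → h (q i) ≡ e i) → (∀ {u} → O u → h u ≡ g u) →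
        ∀ {u t} → u ∈ K → Free O g u t → (∀ i → u ≡ p i → e i ≢ t) → Free (_∉ K) h u t
      free-in {K} st {h} e hq hO {u} {t} uK (t∈ , fr) ne = t∈ , λ b b∉ a → go b b∉ a (b Finₚ.≟ v) (b ∈F? K₀)
        where
        open State st
        viaDone : ∀ b → Done K b → Adj G u b → h b ≢ t
        viaDone b d a r = let i , x , y = only uK d (flipAdj G a) in ne i y (trans (sym (hq i)) (trans (cong h (sym x)) r))
        go : ∀ b → b ∉ K → Adj G u b → Dec (b ≡ v) → Dec (b ∈ K₀) → h b ≢ t
        go b b∉ a (yes e) _ = viaDone b (inj₁ e) a
        go b b∉ a (no _) (yes i) = viaDone b (inj₂ (i , b∉)) a
        go b b∉ a (no ne′) (no i) r = fr b (i , ne′) a (trans (sym (hO (i , ne′))) r)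

      module Absorb {K p q} (st : State K p q) (C : Colours K p q) (i : Fin 3) (alone : ∀ {j} → j ≢ i → p j ≢ p i)
        {w : V} (wK : w ∈ K) (uw : Adj G (p i) w) (u∉end : p i ∉ End.K (end T₀)) (q∉end : q i ∉ End.K (end T₀)) where
        open State st
        open Colours C

        u : V
        u = p i

        abstract

          frees : Two (Free O g u)
          frees =
            let xs , uxs , fr , _ , le = free-low O? g (low (K⊆ (pK i))) (q i ∷ w ∷ [])
                  (((λ e → done∉K (done i) (subst (_∈ K) (sym e) wK)) ∷ []) ∷ [] ∷ [])
                  (λ { (here refl) → flipAdj G (qp i) , done∉O (done i) ; (there (here refl)) → uw , (λ o → proj₁ o (K⊆ wK)) })
            in two uxs le fr

        New : Bool → ℕ → Set
        New s x = Free O g u x × ∃[ e ] (E i s e × e ≢ x)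

        new : ∀ {s e x} → Free O g u x → E i s e → e ≢ x → New s x
        new f h ne = f , _ , h , ne

        some-new : ∀ s → ∃[ x ] New s x
        some-new s = let e , h = some i s ; x , f , ne = two-avoid frees e in x , new f h (ne ∘ sym)

        abstract

          -- Unless the leg becomes flexible, the list of u is the pair of the two colours, which are thereby swapped.
          prolong : ∀ {x y} → x ≢ y → E i true x → E i false y → (∃[ s ] Two (New s)) ⊎ (New true y × New false x)
          prolong {x} {y} x≢y hx hy with frees
          ... | a , b , a≢b , fa , fb with x ≟ a | x ≟ b | y ≟ a | y ≟ b
          ...   | no xa | no xb | _ | _ = inj₁ (true , a , b , a≢b , new fa hx xa , new fb hx xb)
          ...   | yes _ | _ | no ya | no yb = inj₁ (false , a , b , a≢b , new fa hy ya , new fb hy yb)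
          ...   | no _ | yes _ | no ya | no yb = inj₁ (false , a , b , a≢b , new fa hy ya , new fb hy yb)
          ...   | yes refl | _ | yes refl | _ = contradiction refl x≢y
          ...   | no _ | yes refl | no _ | yes refl = contradiction refl x≢y
          ...   | yes refl | _ | no _ | yes refl = inj₂ (new fb hx x≢y , new fa hy (x≢y ∘ sym))
          ...   | no _ | yes refl | yes refl | _ = inj₂ (new fa hx x≢y , new fb hy (x≢y ∘ sym))

        typed-new : Typed New
        typed-new with typed i
        ... | inj₁ (s , e₁ , e₂ , ne , h₁ , h₂) = let a , b , a≢b , fa , fb = frees in inj₁ (s , a , b , a≢b , either fa , either fb)
          where
          -- One of the two colours at the previous end differs from x, so a flexible leg remains
          -- flexible in the same scheme.
          either : ∀ {x} → Free O g u x → New s x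
          either {x} f with e₁ ≟ x
          ... | yes refl = new f h₂ (ne ∘ sym)
          ... | no q = new f h₁ q
        ... | inj₂ (inj₁ (h , h′)) = case prolong distinct h h′ of λ { (inj₁ t) → inj₁ t ; (inj₂ t) → inj₂ (inj₂ t) }
        ... | inj₂ (inj₂ (h , h′)) = case prolong (distinct ∘ sym) h h′ of λ { (inj₁ t) → inj₁ t ; (inj₂ t) → inj₂ (inj₁ t) }

        E′ : Fin 3 → Bool → ℕ → Set
        E′ = upd E i New

        E′-i : E′ i ≡ New
        E′-i = upd-at E i New

        colouring′ : ∀ s (e : Fin 3 → ℕ) → (∀ j → E′ j s (e j)) →
          ∃[ h ] (Good (_∉ K ∖ u) h × (∀ j → h (upd q i u j) ≡ e j) × (∀ {t} → O t → h t ≡ g t))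
        colouring′ s e he with subst (λ P → P s (e i)) E′-i (he i)
        ... | fu , e₀ , h₀ , ne with colouring s (upd e i e₀) earlier
          where
          earlier : ∀ j → E j s (upd e i e₀ j)
          earlier j with upd-case e i e₀ j | upd-case E i New j
          ... | inj₁ (refl , r) | _ = subst (E i s) (sym r) h₀
          ... | inj₂ (_ , r) | inj₂ (_ , r′) = subst (E j s) (sym r) (subst (λ P → P s (e j)) r′ (he j))
          ... | inj₂ (a , _) | inj₁ (b , _) = contradiction b a
        ... | h , gh , hq , hO = upd h u (e i) ,
          good-⊆ (λ t t∉ → case t Finₚ.≟ u of λ { (yes r) → inj₁ r ; (no r) → inj₂ λ tK → t∉ (∈-∖⁺ tK r) })
            (extend (λ n → n (pK i)) gh (free-in st (upd e i e₀) hq hO (pK i) fu blocked)) ,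
          ends , λ o → trans (upd-off h λ { refl → proj₁ o (K⊆ (pK i)) }) (hO o)
          where
          blocked : ∀ l → u ≡ p l → upd e i e₀ l ≢ e i
          blocked l r with upd-case e i e₀ l
          ... | inj₁ (_ , x) = λ y → ne (trans (sym x) y)
          ... | inj₂ (l≢i , _) = contradiction (sym r) (alone l≢i)
          ends : ∀ j → upd h u (e i) (upd q i u j) ≡ e j
          ends j with upd-case q i u j | upd-case e i e₀ j
          ... | inj₁ (refl , x) | _ = trans (cong (upd h u (e i)) x) (upd-at h u (e i))
          ... | inj₂ (_ , x) | inj₂ (_ , y) = trans (cong (upd h u (e i)) x)
                  (trans (upd-off h λ r → done∉K (done j) (subst (_∈ K) (sym r) (pK i))) (trans (hq j) y))
          ... | inj₂ (a , _) | inj₁ (b , _) = contradiction b a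

        absorbed : Colours (K ∖ u) (upd p i w) (upd q i u)
        absorbed = record { E = E′ ; some = some′ ; typed = typed′ ; g∈E = g∈′ ; colouring = colouring′ }
          where
          some′ : ∀ j s → ∃[ e ] E′ j s e
          some′ j s with upd-case E i New j
          ... | inj₁ (_ , r) = subst (λ P → ∃[ e ] P s e) (sym r) (some-new s)
          ... | inj₂ (_ , r) = subst (λ P → ∃[ e ] P s e) (sym r) (some j s)
          typed′ : ∀ j → Typed (E′ j)
          typed′ j with upd-case E i New j
          ... | inj₁ (_ , r) = subst Typed (sym r) typed-new
          ... | inj₂ (_ , r) = subst Typed (sym r) (typed j)
          g∈′ : ∀ j → E′ j true (g (upd q i u j))
          g∈′ j with upd-case E i New j | upd-case q i u j
          ... | inj₁ (_ , r) | inj₁ (_ , x) = subst (λ P → P true (g (upd q i u j))) (sym r) (subst (New true) (cong g (sym x))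
                  (new (g-free u∉end) (g∈E i) (proj₂ g-good (q i) u q∉end u∉end (qp i))))
          ... | inj₂ (_ , r) | inj₂ (_ , x) = subst (λ P → P true (g (upd q i u j))) (sym r) (subst (E j true) (cong g (sym x)) (g∈E j))
          ... | inj₁ (b , _) | inj₂ (a , _) = contradiction b a
          ... | inj₂ (a , _) | inj₁ (b , _) = contradiction b a

      module _ {K p q} (st : State K p q) (C : Colours K p q) where
        open State st
        open Colours C

        module Choice {i j k : Fin 3} (ij : i ≢ j) (ik : i ≢ k) (jk : j ≢ k) {s : Bool} {x y z : ℕ} (hx : E i s x) (hy : E j s y) (hz : E k s z) where
          e : Fin 3 → ℕ
          e = upd (upd (λ _ → z) j y) i x
          e-i : e i ≡ x
          e-i = upd-at _ i x
          e-j : e j ≡ y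
          e-j = trans (upd-off _ (ij ∘ sym)) (upd-at _ j y)
          e-k : e k ≡ z
          e-k = trans (upd-off _ (ik ∘ sym)) (upd-off _ (jk ∘ sym))
          he : ∀ l → E l s (e l)
          he l with cover₃ i j k l ij ik jk
          ... | inj₁ refl = subst (E i s) (sym e-i) hx
          ... | inj₂ (inj₁ refl) = subst (E j s) (sym e-j) hy
          ... | inj₂ (inj₂ refl) = subst (E k s) (sym e-k) hz

        -- The three ends are distinct, so the core vertex has three colours before they block any.
        -- A flexible end dodges a colour that the other two leave. If all are tight, only the two
        -- colours of v are blocked, and a third remains.
        solve-single : Single K → ⊥
        solve-single (x , only-x) with free-low O? g (low (K⊆ (pK zero))) (q (# 0) ∷ q (# 1) ∷ q (# 2) ∷ [])
            ((ne (# 0) (# 1) (λ ()) ∷ ne (# 0) (# 2) (λ ()) ∷ []) ∷ (ne (# 1) (# 2) (λ ()) ∷ []) ∷ [] ∷ [])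
            (λ { (here refl) → nb _ ; (there (here refl)) → nb _ ; (there (there (here refl))) → nb _ })
          where
          ne : ∀ i j → i ≢ j → q i ≢ q j
          ne i j i≢j e = i≢j (apart (trans (only-x (pK i)) (sym (only-x (pK j)))) e)
          nb : ∀ i → Adj G (p zero) (q i) × ¬ O (q i)
          nb i = subst (λ t → Adj G t (q i)) (trans (only-x (pK i)) (sym (only-x (pK zero)))) (flipAdj G (qp i)) , done∉O (done i)
        ... | xs , uxs , fr , _ , le = by-type
          where
          finish : ∀ s e → (∀ i → E i s (e i)) → ∀ {t} → t ∈ xs → (∀ i → e i ≢ t) → ⊥
          finish s e he t∈ ne = let h , gh , hq , hO = colouring s e he in
            not-all-good (good-⊆ (λ u _ → case u ∈F? K of λ { (yes i) → inj₁ (trans (only-x i) (sym (only-x (pK zero)))) ; (no i) → inj₂ i })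
              (extend (λ n → n (pK zero)) gh (free-in st e hq hO (pK zero) (fr t∈) λ i _ → ne i)))
          flexible : ∀ i s → Two (E i s) → ⊥
          flexible i s t with third₃ i i
          ... | j , ij , _ with third₃ i j
          ... | k , ik , jk with some j s | some k s
          ... | y , hy | z , hz with avoid uxs (y ∷ z ∷ []) le
          ... | r , r∈ , r∉ with two-avoid t r
          ... | x′ , hx , x′≢r = finish s e he r∈ ne
            where
            open Choice ij ik jk hx hy hz
            ne : ∀ l → e l ≢ r
            ne l q′ with cover₃ i j k l ij ik jk
            ... | inj₁ refl = x′≢r (trans (sym e-i) q′)
            ... | inj₂ (inj₁ refl) = r∉ (here (trans (sym q′) e-j))
            ... | inj₂ (inj₂ refl) = r∉ (there (here (trans (sym q′) e-k)))
          tight : ∀ i → ∃[ e ] (E i true e × (e ≡ colour-v true ⊎ e ≡ colour-v false))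
          tight i with typed i
          ... | inj₁ (s , t) = ⊥-elim (flexible i s t)
          ... | inj₂ (inj₁ (h , _)) = _ , h , inj₁ refl
          ... | inj₂ (inj₂ (h , _)) = _ , h , inj₂ refl
          by-type : ⊥
          by-type = let t , t∈ , t∉ = avoid uxs (colour-v true ∷ colour-v false ∷ []) le in
            finish true (λ i → proj₁ (tight i)) (λ i → proj₁ (proj₂ (tight i))) t∈
              λ i e → case proj₂ (proj₂ (tight i)) of λ
                { (inj₁ r) → t∉ (here (trans (sym e) r)) ; (inj₂ r) → t∉ (there (here (trans (sym e) r))) }

        -- Each core vertex has three colours before its leg blocks one. A flexible leg is coloured
        -- last and dodges. Otherwise `pinned` makes the ends in scheme `true` those of g, which
        -- differ at i and j, so these legs are of opposite types.
        solve-triangle : Triangle K p → (∃[ i ] ∃[ j ] (i ≢ j × g (q i) ≢ g (q j))) → ⊥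
        solve-triangle (pp , only-p) (i , j , ij , gij) = tight-case (typed i) (typed j)
          where
          q≢p : ∀ a b → q a ≢ p b
          q≢p a b e = done∉K (done a) (subst (_∈ K) (sym e) (pK b))
          options : ∀ a b c → a ≢ b → a ≢ c → b ≢ c → ∃[ xs ] (Unique xs × (∀ {t} → t ∈ xs → Free O g (p a) t) × 3 ≤ length xs)
          options a b c ab ac bc =
            let xs , u , fr , _ , le = free-low O? g (low (K⊆ (pK a))) (q a ∷ p b ∷ p c ∷ [])
                     ((q≢p a b ∷ q≢p a c ∷ []) ∷ (adj-≢ G (pp bc) ∷ []) ∷ [] ∷ [])
                     (λ { (here refl) → flipAdj G (qp a) , done∉O (done a)
                        ; (there (here refl)) → pp ab , (λ o → proj₁ o (K⊆ (pK b)))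
                        ; (there (there (here refl))) → pp ac , (λ o → proj₁ o (K⊆ (pK c))) })
            in xs , u , fr , le
          p-inj : ∀ {a b} → p a ≡ p b → a ≡ b
          p-inj {a} {b} e = decidable-stable (a Finₚ.≟ b) λ ne → adj-≢ G (pp ne) e
          finish : ∀ {a b c} → a ≢ b → a ≢ c → b ≢ c → ∀ {s x y z r t o} → E a s x → E b s y → E c s z →
            Free O g (p a) r → Free O g (p b) t → Free O g (p c) o → x ≢ r → y ≢ t → z ≢ o → r ≢ t → r ≢ o → t ≢ o → ⊥
          finish {a} {b} {c} ab ac bc {s} hx hy hz fr ft fo xr yt zo rt ro to =
            let h , gh , hq , hO = colouring s e he in
            fill p pp (λ l n → n (pK l)) (λ u → case u ∈F? K of λ { (yes m) → inj₂ (only-p m) ; (no m) → inj₁ m }) gh ab ac bc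
              (free-in st e hq hO (pK a) fr λ l m w → xr (trans (sym e-i) (trans (cong e (p-inj m)) w)))
              (free-in st e hq hO (pK b) ft λ l m w → yt (trans (sym e-j) (trans (cong e (p-inj m)) w)))
              (free-in st e hq hO (pK c) fo λ l m w → zo (trans (sym e-k) (trans (cong e (p-inj m)) w)))
              rt ro to
            where open Choice ab ac bc hx hy hz
          flexible : ∀ a s → Two (E a s) → ⊥
          flexible a s tw with third₃ a a
          ... | b , ab , _ with third₃ a b
          ... | c , ac , bc with options a b c ab ac bc | options b a c (ab ∘ sym) bc ac | options c a b (ac ∘ sym) (bc ∘ sym) ab | some b s | some c s
          ... | xs , ux , fx , lx | ys , uy , fy , ly | zs , uz , fz , lz | y , hy | z , hz with avoid uy (y ∷ []) (≤-trans (s≤s (s≤s z≤n)) ly)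
          ... | t , t∈ , t∉ with avoid uz (z ∷ t ∷ []) lz
          ... | o , o∈ , o∉ with avoid ux (t ∷ o ∷ []) lx
          ... | r , r∈ , r∉ with two-avoid tw r
          ... | x , hx , x≢r = finish ab ac bc hx hy hz (fx r∈) (fy t∈) (fz o∈) x≢r (λ e → t∉ (here (sym e))) (λ e → o∉ (here (sym e)))
                                 (λ e → r∉ (here e)) (λ e → r∉ (there (here e))) (λ e → o∉ (there (here (sym e))))
          -- If y is free at p a, it can be used there in the first scheme; otherwise p a keeps three colours in the second.
          opposite : ∀ {a b c x y} → a ≢ b → a ≢ c → b ≢ c → x ≢ y → E a true x → E b true y → E a false y → E b false x → ⊥
          opposite {a} {b} {c} {x} {y} ab ac bc x≢y ha hb ha′ hb′
            with options a b c ab ac bc | options b a c (ab ∘ sym) bc ac | options c a b (ac ∘ sym) (bc ∘ sym) ab | some c true | some c false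
          ... | xs , ux , fx , lx | ys , uy , fy , ly | zs , uz , fz , lz | z , hz | z′ , hz′ with y ∈ℕ? xs
          ...   | yes y∈ with avoid uz (z ∷ y ∷ []) lz
          ...     | o , o∈ , o∉ with avoid uy (y ∷ o ∷ []) ly
          ...       | t , t∈ , t∉ = finish ab ac bc ha hb hz (fx y∈) (fy t∈) (fz o∈) x≢y (λ e → t∉ (here (sym e))) (λ e → o∉ (here (sym e)))
                                      (λ e → t∉ (here (sym e))) (λ e → o∉ (there (here (sym e)))) (λ e → t∉ (there (here e)))
          opposite {a} {b} {c} {x} {y} ab ac bc x≢y ha hb ha′ hb′ | xs , ux , fx , lx | ys , uy , fy , ly | zs , uz , fz , lz | z , hz | z′ , hz′ | no y∉
            with avoid uy (x ∷ []) (≤-trans (s≤s (s≤s z≤n)) ly)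
          ... | t , t∈ , t∉ with avoid uz (z′ ∷ t ∷ []) lz
          ... | o , o∈ , o∉ with avoid ux (t ∷ o ∷ []) lx
          ... | r , r∈ , r∉ = finish ab ac bc ha′ hb′ hz′ (fx r∈) (fy t∈) (fz o∈) (λ e → y∉ (subst (_∈ xs) (sym e) r∈)) (λ e → t∉ (here (sym e))) (λ e → o∉ (here (sym e)))
                                (λ e → r∉ (here e)) (λ e → r∉ (there (here e))) (λ e → o∉ (there (here (sym e))))
          pinned : ∀ a {x} → E a true x → x ≡ g (q a)
          pinned a {x} h = decidable-stable (x ≟ g (q a)) λ ne → flexible a true (x , g (q a) , ne , h , g∈E a)
          tight-case : Typed (E i) → Typed (E j) → ⊥
          tight-case (inj₁ (s , t)) _ = flexible i s t
          tight-case (inj₂ _) (inj₁ (s , t)) = flexible j s t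
          tight-case (inj₂ (inj₁ (h , _))) (inj₂ (inj₁ (h′ , _))) = gij (trans (sym (pinned i h)) (pinned j h′))
          tight-case (inj₂ (inj₂ (h , _))) (inj₂ (inj₂ (h′ , _))) = gij (trans (sym (pinned i h)) (pinned j h′))
          tight-case (inj₂ (inj₁ (h₁ , h₂))) (inj₂ (inj₂ (h₁′ , h₂′))) = let k , ik , jk = third₃ i j in opposite ij ik jk distinct h₁ h₁′ h₂ h₂′
          tight-case (inj₂ (inj₂ (h₁ , h₂))) (inj₂ (inj₁ (h₁′ , h₂′))) = let k , ik , jk = third₃ i j in opposite ij ik jk (distinct ∘ sym) h₁ h₁′ h₂ h₂′

      Ends : End → Set
      Ends en = Triangle (End.K en) (End.p en) → ∃[ i ] ∃[ j ] (i ≢ j × g (End.q en i) ≢ g (End.q en j))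

      descend : ∀ {K p q} (tr : Trip K p q) → Colours K p q → end tr ≡ end T₀ → ⊥
      descend (stop st (inj₁ s)) C e = solve-single st C s
      descend (stop st (inj₂ t)) C e = solve-triangle st C t (subst Ends (sym e) g-end t)
      descend (abs {K} {p} {q} st i alone wK uw tr) C e = descend tr (Absorb.absorbed st C i alone wK uw u∉ q∉) e
        where
        open State st
        u∉ : p i ∉ End.K (end T₀)
        u∉ m = proj₂ (∈-∖⁻ (end-⊆ tr (subst (λ en → p i ∈ End.K en) (sym e) m))) refl
        q∉ : q i ∉ End.K (end T₀)
        q∉ m = done∉K (done i) (proj₁ (∈-∖⁻ (end-⊆ tr (subst (λ en → q i ∈ End.K en) (sym e) m))))

      solved : ⊥
      solved = descend T₀ initial refl

    -- A colouring avoiding the core, with different colours at the ends of two legs if the core is a triangle: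
    -- those ends are made adjacent by contracting two core vertices.
    ending : (en : End) → ∃[ g ] (Good (_∉ End.K en) g ×
      (Triangle (End.K en) (End.p en) → ∃[ i ] ∃[ j ] (i ≢ j × g (End.q en i) ≢ g (End.q en j))))
    ending record { K = K ; p = p ; q = q ; state = st ; core = inj₁ (x , only-x) } =
      let g , gg = colour (λ u → ¬? (u ∈F? K)) (p zero) (λ n → n (pK zero)) in
      g , gg , λ { (pp , _) → ⊥-elim (adj-≢ G (pp {# 0} {# 1} λ ()) (trans (only-x (pK (# 0))) (sym (only-x (pK (# 1)))))) }
      where open State st
    ending record { K = K ; p = p ; q = q ; state = st ; core = inj₂ (pp , _) } with Finₚ.any? (λ i → ¬? (q i Finₚ.≟ v))
    ... | no none = ⊥-elim (Tetrahedron.impossible U (record { v = v ; deg-v = deg-v ; x = p ; xx = pp ; low = λ i → low (K⊆ (pK i))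
            ; vx = λ i → subst (λ t → Adj G t (p i)) (decidable-stable (q i Finₚ.≟ v) λ ne → none (i , ne)) (qp i) }))
      where open State st
    ... | yes (i , q≢v) with third₃ i i
    ...   | j , ij , _ = joined
      where
      open State st
      q≢p : ∀ a b → q a ≢ p b
      q≢p a b e = done∉K (done a) (subst (_∈ K) (sym e) (pK b))
      joined : ∃[ g ] (Good (_∉ K) g × (Triangle K p → ∃[ i ] ∃[ j ] (i ≢ j × g (q i) ≢ g (q j))))
      joined =
        let G₁ , pl₁ , e₁ , keep₁ = smooth {G = G} planarG (qp i) (pp ij) (q≢p i j)
            -- The two ends are distinct: a common end would be v by `tails`.
            G₂ , pl₂ , e₂ , keep₂ = smooth {G = G₁} pl₁ e₁ (keep₁ (adj-≢ G (pp ij) ∘ sym) (q≢p j i) (flipAdj G (qp j))) (λ e → q≢v (tails ij e))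
        in colour-in G₂ pl₂ e₂ λ u∉ w∉ a → keep₂ (λ { refl → u∉ (pK j) }) (λ { refl → w∉ (pK j) }) (keep₁ (λ { refl → u∉ (pK i) }) (λ { refl → w∉ (pK i) }) a)
        where
        colour-in : (G₂ : Graph n) → Planar G₂ → Adj G₂ (q i) (q j) → (∀ {u w} → u ∉ K → w ∉ K → Adj G u w → Adj G₂ u w) →
          ∃[ g ] (Good (_∉ K) g × (Triangle K p → ∃[ i ] ∃[ j ] (i ≢ j × g (q i) ≢ g (q j))))
        colour-in G₂ pl₂ e₂ keep =
          let g , i∈ , g≢ = small (mkGraph P? sy ir) (sub pl₂ (proj₁ ∘ P⁻)) (p i) (λ w a → proj₁ (proj₂ (P⁻ a)) (pK i)) L hL
          in g , ((λ u _ → i∈ u) , λ u w u∉ w∉ a → g≢ u w (P⁺ (keep u∉ w∉ a , u∉ , w∉))) ,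
             λ _ → i , j , ij , g≢ (q i) (q j) (P⁺ (e₂ , done∉K (done i) , done∉K (done j)))
          where
          P : V → V → Set
          P x y = Adj G₂ x y × x ∉ K × y ∉ K
          P? : ∀ x y → Dec (P x y)
          P? x y = adj? G₂ x y ×-dec (¬? (x ∈F? K) ×-dec ¬? (y ∈F? K))
          sy : ∀ {x y} → P x y → P y x
          sy (a , b , c) = flipAdj G₂ a , c , b
          ir : ∀ {x} → ¬ P x x
          ir (a , _) = adj-≢ G₂ a refl
          P⁻ : ∀ {x y} → Adj (mkGraph P? sy ir) x y → P x y
          P⁻ = mkGraph⁻ P? sy ir
          P⁺ : ∀ {x y} → P x y → Adj (mkGraph P? sy ir) x y
          P⁺ = mkGraph⁺ P? sy ir

    impossible : ⊥
    impossible = let g , gg , ge = ending (end trip) in Solve.solved (record { T₀ = trip ; g = g ; g-good = gg ; g-end = ge })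

  LowPath : V → V → Set
  LowPath = Path G (λ u → Low G u × u ≢ v)

  record Ported (K : List V) : Set where
    field
      p : Fin 3 → V
      p-inj : ∀ {i j} → p i ≡ p j → i ≡ j
      pK : ∀ i → p i ∈ K
      vp : ∀ i → Adj G v (p i)

  minimise : ∀ fuel {K} → length K ≤ fuel → Connected G K → (∀ {u} → u ∈ K → Low G u × u ≢ v) → Ported K → ⊥
  minimise fuel {K} le cK inK P = em {∃[ u ] (u ∈ K × Connected G (K ∖ u) × Ported (K ∖ u))} λ
    { (yes (u , uK , c , P′)) → smaller fuel le u uK c P′
    ; (no minimal) → Legs.impossible (record { K₀ = K ; low = proj₁ ∘ inK ; v∉K₀ = λ i → proj₂ (inK i) refl ; p₀ = p ; p₀-inj = p-inj ; p₀K = pK ; vp₀ = vp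
        ; cK₀ = cK ; ports₀ = ports minimal ; v-only = v-only minimal }) }
    where
    open Ported P
    smaller : ∀ fuel → length K ≤ fuel → ∀ u → u ∈ K → Connected G (K ∖ u) → Ported (K ∖ u) → ⊥
    smaller zero le u uK c P′ with () ← ≤-trans (length-∖ uK) le
    smaller (suc fuel) le u uK c P′ = minimise fuel (≤-pred (≤-trans (length-∖ uK) le)) c (inK ∘ proj₁ ∘ ∈-∖⁻) P′
    Minimal : Set
    Minimal = ¬ (∃[ u ] (u ∈ K × Connected G (K ∖ u) × Ported (K ∖ u)))
    ports : Minimal → ∀ {u} → u ∈ K → Connected G (K ∖ u) → ∃[ i ] u ≡ p i
    ports minimal {u} uK c with Finₚ.any? (λ i → u Finₚ.≟ p i)
    ... | yes e = e
    ... | no none = ⊥-elim (minimal (u , uK , c , record { p = p ; p-inj = p-inj ; pK = λ i → ∈-∖⁺ (pK i) (λ e → none (i , sym e)) ; vp = vp }))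
    -- A further neighbour of v could replace a port that is not a cut vertex, and that port could
    -- then be dropped.
    v-only : Minimal → ∀ {u} → u ∈ K → Adj G v u → ∃[ i ] u ≡ p i
    v-only minimal {u} uK vu with Finₚ.any? (λ i → u Finₚ.≟ p i)
    ... | yes e = e
    ... | no none with noncut G cK (pK (# 0)) (pK (# 1)) (λ e → case p-inj e of λ ())
    ...   | z , zK , _ , c with ports minimal zK c
    ...     | i , refl = ⊥-elim (minimal (p i , zK , c , record { p = upd p i u ; p-inj = inj ; pK = inK′ ; vp = vp′ }))
      where
      fresh : ∀ j → p j ≢ u
      fresh j e = none (j , sym e)
      inj : ∀ {j k} → upd p i u j ≡ upd p i u k → j ≡ k
      inj {j} {k} e with upd-case p i u j | upd-case p i u k
      ... | inj₁ (a , _) | inj₁ (b , _) = trans a (sym b)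
      ... | inj₂ (_ , x) | inj₂ (_ , y) = p-inj (trans (sym x) (trans e y))
      ... | inj₁ (_ , x) | inj₂ (_ , y) = contradiction (trans (sym y) (trans (sym e) x)) (fresh k)
      ... | inj₂ (_ , x) | inj₁ (_ , y) = contradiction (trans (sym x) (trans e y)) (fresh j)
      inK′ : ∀ j → upd p i u j ∈ K ∖ p i
      inK′ j with upd-case p i u j
      ... | inj₁ (_ , x) = subst (_∈ K ∖ p i) (sym x) (∈-∖⁺ uK (fresh i ∘ sym))
      ... | inj₂ (j≢i , x) = subst (_∈ K ∖ p i) (sym x) (∈-∖⁺ (pK j) (j≢i ∘ p-inj))
      vp′ : ∀ j → Adj G v (upd p i u j)
      vp′ j with upd-case p i u j
      ... | inj₁ (_ , x) = subst (Adj G v) (sym x) vu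
      ... | inj₂ (_ , x) = subst (Adj G v) (sym x) (vp j)

  reachable-set : ∀ a → ¬ ¬ (Σ[ K ∈ List V ] (Connected G K × (∀ {u} → u ∈ K → LowPath a u) × (∀ {u} → LowPath a u → u ∈ K)))
  reachable-set a k = dec-all {P = LowPath a} λ d? → k (K d? , conn d? , out d? , into d?)
    where
    module _ (d? : ∀ u → Dec (LowPath a u)) where
      K : List V
      K = filter d? (allFin n)
      out : ∀ {u} → u ∈ K → LowPath a u
      out i = proj₂ (∈-filter⁻ d? {xs = allFin n} i)
      into : ∀ {u} → LowPath a u → u ∈ K
      into {u} = ∈-filter⁺ d? (∈-allFin u)
      inside : ∀ {x y} → LowPath a x → LowPath x y → Path G (_∈ K) x y
      inside p (stop q) = stop (into p)
      inside p (move q e r) = move (into p) e (inside (path-trans p (move q e (stop (path-start r)))) r)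
      conn : Connected G K
      conn i j = inside (out i) (path-trans (path-sym (out i)) (out j))

  no-three : (p : Fin 3 → V) → (∀ {i j} → p i ≡ p j → i ≡ j) → (∀ i → Adj G v (p i)) → ¬ (∀ i → LowPath (p zero) (p i))
  no-three p p-inj vp r = reachable-set (p zero) λ { (K , c , out , into) →
    minimise (length K) ≤-refl c (path-end ∘ out) (record { p = p ; p-inj = p-inj ; pK = into ∘ r ; vp = vp }) }

-- Cut vertices

record Cut {n : ℕ} (U : BadLists n) : Set where
  open BadLists U
  field
    v      : Fin n
    deg-v  : degree G v ≤ 5
    a₁ a₂  : Fin n
    b      : Fin 3 → Fin n
    va₁    : Adj G v a₁
    va₂    : Adj G v a₂
    vb     : ∀ i → Adj G v (b i)
    b-inj  : ∀ {i j} → b i ≡ b j → i ≡ j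
    nbrs-v : ∀ {w} → Adj G v w → w ≡ a₁ ⊎ w ≡ a₂ ⊎ ∃[ i ] w ≡ b i
    apart₁ : ∀ i → ¬ Path G (_≢ v) (b i) a₁
    apart₂ : ∀ i → ¬ Path G (_≢ v) (b i) a₂

module CutVertex {n : ℕ} (U : BadLists n) (C : Cut U) where

  open Uncolourable U
  open Cut C
  open Tripod U v deg-v using (LowPath; reachable-set; no-three)

  -- B is the union of the components of G - v that meet the b i. Hence `¬ A` is B with v, and `¬ B`
  -- is A with v.
  B A : V → Set
  B u = ∃[ i ] Path G (_≢ v) (b i) u
  A u = u ≢ v × ¬ B u

  v∉B : ¬ B v
  v∉B (_ , r) = path-end r refl

  bB : ∀ i → B (b i)
  bB i = i , stop (adj-≢ G (vb i) ∘ sym)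

  a₁A : A a₁
  a₁A = adj-≢ G va₁ ∘ sym , λ { (i , r) → apart₁ i r }

  a₂A : A a₂
  a₂A = adj-≢ G va₂ ∘ sym , λ { (i , r) → apart₂ i r }

  closedB : ∀ {u w} → B u → w ≢ v → Adj G u w → B w
  closedB (i , r) ne e = i , path-trans r (move (path-end r) e (stop ne))

  module _ (B? : ∀ u → Dec (B u)) where

    A? : ∀ u → Dec (A u)
    A? u = ¬? (u Finₚ.≟ v) ×-dec ¬? (B? u)

    ¬A? : ∀ u → Dec (¬ A u)
    ¬A? u = ¬? (A? u)

    ¬B? : ∀ u → Dec (¬ B u)
    ¬B? u = ¬? (B? u)

    meets : ∀ {α β} → Good A α → Good (¬_ ∘ A) β → β v ≡ α a₁ ⊎ β v ≡ α a₂
    meets {α} {β} gA gB with β v ≟ α a₁ | β v ≟ α a₂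
    ... | yes e | _ = inj₁ e
    ... | no _ | yes e = inj₂ e
    ... | no p | no q = ⊥-elim (not-all-good ((λ u _ → case A? u of λ { (yes h) → iA u h ; (no h) → iB u h }) , λ u w _ _ → proper u w))
      where
      γ : V → ℕ
      γ = mix A? α β
      gs = mix-good A? (λ _ h → h) gA gB
      iA = proj₁ (proj₁ gs)
      pA = proj₂ (proj₁ gs)
      iB = proj₁ (proj₂ gs)
      pB = proj₂ (proj₂ gs)
      γv : γ v ≡ β v
      γv = mix-no A? λ h → proj₁ h refl
      at-v : ∀ {u} → A u → Adj G u v → γ u ≢ γ v
      at-v hu e r = case nbrs-v (flipAdj G e) of λ
        { (inj₁ refl) → p (trans (sym γv) (trans (sym r) (mix-yes A? hu)))
        ; (inj₂ (inj₁ refl)) → q (trans (sym γv) (trans (sym r) (mix-yes A? hu)))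
        ; (inj₂ (inj₂ (i , refl))) → proj₂ hu (bB i) }
      cross : ∀ {u w} → A u → ¬ A w → Adj G u w → γ u ≢ γ w
      cross {u} {w} hu hw e = case w Finₚ.≟ v of λ
        { (no w≢v) → contradiction (w≢v , λ Bw → proj₂ hu (closedB Bw (proj₁ hu) (flipAdj G e))) hw
        ; (yes refl) → at-v hu e }
      proper : ∀ u w → Adj G u w → γ u ≢ γ w
      proper u w e = case A? u of λ
        { (yes hu) → case A? w of λ { (yes hw) → pA u w hu hw e ; (no hw) → cross hu hw e }
        ; (no hu) → case A? w of λ { (yes hw) → λ r → cross hw hu (flipAdj G e) (sym r) ; (no hw) → pB u w hu hw e } }

    α₀ : ∃[ α ] Good A α
    α₀ = colour A? v (λ h → proj₁ h refl)

    β₀ : ∃[ β ] Good (¬_ ∘ A) β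
    β₀ = colour ¬A? a₁ (λ h → h a₁A)

    s : ℕ
    s = proj₁ β₀ v

    -- If v had two colours on the side of B, then by `meets` both would occur on a₁ and a₂ in every
    -- colouring of A, and v could take no others. Two colours on each side are too few for `Glue`.
    v-colour : ∀ {β} → Good (¬_ ∘ A) β → β v ≡ s
    v-colour {β} gB = decidable-stable (β v ≟ s) λ ne →
      Glue.glue {G⁺ = G} planarG {A} {¬_ ∘ A} {λ _ → ⊥} A? ¬A? none? (λ h k → k h) {a₁} {v} a₁A (λ h → proj₁ h refl) (flipAdj G va₁)
        (λ _ _ → id) (λ _ _ → id) (λ ()) (s ∷ β v ∷ []) (s ∷ β v ∷ []) (s≤s (s≤s (s≤s (s≤s z≤n))))
        λ γ gA gB′ _ → in-a ne gA , in-v ne gB′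
      where
      in-a : β v ≢ s → ∀ {γ} → Good A γ → γ a₁ ∈ s ∷ β v ∷ []
      in-a ne gA with meets gA (proj₂ β₀) | meets gA gB
      ... | inj₁ e | _ = here (sym e)
      ... | inj₂ _ | inj₁ e = there (here (sym e))
      ... | inj₂ e | inj₂ e′ = contradiction (trans e′ (sym e)) ne
      in-v : β v ≢ s → ∀ {γ} → Good (¬_ ∘ A) γ → γ v ∈ s ∷ β v ∷ []
      in-v ne gB′ with meets (proj₂ α₀) gB′ | meets (proj₂ α₀) (proj₂ β₀) | meets (proj₂ α₀) gB
      ... | inj₁ e | inj₁ e₀ | _ = here (trans e (sym e₀))
      ... | inj₂ e | inj₂ e₀ | _ = here (trans e (sym e₀))
      ... | inj₁ e | inj₂ _ | inj₁ e₁ = there (here (trans e (sym e₁)))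
      ... | inj₂ e | inj₁ _ | inj₂ e₁ = there (here (trans e (sym e₁)))
      ... | inj₁ _ | inj₂ e₀ | inj₂ e₁ = contradiction (trans e₁ (sym e₀)) ne
      ... | inj₂ _ | inj₁ e₀ | inj₁ e₁ = contradiction (trans e₁ (sym e₀)) ne

    s∈L : s ∈ L v
    s∈L = proj₁ (proj₂ β₀) v λ h → proj₁ h refl

    R : List ℕ
    R = filter (λ t → ¬? (t ≟ s)) (L v)

    ∈R⁺ : ∀ {t} → t ∈ L v → t ≢ s → t ∈ R
    ∈R⁺ = ∈-filter⁺ (λ t → ¬? (t ≟ s))

    ∈R⁻ : ∀ {t} → t ∈ R → t ∈ L v × t ≢ s
    ∈R⁻ = ∈-filter⁻ (λ t → ¬? (t ≟ s)) {xs = L v}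

    R-unique : Unique R
    R-unique = Uniqueₚ.filter⁺ (λ t → ¬? (t ≟ s)) (proj₂ (hL v))

    3≤R : 3 ≤ length R
    3≤R = ≤-pred (subst (_≤ suc (length R)) (proj₁ (hL v)) (length-⊆ {ys = s ∷ R} (proj₂ (hL v)) λ {t} t∈ →
      case t ≟ s of λ { (yes e) → here e ; (no ne) → there (∈R⁺ t∈ ne) }))

    R≤3 : length R ≤ 3
    R≤3 = ≤-pred (subst (length (s ∷ R) ≤_) (proj₁ (hL v)) (length-⊆ {xs = s ∷ R} {L v}
      (All.tabulate (λ i e → proj₂ (∈R⁻ i) (sym e)) ∷ R-unique) λ { (here refl) → s∈L ; (there i) → proj₁ (∈R⁻ i) }))

    -- If v had the colour s on the side of A, `meets` would give s to its neighbour a₁ or a₂. Three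
    -- colours remain for v there.
    v-other : ∀ {η} → Good (¬_ ∘ B) η → η v ∈ R
    v-other {η} g = ∈R⁺ (proj₁ g v v∉B) λ e → case meets (good-⊆ (λ u → proj₂) g) (proj₂ β₀) of λ
      { (inj₁ r) → proj₂ g v a₁ v∉B (proj₂ a₁A) va₁ (trans e r)
      ; (inj₂ r) → proj₂ g v a₂ v∉B (proj₂ a₂A) va₂ (trans e r) }

    record Link : Set where
      field
        K    : List V
        cK   : Connected G K
        inK  : ∀ {u} → u ∈ K → Low G u × u ≢ v
        b₀K  : b (# 0) ∈ K
        b₁K  : b (# 1) ∈ K
        ends : ∀ {u} → u ∈ K → Connected G (K ∖ u) → u ≡ b (# 0) ⊎ u ≡ b (# 1)

    module Linked (LK : Link) where

      open Link LK

      b₀ b₂ : V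
      b₀ = b (# 0)
      b₂ = b (# 2)

      b₀≢b₁ : b₀ ≢ b (# 1)
      b₀≢b₁ e = case b-inj e of λ ()

      b₂∉K : b₂ ∉ K
      b₂∉K b₂K = no-three b b-inj vb λ
        { zero → path-map inK (cK b₀K b₀K) ; (suc zero) → path-map inK (cK b₀K b₁K) ; (suc (suc zero)) → path-map inK (cK b₀K b₂K) }

      cut₀ : Connected G (K ∖ b₀)
      cut₀ with noncut G cK b₁K b₀K b₀≢b₁
      ... | u , uK , u≢b₁ , c with ends uK c
      ...   | inj₁ refl = c
      ...   | inj₂ e = contradiction e u≢b₁

      neither : ∀ {r} → r ∈ K → r ≢ b₀ → r ≢ b (# 1) → ¬ Connected G (K ∖ r)
      neither rK p q c = case ends rK c of λ { (inj₁ e) → p e ; (inj₂ e) → q e }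

      abstract
        -- With two neighbours, b₀ would stay attached after the removal of any other vertex. A
        -- non-cut vertex of K without b₀, chosen different from b₁, would then be one of K, against
        -- `ends`.
        next : ∃[ w ] (w ∈ K × Adj G b₀ w × (∀ {t} → t ∈ K → Adj G b₀ t → t ≡ w))
        next with neighbour G (cK b₀K b₁K) b₀≢b₁
        ... | w , wK , e = w , wK , e , λ {t} tK e′ → decidable-stable (t Finₚ.≟ w) (two-nbrs tK e′)
          where
          two-nbrs : ∀ {t} → t ∈ K → Adj G b₀ t → t ≢ w → ⊥
          two-nbrs {t} tK e′ t≢w with other (b (# 1))
            where
            other : ∀ y → ∃[ z ] (z ∈ K × Adj G b₀ z × z ≢ y)
            other y with t Finₚ.≟ y
            ... | yes refl = w , wK , e , t≢w ∘ sym
            ... | no t≢y = t , tK , e′ , t≢y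
          ... | y , yK , ey , y≢ with noncut G cut₀ (∈-∖⁺ b₁K (b₀≢b₁ ∘ sym)) (∈-∖⁺ yK (adj-≢ G ey ∘ sym)) y≢
          ... | r , rK′ , r≢b₁ , c with ∈-∖⁻ rK′ | t Finₚ.≟ r
          ... | rK , r≢b₀ | yes refl = neither rK r≢b₀ r≢b₁ (connected-reinsert G b₀K (r≢b₀ ∘ sym) wK (t≢w ∘ sym) e c)
          ... | rK , r≢b₀ | no t≢r = neither rK r≢b₀ r≢b₁ (connected-reinsert G b₀K (r≢b₀ ∘ sym) tK t≢r e′ c)

      w : V
      w = proj₁ next

      wK : w ∈ K
      wK = proj₁ (proj₂ next)

      b₀w : Adj G b₀ w
      b₀w = proj₁ (proj₂ (proj₂ next))

      w-only : ∀ {t} → t ∈ K → Adj G b₀ t → t ≡ w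
      w-only = proj₂ (proj₂ (proj₂ next))

      X : V → Set
      X u = B u × u ∉ K

      X? : ∀ u → Dec (X u)
      X? u = B? u ×-dec ¬? (u ∈F? K)

      Xb₂ : X b₂
      Xb₂ = bB (# 2) , b₂∉K

      ¬Xv : ¬ X v
      ¬Xv x = v∉B (proj₁ x)

      v-nbr-X : ∀ {u} → X u → Adj G v u → u ≡ b₂
      v-nbr-X (Bu , u∉) e with nbrs-v e
      ... | inj₁ refl = contradiction Bu (proj₂ a₁A)
      ... | inj₂ (inj₁ refl) = contradiction Bu (proj₂ a₂A)
      ... | inj₂ (inj₂ (zero , refl)) = contradiction b₀K u∉
      ... | inj₂ (inj₂ (suc zero , refl)) = contradiction b₁K u∉
      ... | inj₂ (inj₂ (suc (suc zero) , refl)) = refl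

      module _ {γ : V → ℕ} (g : Good X γ) where

        options : ∃[ xs ] (Unique xs × (∀ {t} → t ∈ xs → Free X γ b₀ t) × (∀ {t} → Free X γ b₀ t → t ∈ xs) × 2 ≤ length xs)
        options = free-low X? γ (proj₁ (inK b₀K)) (v ∷ w ∷ []) (((λ e → proj₂ (inK wK) (sym e)) ∷ []) ∷ [] ∷ [])
          (λ { (here refl) → flipAdj G (vb (# 0)) , ¬Xv ; (there (here refl)) → b₀w , (λ x → proj₂ x wK) })

        fs : List ℕ
        fs = proj₁ options

        fs-unique : Unique fs
        fs-unique = proj₁ (proj₂ options)

        fs-free : ∀ {t} → t ∈ fs → Free X γ b₀ t
        fs-free = proj₁ (proj₂ (proj₂ options))

        -- With v coloured x, all of K except b₀ is coloured greedily; a colour for b₀ would contradict v-colour.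
        blocked : ∀ {x} → x ∈ R → x ≢ γ b₂ → ∃[ y ] (∀ {t} → t ∈ fs → t ≡ x ⊎ t ≡ y)
        blocked {x} x∈R x≢ with greedy (length K) ≤-refl cK (proj₁ ∘ inK) b₀K (λ u → (u Finₚ.≟ v) ⊎-dec X? u)
            (λ { uK (inj₁ e) → proj₂ (inK uK) e ; uK (inj₂ h) → proj₂ h uK })
            (extend ¬Xv g (proj₁ (∈R⁻ x∈R) , λ u h e r → x≢ (trans (sym r) (cong γ (v-nbr-X h e)))))
        ... | c , gc , same = c w , one-of
          where
          c-v : c v ≡ x
          c-v = trans (same v (inj₁ refl)) (upd-at γ v x)
          c-X : ∀ {u} → X u → c u ≡ γ u
          c-X h = trans (same _ (inj₂ h)) (upd-off γ λ { refl → ¬Xv h })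
          one-of : ∀ {t} → t ∈ fs → t ≡ x ⊎ t ≡ c w
          one-of {t} t∈ with t ≟ x | t ≟ c w
          ... | yes e | _ = inj₁ e
          ... | no _ | yes e = inj₂ e
          ... | no t≢x | no t≢w = ⊥-elim (proj₂ (∈R⁻ x∈R) (trans (sym (trans (upd-off c (adj-≢ G (vb (# 0)))) c-v)) (v-colour (good-⊆ into full))))
            where
            full = extend {u = b₀} {x = t} (λ { (inj₁ (inj₁ e)) → proj₂ (inK b₀K) e ; (inj₁ (inj₂ h)) → proj₂ h b₀K ; (inj₂ (_ , ne)) → ne refl }) gc
              (proj₁ (fs-free t∈) , λ
                { u (inj₁ (inj₁ refl)) e r → t≢x (trans (sym r) c-v)
                ; u (inj₁ (inj₂ h)) e r → proj₂ (fs-free t∈) u h e (trans (sym (c-X h)) r)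
                ; u (inj₂ (uK , _)) e r → t≢w (trans (sym r) (cong c (w-only uK e))) })
            into : ∀ u → ¬ A u → u ≡ b₀ ⊎ ((u ≡ v ⊎ X u) ⊎ (u ∈ K × u ≢ b₀))
            into u nA with u Finₚ.≟ b₀ | u Finₚ.≟ v | u ∈F? K | B? u
            ... | yes e | _ | _ | _ = inj₁ e
            ... | no _ | yes e | _ | _ = inj₂ (inj₁ (inj₁ e))
            ... | no ne | no _ | yes uK | _ = inj₂ (inj₂ (uK , ne))
            ... | no _ | no _ | no u∉ | yes Bu = inj₂ (inj₁ (inj₂ (Bu , u∉)))
            ... | no _ | no u≢v | no _ | no ¬Bu = contradiction (u≢v , ¬Bu) nA

        fs≤2 : length fs ≤ 2
        fs≤2 = let x , x∈ , x∉ = avoid R-unique (γ b₂ ∷ []) (≤-trans (s≤s (s≤s z≤n)) 3≤R)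
                   y , h = blocked x∈ (λ e → x∉ (here e))
               in length-⊆ {ys = x ∷ y ∷ []} fs-unique λ t∈ → case h t∈ of λ { (inj₁ e) → here e ; (inj₂ e) → there (here e) }

        -- `blocked` confines the free colours of b₀, at least two, to x and one more, so x is among
        -- them. By cardinality the free colours are exactly those of R other than γ b₂.
        rest∈fs : ∀ {x} → x ∈ R → x ≢ γ b₂ → x ∈ fs
        rest∈fs {x} x∈ x≢ = decidable-stable (x ∈ℕ? fs) λ x∉ →
          let y , h = blocked x∈ x≢
              t , t∈ , t∉ = avoid fs-unique (y ∷ []) (proj₂ (proj₂ (proj₂ (proj₂ options))))
          in case h t∈ of λ { (inj₁ e) → x∉ (subst (_∈ fs) e t∈) ; (inj₂ e) → t∉ (here e) }

        not-R⊆fs : ¬ (∀ {x} → x ∈ R → x ∈ fs)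
        not-R⊆fs h = <⇒≱ (s≤s fs≤2) (≤-trans 3≤R (length-⊆ R-unique h))

        b₂∈R : γ b₂ ∈ R
        b₂∈R = decidable-stable (γ b₂ ∈ℕ? R) λ n → not-R⊆fs λ x∈ → rest∈fs x∈ λ { refl → n x∈ }

        abstract
          used : ∀ {t} → t ∈ L b₀ → t ∉ fs → ∃[ u ] (X u × Adj G b₀ u × γ u ≡ t)
          used {t} t∈ t∉ with Finₚ.any? (λ u → X? u ×-dec (adj? G b₀ u ×-dec (γ u ≟ t)))
          ... | yes r = r
          ... | no none = contradiction (proj₁ (proj₂ (proj₂ (proj₂ options))) (t∈ , λ u h e r → none (u , h , e , r))) t∉

      γ₀ : ∃[ γ ] Good X γ
      γ₀ = colour X? v ¬Xv

      γ : V → ℕ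
      γ = proj₁ γ₀

      g : Good X γ
      g = proj₂ γ₀

      v∉X : ∀ {u} → X u → ¬ ¬ B u
      v∉X h k = k (proj₁ h)

      -- One colour at b₂ and three at v make only four for the edge v b₂.
      fixed : (∀ {γ′} → Good X γ′ → γ′ b₂ ≡ γ b₂) → ⊥
      fixed h = Glue.glue {G⁺ = G} planarG {X} {¬_ ∘ B} {λ _ → ⊥} X? ¬B? none? v∉X {b₂} {v} Xb₂ v∉B (flipAdj G (vb (# 2)))
        (λ _ _ → id) (λ _ _ → id) (λ ()) (γ b₂ ∷ []) R (s≤s R≤3) λ _ gX gB _ → here (h gX) , v-other gB

      module Moving {γ₁ : V → ℕ} (g₁ : Good X γ₁) (moved : γ₁ b₂ ≢ γ b₂) where

        -- Each colour of R is free at b₀ in one of two colourings that differ at b₂.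
        R⊆L : ∀ {t} → t ∈ R → t ∈ L b₀
        R⊆L {t} t∈ with t ≟ γ b₂
        ... | no ne = proj₁ (fs-free g (rest∈fs g t∈ ne))
        ... | yes refl = proj₁ (fs-free g₁ (rest∈fs g₁ t∈ (moved ∘ sym)))

        fourth : ∃[ z ] (z ∈ L b₀ × z ∉ R)
        fourth = avoid (proj₂ (hL b₀)) R (subst (length R <_) (sym (proj₁ (hL b₀))) (s≤s R≤3))

        z : ℕ
        z = proj₁ fourth

        z∉R : z ∉ R
        z∉R = proj₂ (proj₂ fourth)

        module _ {γ′ : V → ℕ} (g′ : Good X γ′) where

          -- Two colours of R are free already, and `fs≤2` allows no third.
          z∉fs : z ∉ fs g′
          z∉fs z∈ = <⇒≱ (s≤s (fs≤2 g′)) (≤-trans (s≤s two-left) (length-⊆ {xs = z ∷ others} {fs g′}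
              (All.tabulate (λ i e → z∉R (subst (_∈ R) (sym e) (proj₁ (∈others i)))) ∷ Uniqueₚ.filter⁺ other? R-unique)
              λ { (here refl) → z∈ ; (there i) → let x∈ , x≢ = ∈others i in rest∈fs g′ x∈ x≢ }))
            where
            other? : ∀ t → Dec (t ≢ γ′ b₂)
            other? t = ¬? (t ≟ γ′ b₂)
            others : List ℕ
            others = filter other? R
            ∈others : ∀ {t} → t ∈ others → t ∈ R × t ≢ γ′ b₂
            ∈others = ∈-filter⁻ other? {xs = R}
            two-left : 2 ≤ length others
            two-left = ≤-pred (≤-trans 3≤R (length-⊆ {ys = γ′ b₂ ∷ others} R-unique λ {t} t∈ →
              case t ≟ γ′ b₂ of λ { (yes e) → here e ; (no ne) → there (∈-filter⁺ other? t∈ ne) }))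

          b₂∉fs : γ′ b₂ ∉ fs g′
          b₂∉fs i = not-R⊆fs g′ λ {x} x∈ → case x ≟ γ′ b₂ of λ { (yes e) → subst (_∈ fs g′) (sym e) i ; (no ne) → rest∈fs g′ x∈ ne }

          z-used : ∃[ u ] (X u × Adj G b₀ u × γ′ u ≡ z)
          z-used = used g′ (proj₁ (proj₂ fourth)) z∉fs

          b₂-used : ∃[ u ] (X u × Adj G b₀ u × γ′ u ≡ γ′ b₂)
          b₂-used = used g′ (R⊆L (b₂∈R g′)) b₂∉fs

        module Placed {u₁ u₂ : V} (Xu₁ : X u₁) (b₀u₁ : Adj G b₀ u₁) (γu₁ : γ u₁ ≡ z)
          (Xu₂ : X u₂) (b₀u₂ : Adj G b₀ u₂) (γu₂ : γ u₂ ≡ γ b₂) where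

          u₁≢u₂ : u₁ ≢ u₂
          u₁≢u₂ e = z∉R (subst (_∈ R) (trans (sym γu₂) (trans (cong γ (sym e)) γu₁)) (b₂∈R g))

          u₁≢b₂ : u₁ ≢ b₂
          u₁≢b₂ e = z∉R (subst (_∈ R) (trans (cong γ (sym e)) γu₁) (b₂∈R g))

          X≢v : ∀ {u} → X u → u ≢ v
          X≢v h refl = ¬Xv h

          X≢w : ∀ {u} → X u → u ≢ w
          X≢w h e = proj₂ h (subst (_∈ K) (sym e) wK)

          outer : ∀ {u} → X u → Adj G b₀ u → u ≡ u₁ ⊎ u ≡ u₂
          outer {u} h e = case u Finₚ.≟ u₁ of λ
            { (yes p) → inj₁ p
            ; (no p) → case u Finₚ.≟ u₂ of λ
                { (yes q) → inj₂ q
                ; (no q) → contradiction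
                    (low-nbrs {G = G} (proj₁ (inK b₀K)) {u ∷ u₁ ∷ u₂ ∷ v ∷ w ∷ []}
                      ((p ∷ q ∷ X≢v h ∷ X≢w h ∷ []) ∷ (u₁≢u₂ ∷ X≢v Xu₁ ∷ X≢w Xu₁ ∷ []) ∷ (X≢v Xu₂ ∷ X≢w Xu₂ ∷ []) ∷ ((λ r → proj₂ (inK wK) (sym r)) ∷ []) ∷ [] ∷ [])
                      (e ∷ b₀u₁ ∷ b₀u₂ ∷ flipAdj G (vb (# 0)) ∷ b₀w ∷ []))
                    1+n≰n } }

          -- Both z and the colour of b₂ are blocked at b₀, hence occur on its neighbours in X. The
          -- degree of b₀ leaves only u₁ and u₂ for them.
          forced : ∀ {γ′} → Good X γ′ → γ′ u₁ ≢ γ′ b₂ → γ′ u₁ ≡ z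
          forced {γ′} g′ ne =
            let u , h , e , r = z-used g′
                u′ , h′ , e′ , r′ = b₂-used g′
            in case outer h e of λ
              { (inj₁ p) → trans (cong γ′ (sym p)) r
              ; (inj₂ p) → case outer h′ e′ of λ
                  { (inj₁ p′) → contradiction (trans (cong γ′ (sym p′)) r′) ne
                  ; (inj₂ p′) → contradiction (subst (_∈ R) (trans (sym r′) (trans (cong γ′ (trans p′ (sym p))) r)) (b₂∈R g′)) z∉R } }

          -- Contract along u₁, b₀, v and keep v b₂ as the extra edge of `Glue`. It makes u₁ avoid
          -- the colour of b₂, so that z alone remains at u₁ against three colours at v.
          joined : ⊥
          joined =
            let G⁺ , pl , e , keep = smooth {G = G} planarG (flipAdj G b₀u₁) (flipAdj G (vb (# 0))) (λ { refl → ¬Xv Xu₁ })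
            in Glue.glue {G⁺ = G⁺} pl {X} {¬_ ∘ B} {_≡ b₂} X? ¬B? (Finₚ._≟ b₂) v∉X {u₁} {v} Xu₁ v∉B e
                 (λ h h′ → keep (X≢b₀ h) (X≢b₀ h′)) (λ h h′ → keep (¬B≢b₀ h) (¬B≢b₀ h′))
                 (λ { refl → Xb₂ , u₁≢b₂ ∘ sym , keep (adj-≢ G (vb (# 0))) (X≢b₀ Xb₂) (vb (# 2)) })
                 (z ∷ []) R (s≤s R≤3) λ _ gX gB ex → here (forced gX (ex b₂ refl)) , v-other gB
            where
            X≢b₀ : ∀ {u} → X u → u ≢ b₀
            X≢b₀ h refl = proj₂ h b₀K
            ¬B≢b₀ : ∀ {u} → ¬ B u → u ≢ b₀
            ¬B≢b₀ h refl = h (bB (# 0))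

        contracted : ⊥
        contracted = let _ , h , e , r = z-used g ; _ , h′ , e′ , r′ = b₂-used g in Placed.joined h e r h′ e′ r′

      impossible : ⊥
      impossible = em {∃[ γ₁ ] (Good X γ₁ × γ₁ b₂ ≢ γ b₂)} λ
        { (yes (_ , g₁ , moved)) → Moving.contracted g₁ moved
        ; (no none) → fixed λ {γ′} g′ → decidable-stable (γ′ b₂ ≟ γ b₂) λ ne → none (γ′ , g′ , ne) }

    minimise : ∀ fuel {K} → length K ≤ fuel → Connected G K → (∀ {u} → u ∈ K → Low G u × u ≢ v) → b (# 0) ∈ K → b (# 1) ∈ K → ⊥
    minimise fuel {K} le cK inK b₀K b₁K = em {∃[ u ] (u ∈ K × Connected G (K ∖ u) × b (# 0) ≢ u × b (# 1) ≢ u)} λ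
      { (yes (u , uK , c , p , q)) → smaller fuel le u uK c p q
      ; (no minimal) → Linked.impossible (record { K = K ; cK = cK ; inK = inK ; b₀K = b₀K ; b₁K = b₁K ; ends = λ {u} uK c → case u Finₚ.≟ b (# 0) of λ
          { (yes e) → inj₁ e
          ; (no p) → case u Finₚ.≟ b (# 1) of λ { (yes e) → inj₂ e ; (no q) → ⊥-elim (minimal (u , uK , c , p ∘ sym , q ∘ sym)) } } }) }
      where
      smaller : ∀ fuel → length K ≤ fuel → ∀ u → u ∈ K → Connected G (K ∖ u) → b (# 0) ≢ u → b (# 1) ≢ u → ⊥
      smaller zero le u uK _ _ _ with () ← ≤-trans (length-∖ uK) le
      smaller (suc fuel) le u uK c p q =
        minimise fuel (≤-pred (≤-trans (length-∖ uK) le)) c (inK ∘ proj₁ ∘ ∈-∖⁻) (∈-∖⁺ b₀K p) (∈-∖⁺ b₁K q)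

  not-linked : ¬ LowPath (b (# 0)) (b (# 1))
  not-linked r = dec-all {P = B} λ B? → reachable-set (b (# 0)) λ { (K , c , out , into) →
    minimise B? (length K) ≤-refl c (path-end ∘ out) (into (stop (path-start r))) (into r) }

-- Faces

-- `¬ Choosable4 G` does not hand over bad lists. Deciding colourability by finite search allows the
-- refutation to assume them.
refute : ∀ {n} {G : Graph n} → MinimalNon4ChoosablePlanar G →
  (∀ L → (∀ v → length (L v) ≡ 4 × Unique (L v)) →
    ¬ (Σ[ c ∈ (Fin n → ℕ) ] ((∀ v → c v ∈ L v) × (∀ u w → Adj G u w → c u ≢ c w))) → ⊥) → ⊥
refute {n} {G} (_ , ¬ch , _) h = ¬ch λ L hL → case search L Proper proper? resp of λ { (yes c) → c ; (no unc) → ⊥-elim (h L hL unc) }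
  where
  Proper : (Fin n → ℕ) → Set
  Proper c = ∀ u w → Adj G u w → c u ≢ c w
  proper? : ∀ c → Dec (Proper c)
  proper? c = Finₚ.all? λ u → Finₚ.all? λ w → adj? G u w →-dec ¬? (c u ≟ c w)
  resp : ∀ {c c′} → (∀ v → c v ≡ c′ v) → Proper c → Proper c′
  resp e p u w a q = p u w a (trans (e u) (trans q (sym (e w))))

LowLink : (G : Graph n) → Fin n → Fin n → Fin n → Set
LowLink G v = Path G (λ u → Low G u × u ≢ v)

abstract

  bridgeless : {G : Graph n} → MinimalNon4ChoosablePlanar G → ∀ {v w} → Adj G v w →
    ¬ (∀ {t} → Adj G v t → t ≢ w → ¬ Path G (_≢ v) w t)
  bridgeless {G = G} min vw alone = refute min λ L hL unc → Uncolourable.no-bridge (record { min = min ; hL = hL ; unc = unc }) vw alone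

  low-links : {G : Graph n} → MinimalNon4ChoosablePlanar G → ∀ {v} → degree G v ≤ 5 →
    (p : Fin 3 → Fin n) → (∀ {i j} → p i ≡ p j → i ≡ j) → (∀ i → Adj G v (p i)) → ¬ (∀ i → LowLink G v (p zero) (p i))
  low-links {G = G} min {v} deg p inj vp r = refute min λ L hL unc → Tripod.no-three (record { min = min ; hL = hL ; unc = unc }) v deg p inj vp r

  cut-links : {G : Graph n} → MinimalNon4ChoosablePlanar G → ∀ {v} → degree G v ≤ 5 →
    (a₁ a₂ : Fin n) (b : Fin 3 → Fin n) → Adj G v a₁ → Adj G v a₂ → (∀ i → Adj G v (b i)) → (∀ {i j} → b i ≡ b j → i ≡ j) →
    (∀ {w} → Adj G v w → w ≡ a₁ ⊎ w ≡ a₂ ⊎ ∃[ i ] w ≡ b i) →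
    (∀ i → ¬ Path G (_≢ v) (b i) a₁) → (∀ i → ¬ Path G (_≢ v) (b i) a₂) → ¬ LowLink G v (b (# 0)) (b (# 1))
  cut-links {G = G} min {v} deg a₁ a₂ b va₁ va₂ vb inj nb ap₁ ap₂ r =
    refute min λ L hL unc → CutVertex.not-linked (record { min = min ; hL = hL ; unc = unc }) (record
      { deg-v = deg ; va₁ = va₁ ; va₂ = va₂ ; vb = vb ; b-inj = inj ; nbrs-v = nb ; apart₁ = ap₁ ; apart₂ = ap₂ }) r

triple : {A : Set} → A → A → A → Fin 3 → A
triple x y z zero = x
triple x y z (suc zero) = y
triple x y z (suc (suc zero)) = z

triple-inj : {A : Set} {x y z : A} → x ≢ y → x ≢ z → y ≢ z → ∀ {i j} → triple x y z i ≡ triple x y z j → i ≡ j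
triple-inj xy xz yz {zero} {zero} _ = refl
triple-inj xy xz yz {zero} {suc zero} e = contradiction e xy
triple-inj xy xz yz {zero} {suc (suc zero)} e = contradiction e xz
triple-inj xy xz yz {suc zero} {zero} e = contradiction (sym e) xy
triple-inj xy xz yz {suc zero} {suc zero} _ = refl
triple-inj xy xz yz {suc zero} {suc (suc zero)} e = contradiction e yz
triple-inj xy xz yz {suc (suc zero)} {zero} e = contradiction (sym e) xz
triple-inj xy xz yz {suc (suc zero)} {suc zero} e = contradiction (sym e) yz
triple-inj xy xz yz {suc (suc zero)} {suc (suc zero)} _ = refl

module Faces {n} {G : Graph n} (min : MinimalNon4ChoosablePlanar G) (R : Rotation G) (pl : IsPlane R) (v : Fin n) (deg : degree G v ≡ 5) where

  open Corners R v deg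

  φ : Dart G → Dart G
  φ = faceNext R

  SF : Dart G → Dart G → Set
  SF = SameFace R

  sf-sym : ∀ {d d′} → SF d d′ → SF d′ d
  sf-sym s = O⇒sameFace (E-sym (sameFace⇒O s))

  sf? : ∀ d d′ → Dec (SF d d′)
  sf? d d′ = map′ O⇒sameFace sameFace⇒O (E? φ φ d d′)

  onFace? : ∀ d x → Dec (OnFace R d x)
  onFace? d x = map′
    (λ { (d′ , e , o) → let k , q = O⇒iter φ₀-inj o in k , trans (cong tl q) e })
    (λ { (k , e) → iter φ k d , e , O-iter k d })
    (any-D λ d′ → (tl d′ Finₚ.≟ x) ×-dec E? φ φ d d′)

  -- Decidability turns the refutation of badness into the witnesses demanded by the conclusion.
  good? : ∀ d → Dec (FaceHasTwoBig R d)
  good? d = Finₚ.any? λ x → Finₚ.any? λ y →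
    ¬? (x Finₚ.≟ y) ×-dec (onFace? d x ×-dec (onFace? d y ×-dec ((5 ≤? degree G x) ×-dec (5 ≤? degree G y))))

  bad-resp : ∀ {d d′} → SF d d′ → ¬ FaceHasTwoBig R d → ¬ FaceHasTwoBig R d′
  bad-resp {d} {d′} s bad (x , y , x≢y , ox , oy , dx , dy) = bad (x , y , x≢y , move-on ox , move-on oy , dx , dy)
    where
    move-on : ∀ {x} → OnFace R d′ x → OnFace R d x
    move-on (k , e) = let m , q = O⇒iter φ₀-inj (sameFace⇒O s ◅◅ O-iter k d′) in m , trans (cong tl q) e

  Conclusion : Set
  Conclusion = ∃[ d₁ ] ∃[ d₂ ] ∃[ d₃ ]
    (tl d₁ ≡ v × tl d₂ ≡ v × tl d₃ ≡ v × ¬ SameFace R d₁ d₂ × ¬ SameFace R d₁ d₃ × ¬ SameFace R d₂ d₃ ×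
     FaceHasTwoBig R d₁ × FaceHasTwoBig R d₂ × FaceHasTwoBig R d₃)

  deg≤5 : degree G v ≤ 5
  deg≤5 = ≤-reflexive deg

  module At (w₀ : Fin n) (a₀ : Adj G v w₀) where

    open From w₀ a₀

    Bad : ℕ → Set
    Bad k = ¬ FaceHasTwoBig R (δ k)

    abstract

      -- w t is the vertex through which the facial walk leaving v through w k first returns to v.
      return : ∀ k → Bad k → ∃[ t ] (t < 5 × LowLink G v (w k) (w t) × SF (δ k) (δ (suc t)))
      return k bad with period φ₀-inj (δ k)
      ... | m , e with least (λ i → tl (iter φ (suc i) (δ k)) Finₚ.≟ v) m (cong tl e)
      ... | zero , at-v , _ = contradiction at-v (adj-≢ G (vw k) ∘ sym)
      ... | suc j , at-v , before with w-nbr (flipAdj G (subst (Adj G (tl (iter φ (suc j) (δ k)))) at-v (arc (iter φ (suc j) (δ k)))))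
      -- The walk enters v from `w t`, so its next dart leaves along `w (suc t)`.
      ...   | t , t<5 , wt = t , t<5 , subst (LowLink G v (w k)) (sym wt) (walk j (n<1+n j)) ,
              (suc (suc j) , at-v , cong₂ (rot R) at-v (sym wt))
        where
        low : ∀ i → i < suc j → Low G (tl (iter φ (suc i) (δ k))) × tl (iter φ (suc i) (δ k)) ≢ v
        -- A vertex of degree at least five on the walk would, together with v, make the face good.
        low i i<j = ≤-pred (≰⇒> λ big → bad (tl (iter φ (suc i) (δ k)) , v , before i i<j , (suc i , refl) , (0 , refl) , big , ≤-reflexive (sym deg))) , before i i<j
        walk : ∀ i → i < suc j → LowLink G v (w k) (tl (iter φ (suc i) (δ k)))
        walk zero h = stop (low zero h)
        walk (suc i) h = path-trans (walk i (≤-trans (n≤1+n _) h))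
          (move (low i (≤-trans (n≤1+n _) h)) (arc (iter φ (suc i) (δ k))) (stop (low (suc i) h)))

    not-v : ∀ {x y} → LowLink G v x y → Path G (_≢ v) x y
    not-v = path-map proj₂

    w-≢ : ∀ {i j} → i < 5 → j < 5 → i ≢ j → w i ≢ w j
    w-≢ i< j< ne e = ne (w-inj _ _ i< j< e)

    -- A common face of consecutive corners would make v w₀ a bridge.
    adjacent-corners : ¬ SF (δ 0) (δ 1)
    adjacent-corners sf = bridgeless {G = G} min a₀ λ vt t≢w₀ r →
      let t , t<5 , e = w-nbr vt in split-one pl sf t t<5 (λ q → t≢w₀ (trans (sym e) (cong w q))) (subst (Path G (_≢ v) w₀) (sym e) r)

    no-chain : ∀ i j k → i < 5 → j < 5 → k < 5 → i ≢ j → i ≢ k → j ≢ k → LowLink G v (w i) (w j) → ¬ LowLink G v (w i) (w k)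
    no-chain i j k i< j< k< ij ik jk p q = low-links {G = G} min deg≤5 (triple (w i) (w j) (w k))
      (triple-inj (w-≢ i< j< ij) (w-≢ i< k< ik) (w-≢ j< k< jk))
      (λ { zero → vw i ; (suc zero) → vw j ; (suc (suc zero)) → vw k })
      λ { zero → stop (path-start p) ; (suc zero) → p ; (suc (suc zero)) → q }

    0<5 : 0 < 5
    0<5 = s≤s z≤n
    1<5 : 1 < 5
    1<5 = s≤s (s≤s z≤n)
    2<5 : 2 < 5
    2<5 = s≤s (s≤s (s≤s z≤n))
    3<5 : 3 < 5
    3<5 = s≤s (s≤s (s≤s (s≤s z≤n)))
    4<5 : 4 < 5
    4<5 = s≤s (s≤s (s≤s (s≤s (s≤s z≤n))))

    w-6 : w 6 ≡ w 1
    w-6 = cong (rot R v) w-5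

  next-corner : ∀ w₀ (a₀ : Adj G v w₀) k → let open From w₀ a₀ in ¬ SF (δ k) (δ (suc k))
  next-corner w₀ a₀ k = At.adjacent-corners (w k) (vw k)
    where open From w₀ a₀

  module Twice (w₀ : Fin n) (a₀ : Adj G v w₀) (sf : SF (From.δ w₀ a₀ 0) (From.δ w₀ a₀ 2)) where

    open From w₀ a₀
    open At w₀ a₀

    separated : ∀ s t → s < 2 → 2 ≤ t → t < 5 → ¬ Path G (_≢ v) (w s) (w t)
    separated = split-two pl sf

    unlinked : ∀ i j k → 2 ≤ i → 2 ≤ j → 2 ≤ k → i < 5 → j < 5 → k < 5 → i ≢ j → i ≢ k → j ≢ k →
      (∀ t → t < 5 → t ≡ 0 ⊎ t ≡ 1 ⊎ t ≡ i ⊎ t ≡ j ⊎ t ≡ k) → ¬ LowLink G v (w i) (w j)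
    unlinked i j k 2≤i 2≤j 2≤k i< j< k< ij ik jk cov =
      cut-links {G = G} min deg≤5 (w 0) (w 1) (triple (w i) (w j) (w k)) (vw 0) (vw 1)
        (λ { zero → vw i ; (suc zero) → vw j ; (suc (suc zero)) → vw k })
        (triple-inj (w-≢ i< j< ij) (w-≢ i< k< ik) (w-≢ j< k< jk)) nb
        (λ { zero r → separated 0 i (s≤s z≤n) 2≤i i< (path-sym r) ; (suc zero) r → separated 0 j (s≤s z≤n) 2≤j j< (path-sym r)
           ; (suc (suc zero)) r → separated 0 k (s≤s z≤n) 2≤k k< (path-sym r) })
        (λ { zero r → separated 1 i (s≤s (s≤s z≤n)) 2≤i i< (path-sym r) ; (suc zero) r → separated 1 j (s≤s (s≤s z≤n)) 2≤j j< (path-sym r)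
           ; (suc (suc zero)) r → separated 1 k (s≤s (s≤s z≤n)) 2≤k k< (path-sym r) })
      where
      nb : ∀ {x} → Adj G v x → x ≡ w 0 ⊎ x ≡ w 1 ⊎ ∃[ l ] x ≡ triple (w i) (w j) (w k) l
      nb vx = let t , t<5 , e = w-nbr vx in case cov t t<5 of λ
        { (inj₁ q) → inj₁ (trans (sym e) (cong w q)) ; (inj₂ (inj₁ q)) → inj₂ (inj₁ (trans (sym e) (cong w q)))
        ; (inj₂ (inj₂ (inj₁ q))) → inj₂ (inj₂ (# 0 , trans (sym e) (cong w q)))
        ; (inj₂ (inj₂ (inj₂ (inj₁ q)))) → inj₂ (inj₂ (# 1 , trans (sym e) (cong w q)))
        ; (inj₂ (inj₂ (inj₂ (inj₂ q)))) → inj₂ (inj₂ (# 2 , trans (sym e) (cong w q))) }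

    cases : ∀ t → t < 5 → t ≡ 0 ⊎ t ≡ 1 ⊎ t ≡ 2 ⊎ t ≡ 3 ⊎ t ≡ 4
    cases 0 _ = inj₁ refl
    cases 1 _ = inj₂ (inj₁ refl)
    cases 2 _ = inj₂ (inj₂ (inj₁ refl))
    cases 3 _ = inj₂ (inj₂ (inj₂ (inj₁ refl)))
    cases 4 _ = inj₂ (inj₂ (inj₂ (inj₂ refl)))
    cases (suc (suc (suc (suc (suc _))))) (s≤s (s≤s (s≤s (s≤s (s≤s ())))))

    unlinked-23 : ¬ LowLink G v (w 2) (w 3)
    unlinked-23 = unlinked 2 3 4 (s≤s (s≤s z≤n)) (s≤s (s≤s z≤n)) (s≤s (s≤s z≤n)) 2<5 3<5 4<5 (λ ()) (λ ()) (λ ()) cases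

    unlinked-34 : ¬ LowLink G v (w 3) (w 4)
    unlinked-34 = unlinked 3 4 2 (s≤s (s≤s z≤n)) (s≤s (s≤s z≤n)) (s≤s (s≤s z≤n)) 3<5 4<5 2<5 (λ ()) (λ ()) (λ ()) λ t h → case cases t h of λ
      { (inj₁ e) → inj₁ e ; (inj₂ (inj₁ e)) → inj₂ (inj₁ e) ; (inj₂ (inj₂ (inj₁ e))) → inj₂ (inj₂ (inj₂ (inj₂ e)))
      ; (inj₂ (inj₂ (inj₂ (inj₁ e)))) → inj₂ (inj₂ (inj₁ e)) ; (inj₂ (inj₂ (inj₂ (inj₂ e)))) → inj₂ (inj₂ (inj₂ (inj₁ e))) }

    unlinked-24 : ¬ LowLink G v (w 2) (w 4)
    unlinked-24 = unlinked 2 4 3 (s≤s (s≤s z≤n)) (s≤s (s≤s z≤n)) (s≤s (s≤s z≤n)) 2<5 4<5 3<5 (λ ()) (λ ()) (λ ()) λ t h → case cases t h of λ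
      { (inj₁ e) → inj₁ e ; (inj₂ (inj₁ e)) → inj₂ (inj₁ e) ; (inj₂ (inj₂ (inj₁ e))) → inj₂ (inj₂ (inj₁ e))
      ; (inj₂ (inj₂ (inj₂ (inj₁ e)))) → inj₂ (inj₂ (inj₂ (inj₂ e))) ; (inj₂ (inj₂ (inj₂ (inj₂ e)))) → inj₂ (inj₂ (inj₂ (inj₁ e))) }

    back : ∀ s t → s < 2 → 2 ≤ t → t < 5 → ¬ LowLink G v (w t) (w s)
    back s t s< 2≤t t< r = separated s t s< 2≤t t< (path-sym (not-v r))

    -- The walk of a bad face returns through some `w t`: t below 2 is separated from 2, t = 2 would
    -- be a bridge, and 3 and 4 are excluded by (3).
    not-bad-2 : ¬ Bad 2
    not-bad-2 bad with return 2 bad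
    ... | 0 , _ , r , _ = back 0 2 (s≤s z≤n) (s≤s (s≤s z≤n)) 2<5 r
    ... | 1 , _ , r , _ = back 1 2 (s≤s (s≤s z≤n)) (s≤s (s≤s z≤n)) 2<5 r
    ... | 2 , _ , _ , s = next-corner w₀ a₀ 2 s
    ... | 3 , _ , r , _ = unlinked-23 r
    ... | 4 , _ , r , _ = unlinked-24 r
    ... | suc (suc (suc (suc (suc _)))) , s≤s (s≤s (s≤s (s≤s (s≤s ())))) , _

    not-bad-3 : ¬ Bad 3
    not-bad-3 bad with return 3 bad
    ... | 0 , _ , r , _ = back 0 3 (s≤s z≤n) (s≤s (s≤s z≤n)) 3<5 r
    ... | 1 , _ , r , _ = back 1 3 (s≤s (s≤s z≤n)) (s≤s (s≤s z≤n)) 3<5 r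
    ... | 2 , _ , r , _ = unlinked-23 (path-sym r)
    ... | 3 , _ , _ , s = next-corner w₀ a₀ 3 s
    ... | 4 , _ , r , _ = unlinked-34 r
    ... | suc (suc (suc (suc (suc _)))) , s≤s (s≤s (s≤s (s≤s (s≤s ())))) , _

    not-bad-4 : ¬ Bad 4
    not-bad-4 bad with return 4 bad
    ... | 0 , _ , r , _ = back 0 4 (s≤s z≤n) (s≤s (s≤s z≤n)) 4<5 r
    ... | 1 , _ , r , _ = back 1 4 (s≤s (s≤s z≤n)) (s≤s (s≤s z≤n)) 4<5 r
    ... | 2 , _ , r , _ = unlinked-24 (path-sym r)
    ... | 3 , _ , r , _ = unlinked-34 (path-sym r)
    ... | 4 , _ , _ , s = next-corner w₀ a₀ 4 s
    ... | suc (suc (suc (suc (suc _)))) , s≤s (s≤s (s≤s (s≤s (s≤s ())))) , _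

    -- Then the face has corners at 0, 2 and 3. Renumbered from `w 3`, it also separates 3, 4 from
    -- 0, 1, 2, which isolates `w 2` behind a bridge.
    not-03 : ¬ SF (δ 0) (δ 3)
    not-03 s = bridgeless {G = G} min (vw 2) alone
      where
      module F₃ = From (w 3) (vw 3)
      apart : ∀ i j → i < 2 → 2 ≤ j → j < 5 → ¬ Path G (_≢ v) (F₃.w i) (F₃.w j)
      apart = F₃.split-two pl (subst (SF (δ 3)) (sym (δ-≡ 5 0 w-5)) (sf-sym s))
      F₃w₄ : F₃.w 4 ≡ w 2
      F₃w₄ = cong (rot R v) w-6
      alone : ∀ {t} → Adj G v t → t ≢ w 2 → ¬ Path G (_≢ v) (w 2) t
      alone vt t≢ r with w-nbr vt
      ... | 0 , _ , refl = separated 0 2 (s≤s z≤n) (s≤s (s≤s z≤n)) 2<5 (path-sym r)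
      ... | 1 , _ , refl = separated 1 2 (s≤s (s≤s z≤n)) (s≤s (s≤s z≤n)) 2<5 (path-sym r)
      ... | 2 , _ , refl = t≢ refl
      ... | 3 , _ , refl = apart 0 4 (s≤s z≤n) (s≤s (s≤s z≤n)) 4<5 (path-sym (subst (λ x → Path G (_≢ v) x (w 3)) (sym F₃w₄) r))
      ... | 4 , _ , refl = apart 1 4 (s≤s (s≤s z≤n)) (s≤s (s≤s z≤n)) 4<5 (path-sym (subst (λ x → Path G (_≢ v) x (w 4)) (sym F₃w₄) r))
      ... | suc (suc (suc (suc (suc _)))) , s≤s (s≤s (s≤s (s≤s (s≤s ())))) , _

    not-04 : ¬ SF (δ 0) (δ 4)
    not-04 s = next-corner w₀ a₀ 4 (subst (SF (δ 4)) (sym (δ-≡ 5 0 w-5)) (sf-sym s))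

    good : ∀ k → ¬ Bad k → FaceHasTwoBig R (δ k)
    good k = decidable-stable (good? (δ k))

    conclusion : Conclusion
    -- Only the face of `δ 1` may be bad; `δ 0` lies on the face of `δ 2`.
    conclusion = δ 0 , δ 3 , δ 4 , refl , refl , refl , not-03 , not-04 , next-corner w₀ a₀ 3 ,
      good 0 (not-bad-2 ∘ bad-resp sf) , good 3 not-bad-3 , good 4 not-bad-4

  module Distinct (w₀ : Fin n) (a₀ : Adj G v w₀) (skip : ∀ k → k < 5 → ¬ SF (From.δ w₀ a₀ k) (From.δ w₀ a₀ (2 + k))) where

    open From w₀ a₀
    open At w₀ a₀

    wrap-0 : ∀ k → SF (δ 0) (δ k) → SF (δ k) (δ 5)
    wrap-0 k s = subst (SF (δ k)) (sym (δ-≡ 5 0 w-5)) (sf-sym s)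

    -- Two of five cyclic positions are at distance one or two; pairs that wrap around are shifted
    -- by the period.
    ordered : ∀ i j → i < j → j < 5 → ¬ SF (δ i) (δ j)
    ordered 0 1 _ _ = next-corner w₀ a₀ 0
    ordered 0 2 _ _ = skip 0 0<5
    ordered 0 3 _ _ s = skip 3 3<5 (wrap-0 3 s)
    ordered 0 4 _ _ s = next-corner w₀ a₀ 4 (wrap-0 4 s)
    ordered 1 2 _ _ = next-corner w₀ a₀ 1
    ordered 1 3 _ _ = skip 1 1<5
    ordered 1 4 _ _ s = skip 4 4<5 (subst (SF (δ 4)) (sym (δ-≡ 6 1 w-6)) (sf-sym s))
    ordered 2 3 _ _ = next-corner w₀ a₀ 2
    ordered 2 4 _ _ = skip 2 2<5
    ordered 3 4 _ _ = next-corner w₀ a₀ 3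
    ordered (suc _) 1 (s≤s ()) _
    ordered (suc (suc _)) 2 (s≤s (s≤s ())) _
    ordered (suc (suc (suc _))) 3 (s≤s (s≤s (s≤s ()))) _
    ordered (suc (suc (suc (suc _)))) 4 (s≤s (s≤s (s≤s (s≤s ())))) _
    ordered _ (suc (suc (suc (suc (suc _))))) _ (s≤s (s≤s (s≤s (s≤s (s≤s ())))))

    same : ∀ i j → i < 5 → j < 5 → SF (δ i) (δ j) → i ≡ j
    same i j i< j< s = decidable-stable (i ≟ j) λ ne → case <-cmp i j of λ
      { (tri< lt _ _) → ordered i j lt j< s ; (tri≈ _ e _) → ne e ; (tri> _ _ gt) → ordered j i gt i< (sf-sym s) }

    -- As the corners lie on distinct faces, the walk of a bad face must return through the
    -- preceding neighbour. A return with t = 4 leads to index 5, which is corner 0.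
    link-prev : ∀ k → k < 4 → Bad (suc k) → LowLink G v (w (suc k)) (w k)
    link-prev k k<4 bad with return (suc k) bad
    ... | t , t<5 , r , s with suc t ≤? 4
    ...   | yes t<4 = subst (λ m → LowLink G v (w (suc k)) (w m)) (suc-injective (sym (same (suc k) (suc t) (s≤s k<4) (s≤s t<4) s))) r
    ...   | no t≮4 = contradiction (same (suc k) 0 (s≤s k<4) 0<5 (subst (SF (δ (suc k))) (trans (cong δ (cong suc t≡4)) (δ-≡ 5 0 w-5)) s)) λ ()
      where
      t≡4 : t ≡ 4
      t≡4 = ≤-antisym (≤-pred t<5) (≤-pred (≰⇒> t≮4))

    link-04 : Bad 0 → LowLink G v (w 0) (w 4)
    link-04 bad with return 0 bad
    ... | t , t<5 , r , s with suc t ≤? 4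
    ...   | yes t<4 = contradiction (same 0 (suc t) 0<5 (s≤s t<4) s) λ ()
    ...   | no t≮4 = subst (λ m → LowLink G v (w 0) (w m)) (≤-antisym (≤-pred t<5) (≤-pred (≰⇒> t≮4))) r

    consecutive : ∀ k → k < 3 → Bad (suc k) → Bad (suc (suc k)) → ⊥
    consecutive k k<3 b b′ = no-chain (suc k) k (suc (suc k)) (s≤s (≤-trans k<3 (n≤1+n 3))) (≤-trans k<3 (≤-trans (n≤1+n 3) (n≤1+n 4))) (s≤s (s≤s k<3))
      (λ ()) (λ ()) (λ ()) (link-prev k (≤-trans k<3 (n≤1+n 3)) b) (path-sym (link-prev (suc k) (s≤s k<3) b′))

    bad-01 : Bad 0 → Bad 1 → ⊥
    bad-01 b b′ = no-chain 0 4 1 0<5 4<5 1<5 (λ ()) (λ ()) (λ ()) (link-04 b) (path-sym (link-prev 0 (s≤s z≤n) b′))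

    bad-40 : Bad 4 → Bad 0 → ⊥
    bad-40 b b′ = no-chain 4 3 0 4<5 3<5 0<5 (λ ()) (λ ()) (λ ()) (link-prev 3 (s≤s (s≤s (s≤s (s≤s z≤n)))) b) (path-sym (link-04 b′))

    good : ∀ k → ¬ Bad k → FaceHasTwoBig R (δ k)
    good k = decidable-stable (good? (δ k))

    three : ∀ i j k → i < j → j < k → k < 5 → FaceHasTwoBig R (δ i) → FaceHasTwoBig R (δ j) → FaceHasTwoBig R (δ k) → Conclusion
    three i j k ij jk k< gi gj gk = δ i , δ j , δ k , refl , refl , refl , ordered i j ij (<-trans jk k<) , ordered i k (<-trans ij jk) k< , ordered j k jk k< , gi , gj , gk

    -- Bad corners are independent in a 5-cycle, so there are at most two.
    conclusion : Conclusion
    conclusion with good? (δ 0)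
    ... | no b₀ with good? (δ 2)
    ...   | yes g₂ = three 1 2 4 (s≤s (s≤s z≤n)) (s≤s (s≤s (s≤s z≤n))) 4<5 (good 1 (bad-01 b₀)) g₂ (good 4 λ b₄ → bad-40 b₄ b₀)
    ...   | no b₂ = three 1 3 4 (s≤s (s≤s z≤n)) (s≤s (s≤s (s≤s (s≤s z≤n)))) 4<5 (good 1 (bad-01 b₀)) (good 3 (consecutive 1 (s≤s (s≤s z≤n)) b₂)) (good 4 λ b₄ → bad-40 b₄ b₀)
    conclusion | yes g₀ with good? (δ 1) | good? (δ 3)
    ... | yes g₁ | yes g₃ = three 0 1 3 (s≤s z≤n) (s≤s (s≤s z≤n)) 3<5 g₀ g₁ g₃
    ... | yes g₁ | no b₃ = three 0 1 4 (s≤s z≤n) (s≤s (s≤s z≤n)) 4<5 g₀ g₁ (good 4 (consecutive 2 (s≤s (s≤s (s≤s z≤n))) b₃))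
    ... | no b₁ | yes g₃ = three 0 2 3 (s≤s z≤n) (s≤s (s≤s (s≤s z≤n))) 3<5 g₀ (good 2 (consecutive 0 (s≤s z≤n) b₁)) g₃
    ... | no b₁ | no b₃ = three 0 2 4 (s≤s z≤n) (s≤s (s≤s (s≤s z≤n))) 4<5 g₀ (good 2 (consecutive 0 (s≤s z≤n) b₁)) (good 4 (consecutive 2 (s≤s (s≤s (s≤s z≤n))) b₃))

  three-good-faces : Conclusion
  three-good-faces with first
  ... | w₀ , a₀ = decide (Finₚ.any? λ (k : Fin 5) → sf? (δ (Fin.toℕ k)) (δ (2 + Fin.toℕ k)))
    where
    open From w₀ a₀
    decide : Dec (∃[ k ] SF (δ (Fin.toℕ {5} k)) (δ (2 + Fin.toℕ k))) → Conclusion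
    -- Renumbering from `w k` puts the repeated face at 0 and 2.
    decide (yes (k , s)) = Twice.conclusion (w (Fin.toℕ k)) (vw (Fin.toℕ k)) s
    decide (no none) = Distinct.conclusion w₀ a₀ λ k k<5 s → none (Fin.fromℕ< k<5 ,
      subst (λ m → SF (δ m) (δ (2 + m))) (sym (Finₚ.toℕ-fromℕ< k<5)) s)

theorem2 : ∀ {n} (G : Graph n) → MinimalNon4ChoosablePlanar G →
    (R : Rotation G) → IsPlane R →
    (v : Fin n) → degree G v ≡ 5 →
    ∃[ d₁ ] ∃[ d₂ ] ∃[ d₃ ]
    (tl d₁ ≡ v × tl d₂ ≡ v × tl d₃ ≡ v ×
    ¬ SameFace R d₁ d₂ × ¬ SameFace R d₁ d₃ × ¬ SameFace R d₂ d₃ ×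
    FaceHasTwoBig R d₁ × FaceHasTwoBig R d₂ × FaceHasTwoBig R d₃)
theorem2 G min R pl v deg = Faces.three-good-faces min R pl v deg
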